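{- Let $\mathcal{C}$ be a finite abstract simplicial complex, let $\mathcal{V}=\{V_1,\ldots,V_n\}$ be a partition of $V(\mathcal{C})$, let $d\ge0$ be an integer, and let $\eta\in\{\eta_\pi,\eta_H\}$. If $\eta(\mathcal{C}[V_I])\ge|I|-d+1$ for all nonempty $I\subseteq[n]$, where $V_I=\bigcup_{i\in I}V_i$, then $\mathbf{RG}(\mathcal{C},\mathcal{V};n-d)$ is connected.
   Context: $\mathcal{C}[X]=\{\sigma\in\mathcal{C}:\sigma\subseteq X\}$. $\eta_\pi(\mathcal{K})$ (resp. $\eta_H(\mathcal{K})$) is $2$ plus the largest $k\ge-2$ such that $\mathcal{K}$ is homotopically $j$-connected (resp. $\widetilde H_j(\mathcal{K};\mathbb{Q})=0$) for all $-1\le j\le k$, where $(-1)$-connectedness / $\widetilde H_{ -1}=0$ means $\mathcal{K}$ has at least one vertex; possibly $\infty$. A partial colorful simplex is a simplex of $\mathcal{C}$ with at most one vertex from each class $V_i$. $\mathbf{RG}(\mathcal{C},\mathcal{V};k)$ has as vertices the partial colorful simplices of cardinality $k$, two being adjacent if their union is a simplex of $\mathcal{C}$ of cardinality $k+1$. -}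

module Defs where

open import Algebra.Bundles using (CommutativeMonoid)
import Algebra.Properties.CommutativeSemigroup as CommutativeSemigroup
open import Data.Bool.Base using (if_then_else_)
open import Data.Fin.Base using (Fin)
import Data.Fin.Properties as Fin
open import Data.Fin.Subset using (Subset; _∈_; _⊆_; _∩_; _∪_; ⋃; ⁅_⁆; ∣_∣; Nonempty; Empty) renaming (⊥ to ∅)
open import Data.Fin.Subset.Properties using (_∈?_; _⊆?_; ⊆-min; ⊆-trans)
open import Data.Integer.Base as ℤ using (ℤ; +_; 1ℤ)
open import Data.List.Base using (map; filter; allFin)
open import Data.Nat.Base as ℕ using (ℕ; zero; suc)
import Data.Nat.Properties as ℕ
open import Data.Product.Base using (Σ-syntax; ∃-syntax; _×_; _,_; proj₁)
open import Data.Rational.Base as ℚ using (ℚ; 0ℚ; 1ℚ; ½)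
import Data.Rational.Properties as ℚ
open import Data.Vec.Base using (tabulate)
import Data.Vec.Functional as Vector
open import Function.Bundles using (_⇔_)
open import Level using (0ℓ)
open import Relation.Binary.Construct.Closure.ReflexiveTransitive using (Star)
open import Relation.Binary.Core using (Rel)
open import Relation.Binary.PropositionalEquality using (_≡_; _≢_; refl; sym; trans; cong; cong₂; subst; subst₂; module ≡-Reasoning)
open import Relation.Nullary.Decidable using (does; _×-dec_)
open import Relation.Unary using (Pred; Decidable)

IsCauchy : (ℕ → ℚ) → Set
IsCauchy s = ∀ ε → 0ℚ ℚ.< ε → ∃[ N ] (∀ m n → N ℕ.≤ m → N ℕ.≤ n → ℚ.∣ s m ℚ.- s n ∣ ℚ.< ε)

record ℝ : Set where
  constructor mkℝ
  field
    seq    : ℕ → ℚ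
    cauchy : IsCauchy seq

open ℝ public

private abstract
  sum-diff : ∀ a b c d → (a ℚ.+ b) ℚ.- (c ℚ.+ d) ≡ (a ℚ.- c) ℚ.+ (b ℚ.- d)
  sum-diff a b c d = trans (cong (a ℚ.+ b ℚ.+_) (ℚ.neg-distrib-+ c d)) (interchange a b (ℚ.- c) (ℚ.- d))
    where open CommutativeSemigroup (CommutativeMonoid.commutativeSemigroup ℚ.+-0-commutativeMonoid) using (interchange)

  diff-add : ∀ a b → (a ℚ.- b) ℚ.+ b ≡ a
  diff-add a b = trans (ℚ.+-assoc a (ℚ.- b) b) (trans (cong (a ℚ.+_) (ℚ.+-inverseˡ b)) (ℚ.+-identityʳ a))

  *-distribˡ-- : ∀ a b c → a ℚ.* (b ℚ.- c) ≡ a ℚ.* b ℚ.- a ℚ.* c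
  *-distribˡ-- a b c = trans (ℚ.*-distribˡ-+ a b (ℚ.- c)) (cong (a ℚ.* b ℚ.+_) (sym (ℚ.neg-distribʳ-* a c)))

  prod-diff : ∀ a b c d → a ℚ.* b ℚ.- c ℚ.* d ≡ a ℚ.* (b ℚ.- d) ℚ.+ d ℚ.* (a ℚ.- c)
  prod-diff a b c d = sym (let open ≡-Reasoning in begin
    a ℚ.* (b ℚ.- d) ℚ.+ d ℚ.* (a ℚ.- c)
      ≡⟨ cong₂ ℚ._+_ (*-distribˡ-- a b d) (*-distribˡ-- d a c) ⟩
    (a ℚ.* b ℚ.- a ℚ.* d) ℚ.+ (d ℚ.* a ℚ.- d ℚ.* c)
      ≡⟨ cong₂ (λ p q → (a ℚ.* b ℚ.- a ℚ.* d) ℚ.+ (p ℚ.- q)) (ℚ.*-comm d a) (ℚ.*-comm d c) ⟩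
    (a ℚ.* b ℚ.- a ℚ.* d) ℚ.+ (a ℚ.* d ℚ.- c ℚ.* d)
      ≡⟨ ℚ.+-assoc (a ℚ.* b ℚ.- a ℚ.* d) (a ℚ.* d) (ℚ.- (c ℚ.* d)) ⟨
    ((a ℚ.* b ℚ.- a ℚ.* d) ℚ.+ a ℚ.* d) ℚ.- c ℚ.* d
      ≡⟨ cong (ℚ._- c ℚ.* d) (diff-add (a ℚ.* b) (a ℚ.* d)) ⟩
    a ℚ.* b ℚ.- c ℚ.* d ∎)

  half-pos : ∀ {ε} → 0ℚ ℚ.< ε → 0ℚ ℚ.< ½ ℚ.* ε
  half-pos {ε} 0<ε = subst (ℚ._< ½ ℚ.* ε) (ℚ.*-zeroʳ ½) (ℚ.*-monoʳ-<-pos ½ 0<ε)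

  halves : ∀ ε → ½ ℚ.* ε ℚ.+ ½ ℚ.* ε ≡ ε
  halves ε = trans (sym (ℚ.*-distribʳ-+ ε ½ ½)) (ℚ.*-identityˡ ε)

  +-cauchy : ∀ s t → IsCauchy s → IsCauchy t → IsCauchy (λ n → s n ℚ.+ t n)
  +-cauchy s t cs ct ε 0<ε with cs (½ ℚ.* ε) (half-pos 0<ε) | ct (½ ℚ.* ε) (half-pos 0<ε)
  ... | N₁ , p | N₂ , q = N₁ ℕ.⊔ N₂ , λ m n N≤m N≤n → let open ℚ.≤-Reasoning in begin-strict
    ℚ.∣ (s m ℚ.+ t m) ℚ.- (s n ℚ.+ t n) ∣
      ≡⟨ cong ℚ.∣_∣ (sum-diff (s m) (t m) (s n) (t n)) ⟩
    ℚ.∣ (s m ℚ.- s n) ℚ.+ (t m ℚ.- t n) ∣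
      ≤⟨ ℚ.∣p+q∣≤∣p∣+∣q∣ (s m ℚ.- s n) (t m ℚ.- t n) ⟩
    ℚ.∣ s m ℚ.- s n ∣ ℚ.+ ℚ.∣ t m ℚ.- t n ∣
      <⟨ ℚ.+-mono-< (p m n (ℕ.m⊔n≤o⇒m≤o N₁ N₂ N≤m) (ℕ.m⊔n≤o⇒m≤o N₁ N₂ N≤n))
                    (q m n (ℕ.m⊔n≤o⇒n≤o N₁ N₂ N≤m) (ℕ.m⊔n≤o⇒n≤o N₁ N₂ N≤n)) ⟩
    ½ ℚ.* ε ℚ.+ ½ ℚ.* ε ≡⟨ halves ε ⟩
    ε ∎

  neg-cauchy : ∀ s → IsCauchy s → IsCauchy (λ n → ℚ.- s n)
  neg-cauchy s cs ε 0<ε with cs ε 0<ε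
  ... | N , p = N , λ m n N≤m N≤n → subst (ℚ._< ε) (eq (s m) (s n)) (p m n N≤m N≤n)
    where
    eq : ∀ a b → ℚ.∣ a ℚ.- b ∣ ≡ ℚ.∣ ℚ.- a ℚ.- ℚ.- b ∣
    eq a b = trans (sym (ℚ.∣-p∣≡∣p∣ (a ℚ.- b)))
                   (cong ℚ.∣_∣ (ℚ.neg-distrib-+ a (ℚ.- b)))

  EventuallyBounded : (ℕ → ℚ) → Set
  EventuallyBounded s = ∃[ B ] (0ℚ ℚ.< B × (∃[ N ] (∀ n → N ℕ.≤ n → ℚ.∣ s n ∣ ℚ.< B)))

  bounded : ∀ s → IsCauchy s → EventuallyBounded s
  bounded s cs with cs 1ℚ (ℚ.positive⁻¹ 1ℚ)
  ... | N , p = 1ℚ ℚ.+ ℚ.∣ s N ∣ , ℚ.+-mono-<-≤ (ℚ.positive⁻¹ 1ℚ) (ℚ.0≤∣p∣ (s N)) , N ,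
    λ n N≤n → let open ℚ.≤-Reasoning in begin-strict
    ℚ.∣ s n ∣                           ≡⟨ cong ℚ.∣_∣ (sym (diff-add (s n) (s N))) ⟩
    ℚ.∣ (s n ℚ.- s N) ℚ.+ s N ∣         ≤⟨ ℚ.∣p+q∣≤∣p∣+∣q∣ (s n ℚ.- s N) (s N) ⟩
    ℚ.∣ s n ℚ.- s N ∣ ℚ.+ ℚ.∣ s N ∣     <⟨ ℚ.+-monoˡ-< ℚ.∣ s N ∣ (p n N N≤n ℕ.≤-refl) ⟩
    1ℚ ℚ.+ ℚ.∣ s N ∣                    ∎

  shrink : ∀ B ε → 0ℚ ℚ.< B → 0ℚ ℚ.< ε → ∃[ δ ] (0ℚ ℚ.< δ × B ℚ.* δ ≡ ε)
  shrink B ε 0<B 0<ε = B⁻¹ ℚ.* ε , subst (ℚ._< B⁻¹ ℚ.* ε) (ℚ.*-zeroʳ B⁻¹) (ℚ.*-monoʳ-<-pos B⁻¹ {{ℚ.1/pos⇒pos B}} 0<ε) ,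
    trans (sym (ℚ.*-assoc B B⁻¹ ε)) (trans (cong (ℚ._* ε) (ℚ.*-inverseʳ B)) (ℚ.*-identityˡ ε))
    where
    instance
      B-pos : ℚ.Positive B
      B-pos = ℚ.positive 0<B
      B-nonZero : ℚ.NonZero B
      B-nonZero = ℚ.pos⇒nonZero B
    B⁻¹ : ℚ
    B⁻¹ = ℚ.1/ B

  *-bound : ∀ {a b B δ} → 0ℚ ℚ.< B → ℚ.∣ a ∣ ℚ.< B → ℚ.∣ b ∣ ℚ.< δ → ℚ.∣ a ℚ.* b ∣ ℚ.≤ B ℚ.* δ
  *-bound {a} {b} {B} {δ} 0<B a<B b<δ = let open ℚ.≤-Reasoning in begin
    ℚ.∣ a ℚ.* b ∣         ≡⟨ ℚ.∣p*q∣≡∣p∣*∣q∣ a b ⟩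
    ℚ.∣ a ∣ ℚ.* ℚ.∣ b ∣   ≤⟨ ℚ.*-monoʳ-≤-nonNeg ℚ.∣ b ∣ {{ℚ.nonNegative (ℚ.0≤∣p∣ b)}} (ℚ.<⇒≤ a<B) ⟩
    B ℚ.* ℚ.∣ b ∣         ≤⟨ ℚ.*-monoˡ-≤-nonNeg B {{ℚ.nonNegative (ℚ.<⇒≤ 0<B)}} (ℚ.<⇒≤ b<δ) ⟩
    B ℚ.* δ               ∎

  half-< : ∀ {x} → 0ℚ ℚ.< x → ½ ℚ.* x ℚ.< x
  half-< {x} 0<x = subst₂ ℚ._<_ (ℚ.+-identityˡ (½ ℚ.* x)) (halves x)
                     (ℚ.+-monoˡ-< (½ ℚ.* x) (half-pos 0<x))

  *-cauchy : ∀ s t → IsCauchy s → IsCauchy t → IsCauchy (λ n → s n ℚ.* t n)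
  *-cauchy s t cs ct ε 0<ε
    with bounded s cs | bounded t ct
  ... | B , 0<B , M₁ , bs | C , 0<C , M₂ , bt
    with shrink B (½ ℚ.* (½ ℚ.* ε)) 0<B (half-pos (half-pos 0<ε)) | shrink C (½ ℚ.* ε) 0<C (half-pos 0<ε)
  ... | δ , 0<δ , Bδ≡ | γ , 0<γ , Cγ≡
    with ct δ 0<δ | cs γ 0<γ
  ... | N₁ , p | N₂ , q = (M₁ ℕ.⊔ M₂) ℕ.⊔ (N₁ ℕ.⊔ N₂) , λ m n K≤m K≤n →
    let M = M₁ ℕ.⊔ M₂ ; N = N₁ ℕ.⊔ N₂
        M≤m = ℕ.m⊔n≤o⇒m≤o M N K≤m ; N≤m = ℕ.m⊔n≤o⇒n≤o M N K≤m
        M≤n = ℕ.m⊔n≤o⇒m≤o M N K≤n ; N≤n = ℕ.m⊔n≤o⇒n≤o M N K≤n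
        open ℚ.≤-Reasoning in begin-strict
    ℚ.∣ s m ℚ.* t m ℚ.- s n ℚ.* t n ∣
      ≡⟨ cong ℚ.∣_∣ (prod-diff (s m) (t m) (s n) (t n)) ⟩
    ℚ.∣ s m ℚ.* (t m ℚ.- t n) ℚ.+ t n ℚ.* (s m ℚ.- s n) ∣
      ≤⟨ ℚ.∣p+q∣≤∣p∣+∣q∣ (s m ℚ.* (t m ℚ.- t n)) (t n ℚ.* (s m ℚ.- s n)) ⟩
    ℚ.∣ s m ℚ.* (t m ℚ.- t n) ∣ ℚ.+ ℚ.∣ t n ℚ.* (s m ℚ.- s n) ∣
      ≤⟨ ℚ.+-mono-≤
           (*-bound {s m} {t m ℚ.- t n} 0<B (bs m (ℕ.m⊔n≤o⇒m≤o M₁ M₂ M≤m))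
             (p m n (ℕ.m⊔n≤o⇒m≤o N₁ N₂ N≤m) (ℕ.m⊔n≤o⇒m≤o N₁ N₂ N≤n)))
           (*-bound {t n} {s m ℚ.- s n} 0<C (bt n (ℕ.m⊔n≤o⇒n≤o M₁ M₂ M≤n))
             (q m n (ℕ.m⊔n≤o⇒n≤o N₁ N₂ N≤m) (ℕ.m⊔n≤o⇒n≤o N₁ N₂ N≤n))) ⟩
    B ℚ.* δ ℚ.+ C ℚ.* γ
      ≡⟨ cong₂ ℚ._+_ Bδ≡ Cγ≡ ⟩
    ½ ℚ.* (½ ℚ.* ε) ℚ.+ ½ ℚ.* ε
      <⟨ ℚ.+-monoˡ-< (½ ℚ.* ε) (half-< (half-pos 0<ε)) ⟩
    ½ ℚ.* ε ℚ.+ ½ ℚ.* ε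
      ≡⟨ halves ε ⟩
    ε ∎

  const-cauchy : ∀ q → IsCauchy (λ _ → q)
  const-cauchy q ε 0<ε = 0 , λ _ _ _ _ → subst (ℚ._< ε) (sym (cong ℚ.∣_∣ (ℚ.+-inverseʳ q))) 0<ε

infixl 6 _+ᴿ_ _-ᴿ_
infixl 7 _*ᴿ_
infix  4 _≤ᴿ_ _<ᴿ_ _≈ᴿ_

fromℚ : ℚ → ℝ
fromℚ q = mkℝ (λ _ → q) (const-cauchy q)

0ᴿ 1ᴿ : ℝ
0ᴿ = fromℚ 0ℚ
1ᴿ = fromℚ 1ℚ

_+ᴿ_ _-ᴿ_ _*ᴿ_ : ℝ → ℝ → ℝ
mkℝ s cs +ᴿ mkℝ t ct = mkℝ (λ n → s n ℚ.+ t n) (+-cauchy s t cs ct)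
mkℝ s cs -ᴿ mkℝ t ct = mkℝ (λ n → s n ℚ.- t n) (+-cauchy s (λ n → ℚ.- t n) cs (neg-cauchy t ct))
mkℝ s cs *ᴿ mkℝ t ct = mkℝ (λ n → s n ℚ.* t n) (*-cauchy s t cs ct)

record _<ᴿ_ (x y : ℝ) : Set where
  constructor mk<
  field
    gap     : ℚ
    gap-pos : 0ℚ ℚ.< gap
    from    : ℕ
    holds   : ∀ n → from ℕ.≤ n → seq x n ℚ.+ gap ℚ.< seq y n

record _≤ᴿ_ (x y : ℝ) : Set where
  constructor mk≤
  field
    holds : ∀ ε → 0ℚ ℚ.< ε → ∃[ N ] (∀ n → N ℕ.≤ n → seq x n ℚ.< seq y n ℚ.+ ε)

_≈ᴿ_ : Rel ℝ 0ℓ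
x ≈ᴿ y = x ≤ᴿ y × y ≤ᴿ x

sumᴿ : ∀ {k} → (Fin k → ℝ) → ℝ
sumᴿ = Vector.foldr _+ᴿ_ 0ᴿ

-- Distances are measured in the sup norm, which on ℝᵏ induces the
-- Euclidean topology (and uniformity): Within δ x y says ‖x - y‖∞ < δ.
Within : ∀ {k} → ℚ → Rel (Fin k → ℝ) 0ℓ
Within δ x y = ∀ i → x i -ᴿ y i <ᴿ fromℚ δ × y i -ᴿ x i <ᴿ fromℚ δ

-- Continuity of a map between X ⊆ ℝᵏ and Y ⊆ ℝˡ (given by coordinate
-- functions), in Bishop's sense: on a compact X, constructive continuity
-- is uniform continuity.  Such an f also respects equality of reals.
Continuous : ∀ {X Y : Set} {k l} → (X → Fin k → ℝ) → (Y → Fin l → ℝ) → (X → Y) → Set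
Continuous {X} coordX coordY f =
  ∀ ε → 0ℚ ℚ.< ε → ∃[ δ ] (0ℚ ℚ.< δ ×
    (∀ (x y : X) → Within δ (coordX x) (coordX y) → Within ε (coordY (f x)) (coordY (f y))))

normSq : ∀ {k} → (Fin k → ℝ) → ℝ
normSq x = sumᴿ (λ i → x i *ᴿ x i)

record Ball (k : ℕ) : Set where
  constructor mkBall
  field
    coords : Fin k → ℝ
    inside : normSq coords ≤ᴿ 1ᴿ

-- Sphere j is the j-sphere, the boundary of Ball (suc j).
record Sphere (j : ℕ) : Set where
  constructor mkSphere
  field
    coords : Fin (suc j) → ℝ
    unit   : normSq coords ≈ᴿ 1ᴿ

sphere⇒ball : ∀ {j} → Sphere j → Ball (suc j)
sphere⇒ball (mkSphere x u) = mkBall x (proj₁ u)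

-- The ground set Fin m may contain elements that are not vertices, so
-- that a complex and its induced subcomplexes share one ground set.
record Complex (m : ℕ) : Set₁ where
  field
    Simplex     : Pred (Subset m) 0ℓ
    simplex?    : Decidable Simplex
    ∅-simplex   : Simplex ∅
    down-closed : ∀ {σ τ} → τ ⊆ σ → Simplex σ → Simplex τ

  Vertex : Pred (Fin m) 0ℓ
  Vertex v = Simplex ⁅ v ⁆

open Complex public

infix 8 _[_]

_[_] : ∀ {m} → Complex m → Subset m → Complex m
C [ X ] = record
  { Simplex     = λ σ → Simplex C σ × σ ⊆ X
  ; simplex?    = λ σ → simplex? C σ ×-dec (σ ⊆? X)
  ; ∅-simplex   = ∅-simplex C , ⊆-min X
  ; down-closed = λ { {σ} {τ} τ⊆σ (s , σ⊆X) → down-closed C τ⊆σ s , ⊆-trans {i = τ} τ⊆σ σ⊆X }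
  }

HasVertex : ∀ {m} → Complex m → Set
HasVertex K = ∃[ v ] Vertex K v

-- Points in barycentric coordinates.  The support {v | 0 < x v} of a real
-- point is not a decidable set, so "the support is a simplex" is expressed
-- as: every finite set contained in the support is a simplex.
record ∥_∥ {m} (K : Complex m) : Set where
  field
    bary    : Fin m → ℝ
    nonneg  : ∀ v → 0ᴿ ≤ᴿ bary v
    total   : sumᴿ bary ≈ᴿ 1ᴿ
    support : ∀ σ → (∀ {v} → v ∈ σ → 0ᴿ <ᴿ bary v) → Simplex K σ

open ∥_∥ public using (bary)

SphereMapsExtend : ∀ {m} → Complex m → ℕ → Set
SphereMapsExtend K j =
  (f : Sphere j → ∥ K ∥) → Continuous Sphere.coords bary f →
  Σ[ F ∈ (Ball (suc j) → ∥ K ∥) ] (Continuous Ball.coords bary F ×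
    (∀ x v → bary (F (sphere⇒ball x)) v ≈ᴿ bary (f x) v))

record Chain {m} (K : Complex m) (s : ℕ) : Set where
  field
    coeff     : Subset m → ℚ
    supported : ∀ σ → coeff σ ≢ 0ℚ → Simplex K σ × ∣ σ ∣ ≡ s

open Chain public using (coeff)

sgn : ℕ → ℚ
sgn zero    = 1ℚ
sgn (suc n) = ℚ.- sgn n

below : ∀ {m} → Fin m → Subset m
below v = tabulate (λ u → does (u Fin.<? v))

-- Simplices are oriented by the order of Fin m, and
-- ∂[v₀,…,vⱼ] = Σᵢ (-1)ⁱ [v₀,…,v̂ᵢ,…,vⱼ], extended linearly.  Read off at τ,
-- the contributions to ∂c come from the simplices τ ∪ {v} with v ∉ τ, and
-- the position of v in τ ∪ {v} is the number of u ∈ τ with u < v.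
∂ : ∀ {m} → (Subset m → ℚ) → (Subset m → ℚ)
∂ {m} c τ = Vector.foldr ℚ._+_ 0ℚ {m} λ v →
  if does (v ∈? τ) then 0ℚ else sgn ∣ τ ∩ below v ∣ ℚ.* c (τ ∪ ⁅ v ⁆)

-- A j-chain is a chain on simplices of cardinality j + 1; for j = 0 the
-- map ∂ is the augmentation, into chains on the empty simplex.
ReducedHomologyVanishes : ∀ {m} → Complex m → ℕ → Set
ReducedHomologyVanishes K j =
  (z : Chain K (suc j)) → (∀ τ → ∂ (coeff z) τ ≡ 0ℚ) →
  Σ[ b ∈ Chain K (suc (suc j)) ] (∀ σ → ∂ (coeff b) σ ≡ coeff z σ)

data Theory : Set where
  π H : Theory

-- The condition in dimension j = s - 1.
Connected-at : ∀ {m} → Theory → Complex m → ℕ → Set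
Connected-at _ K zero    = HasVertex K
Connected-at π K (suc j) = SphereMapsExtend K j
Connected-at H K (suc j) = ReducedHomologyVanishes K j

-- η ≥ z, for η = 2 + sup { k ≥ -2 | the condition holds for -1 ≤ j ≤ k }
-- (possibly ∞): some member k of that set has 2 + k ≥ z.  Here e = 2 + k
-- and s = 1 + j.  The value of η itself is not a computable quantity.
infix 4 η[_]_≥_

η[_]_≥_ : ∀ {m} → Theory → Complex m → ℤ → Set
η[ t ] K ≥ z = ∃[ e ] (z ℤ.≤ + e × (∀ s → s ℕ.< e → Connected-at t K s))

record IsPartition {m n} (C : Complex m) (V : Fin n → Subset m) : Set where
  field
    nonempty : ∀ i → Nonempty (V i)
    disjoint : ∀ {i j} → i ≢ j → Empty (V i ∩ V j)
    covers   : ∀ v → Vertex C v ⇔ (∃[ i ] v ∈ V i)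

⋃[_]_ : ∀ {m n} → Subset n → (Fin n → Subset m) → Subset m
⋃[_]_ {n = n} I V = ⋃ (map V (filter (_∈? I) (allFin n)))

record PartialColorful {m n} (C : Complex m) (V : Fin n → Subset m) (σ : Subset m) : Set where
  field
    simplex  : Simplex C σ
    colorful : ∀ i → ∣ σ ∩ V i ∣ ℕ.≤ 1

record Graph : Set₁ where
  field
    Carrier  : Set
    IsVertex : Pred Carrier 0ℓ
    Adjacent : Rel Carrier 0ℓ

-- Any two vertices are joined by a walk; the empty graph counts as
-- connected.
Connected : Graph → Set
Connected G = ∀ x y → IsVertex x → IsVertex y →
  Star (λ u w → IsVertex u × IsVertex w × Adjacent u w) x y
  where open Graph G

-- k is an integer: for k < 0 the graph has no vertices.
RG : ∀ {m n} → Complex m → (Fin n → Subset m) → ℤ → Graph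
RG {m} C V k = record
  { Carrier  = Subset m
  ; IsVertex = λ σ → PartialColorful C V σ × + ∣ σ ∣ ≡ k
  ; Adjacent = λ σ τ → Simplex C (σ ∪ τ) × + ∣ σ ∪ τ ∣ ≡ k ℤ.+ 1ℤ
  }

{-# OPTIONS --safe #-}
module Submission where

-- Homology, d = 0.  Rainbow simplices σ and τ are sections of the coloring.
-- Filling the prism over the simplex of colors one face I at a time, by the
-- acyclicity of C[V_I], gives chains T_I with ∂T_I = τ_I - σ_I - Σ ± T_{I-i}.
-- The rainbow facets of a simplex with n + 1 vertices lie in one component of
-- the graph, so the part of ∂T_{[n]} in the component of σ still has color
-- degree 0; hence that component contains τ.
--
-- Larger d.  Joining C with n isolated points, one of each color, raises the
-- acyclicity of every C[V_I] by one and lowers d by one, and walks in the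
-- join can be pushed back to C.
--
-- Homotopy.  Connectivity is turned into acyclicity: a simplicial map from a
-- subdivided cone over the skeleton of K to K, equal to the identity on the
-- base up to carriers, exhibits every cycle z as the boundary of the cone on
-- z.  The cone over a simplex σ is the cube [0,N]^σ, so that such a map is
-- one function on integer vectors.  It is extended over one more skeleton by
-- interpolating it to a map of spheres, extending that over the ball, and
-- reading off, at the points of a finer grid, a vertex with a large
-- barycentric coordinate.

open import Defs
open import Data.Bool.Base using (true; false; if_then_else_; _∨_)
import Data.Bool.Properties as Bool
open import Data.Empty using (⊥-elim)
open import Data.Fin.Base using (Fin; zero; suc; splitAt; _↑ˡ_; _↑ʳ_)
import Data.Fin.Properties as Fin
open import Data.Fin.Subset using (Subset; Side; Nonempty; inside; outside; _∈_; _∉_; _⊆_; _∩_; _∪_; ⋃; ⁅_⁆; ∣_∣) renaming (⊥ to ∅; ⊤ to full; _-_ to _∖_)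
open import Data.Fin.Subset.Properties
open import Data.Integer.Base as ℤ using (+_; _+_; _-_; 1ℤ)
import Data.Integer.Properties as ℤ
open import Data.List.Base as List using (List; []; _∷_; map; length; filter; allFin)
import Data.List.Properties as List
open import Data.List.Membership.Propositional using () renaming (_∈_ to _∈ˡ_)
open import Data.List.Membership.Propositional.Properties using (∈-map⁺; ∈-map⁻; ∈-++⁺ˡ; ∈-++⁺ʳ; ∈-filter⁺; ∈-filter⁻; ∈-allFin)
open import Data.List.Relation.Unary.All as All using (All; []; _∷_)
import Data.List.Relation.Unary.All.Properties as All
open import Data.List.Relation.Unary.AllPairs using (AllPairs; []; _∷_)
open import Data.List.Relation.Unary.Any using (here; there)
open import Data.Maybe.Base using (Maybe; just; nothing; maybe′) renaming (map to mapMaybe)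
open import Data.Nat.Base as ℕ using (ℕ; zero; suc; z≤n; s≤s)
import Data.Nat.Properties as ℕ
open import Data.Product.Base using (Σ-syntax; ∃-syntax; _×_; _,_; proj₁; proj₂)
open import Data.Rational.Base as ℚ using (ℚ; 0ℚ; 1ℚ; ½; mkℚ)
import Data.Rational.Properties as ℚ
import Data.Rational.Unnormalised.Base as ℚᵘ
import Data.Rational.Unnormalised.Properties as ℚᵘ
open import Data.Sum.Base as Sum using (_⊎_; inj₁; inj₂; [_,_]′)
open import Data.Vec.Base as Vec using (Vec; []; _∷_; _++_; here; there; lookup; replicate; tabulate; take; drop)
import Data.Vec.Functional as Vector
import Data.Vec.Properties as Vec
open import Function.Base using (_∘_; id)
open import Function.Bundles using (Equivalence)
open import Relation.Binary.Construct.Closure.ReflexiveTransitive using (Star; _◅_; _◅◅_; gmap) renaming (ε to done)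
open import Relation.Binary.PropositionalEquality hiding ([_])
open import Relation.Nullary using (¬_; Dec; yes; no; does)
open import Relation.Nullary.Decidable using (map′; ¬?; _×-dec_; _⊎-dec_)
open import Relation.Unary using (Decidable)
open import Tactic.RingSolver using (solve-∀)
open import Tactic.RingSolver.Core.AlmostCommutativeRing using (AlmostCommutativeRing; fromCommutativeRing)

-- Linear functionals and the exterior algebra

-- Degree means the coefficient at the full set of colors of the image under the coloring. The
-- simplex of n colors has no face with n + 1 vertices, so the image of the cut chain is zero there
-- and its boundary has degree 0; a `T_I` with I proper misses a color and has degree 0 as well.
-- Were τ outside the component, the cut of `τ - σ` would have degree -1.
--
-- Much of the form is dictated by constructivity. A chain can be cut only along a decidable set,
-- hence the decision procedure for walks. Membership of a real point in the open ball is not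
-- decidable, so extensions over a ball are evaluated at rational points only, stereographic
-- projection supplies rational points of the sphere, and a large coordinate is found by comparing
-- rational approximations.
--
-- Cubes are used for cones because a face where a coordinate is 0 is again the cone over a facet,
-- and because a product of intervals admits explicit prisms and interpolation one coordinate at a
-- time. On the base a grid map is only asked to satisfy a Sperner condition; degree 1 follows by
-- induction on the faces.

ℚ-ring : AlmostCommutativeRing _ _
ℚ-ring = fromCommutativeRing ℚ.+-*-commutativeRing 0≟
  where
  0≟ : ∀ x → Maybe (0ℚ ≡ x)
  0≟ x with 0ℚ ℚ.≟ x
  ... | yes p = just p
  ... | no  _ = nothing

-- Functions are compared pointwise, without function extensionality, so respecting `≗` is part of
-- linearity. Operators on chains are treated one output coordinate at a time, as functionals.
record Linear {A : Set} (F : (A → ℚ) → ℚ) : Set where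
  field
    cong-≗ : ∀ {x y} → x ≗ y → F x ≡ F y
    lin    : ∀ a b x y → F (λ s → a ℚ.* x s ℚ.+ b ℚ.* y s) ≡ a ℚ.* F x ℚ.+ b ℚ.* F y

  additive : ∀ x y → F (λ s → x s ℚ.+ y s) ≡ F x ℚ.+ F y
  additive x y = trans (cong-≗ (λ s → eq (x s) (y s))) (trans (lin 1ℚ 1ℚ x y) (sym (eq (F x) (F y))))
    where
    eq : ∀ a b → a ℚ.+ b ≡ 1ℚ ℚ.* a ℚ.+ 1ℚ ℚ.* b
    eq = solve-∀ ℚ-ring

  minus : ∀ x y → F (λ s → x s ℚ.- y s) ≡ F x ℚ.- F y
  minus x y = trans (cong-≗ (λ s → eq (x s) (y s))) (trans (lin 1ℚ (ℚ.- 1ℚ) x y) (sym (eq (F x) (F y))))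
    where
    eq : ∀ a b → a ℚ.- b ≡ 1ℚ ℚ.* a ℚ.+ (ℚ.- 1ℚ) ℚ.* b
    eq = solve-∀ ℚ-ring

  scale : ∀ a x → F (λ s → a ℚ.* x s) ≡ a ℚ.* F x
  scale a x = trans (cong-≗ (λ s → eq (a ℚ.* x s) (x s))) (trans (lin a 0ℚ x x) (sym (eq (a ℚ.* F x) (F x))))
    where
    eq : ∀ a b → a ≡ a ℚ.+ 0ℚ ℚ.* b
    eq = solve-∀ ℚ-ring

  negate : ∀ x → F (λ s → ℚ.- x s) ≡ ℚ.- F x
  negate x = trans (cong-≗ (λ s → eq (x s))) (trans (scale (ℚ.- 1ℚ) x) (sym (eq (F x))))
    where
    eq : ∀ a → ℚ.- a ≡ (ℚ.- 1ℚ) ℚ.* a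
    eq = solve-∀ ℚ-ring

  vanish : ∀ x → (∀ s → x s ≡ 0ℚ) → F x ≡ 0ℚ
  vanish x x≡0 = trans (cong-≗ (λ s → trans (x≡0 s) (sym (ℚ.*-zeroˡ (x s))))) (trans (scale 0ℚ x) (ℚ.*-zeroˡ (F x)))

open Linear public

module _ {A : Set} where
  eval-linear : ∀ (s : A) → Linear (λ x → x s)
  eval-linear s = record { cong-≗ = λ x≗y → x≗y s ; lin = λ _ _ _ _ → refl }

  0-linear : Linear {A} (λ _ → 0ℚ)
  0-linear = record { cong-≗ = λ _ → refl ; lin = λ a b _ _ → eq a b }
    where
    eq : ∀ a b → 0ℚ ≡ a ℚ.* 0ℚ ℚ.+ b ℚ.* 0ℚ
    eq = solve-∀ ℚ-ring

  +-linear : ∀ {F G : (A → ℚ) → ℚ} → Linear F → Linear G → Linear (λ x → F x ℚ.+ G x)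
  +-linear {F} {G} f g = record
    { cong-≗ = λ p → cong₂ ℚ._+_ (cong-≗ f p) (cong-≗ g p)
    ; lin    = λ a b x y → trans (cong₂ ℚ._+_ (lin f a b x y) (lin g a b x y)) (eq a b (F x) (F y) (G x) (G y))
    }
    where
    eq : ∀ a b x y z w → (a ℚ.* x ℚ.+ b ℚ.* y) ℚ.+ (a ℚ.* z ℚ.+ b ℚ.* w) ≡ a ℚ.* (x ℚ.+ z) ℚ.+ b ℚ.* (y ℚ.+ w)
    eq = solve-∀ ℚ-ring

  *-linear : ∀ c {F : (A → ℚ) → ℚ} → Linear F → Linear (λ x → c ℚ.* F x)
  *-linear c {F} f = record
    { cong-≗ = λ p → cong (c ℚ.*_) (cong-≗ f p)
    ; lin    = λ a b x y → trans (cong (c ℚ.*_) (lin f a b x y)) (eq a b c (F x) (F y))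
    }
    where
    eq : ∀ a b c x y → c ℚ.* (a ℚ.* x ℚ.+ b ℚ.* y) ≡ a ℚ.* (c ℚ.* x) ℚ.+ b ℚ.* (c ℚ.* y)
    eq = solve-∀ ℚ-ring

  neg-linear : ∀ {F : (A → ℚ) → ℚ} → Linear F → Linear (λ x → ℚ.- F x)
  neg-linear {F} f = record
    { cong-≗ = λ p → cong ℚ.-_ (cong-≗ f p)
    ; lin    = λ a b x y → trans (cong ℚ.-_ (lin f a b x y)) (eq a b (F x) (F y))
    }
    where
    eq : ∀ a b x y → ℚ.- (a ℚ.* x ℚ.+ b ℚ.* y) ≡ a ℚ.* (ℚ.- x) ℚ.+ b ℚ.* (ℚ.- y)
    eq = solve-∀ ℚ-ring

∘-linear : ∀ {A B : Set} {F : (B → ℚ) → ℚ} {f : (A → ℚ) → B → ℚ} →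
  Linear F → (∀ t → Linear (λ x → f x t)) → Linear (F ∘ f)
∘-linear g f = record
  { cong-≗ = λ p → cong-≗ g (λ t → cong-≗ (f t) p)
  ; lin    = λ a b x y → trans (cong-≗ g (λ t → lin (f t) a b x y)) (lin g a b _ _)
  }

pullback-linear : ∀ {A B : Set} {F : (B → ℚ) → ℚ} (h : B → A) → Linear F → Linear (λ x → F (x ∘ h))
pullback-linear h f = ∘-linear f (λ t → eval-linear (h t))

-- A function Subset m → ℚ is an element of the exterior algebra on Fin m
-- (the basis monomials being sorted).  All operations are defined by
-- splitting off the generator zero.

∂ʳ : ∀ {m} → (Subset m → ℚ) → (Subset m → ℚ)
∂ʳ c []            = 0ℚ
∂ʳ c (outside ∷ σ) = c (inside ∷ σ) ℚ.+ ∂ʳ (c ∘ (outside ∷_)) σ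
∂ʳ c (inside ∷ σ)  = ℚ.- ∂ʳ (c ∘ (inside ∷_)) σ

-- Left multiplication by the generator `v`. The sign is the cost of moving `v` past the generator
-- `zero`; monomials that already contain `v` are killed.
wedge : ∀ {m} → Fin m → (Subset m → ℚ) → (Subset m → ℚ)
wedge zero    c (inside ∷ σ)  = c (outside ∷ σ)
wedge zero    c (outside ∷ σ) = 0ℚ
wedge (suc v) c (inside ∷ σ)  = ℚ.- wedge v (c ∘ (inside ∷_)) σ
wedge (suc v) c (outside ∷ σ) = wedge v (c ∘ (outside ∷_)) σ

-- Left multiplication by the sum of all generators; adjoint to ∂ʳ.
δ : ∀ {n} → (Subset n → ℚ) → (Subset n → ℚ)
δ T []            = 0ℚ
δ T (outside ∷ I) = δ (T ∘ (outside ∷_)) I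
δ T (inside ∷ I)  = T (outside ∷ I) ℚ.- δ (T ∘ (inside ∷_)) I

∂ʳ-linear : ∀ {m} (σ : Subset m) → Linear (λ c → ∂ʳ c σ)
∂ʳ-linear []            = 0-linear
∂ʳ-linear (outside ∷ σ) = +-linear (eval-linear (inside ∷ σ)) (pullback-linear (outside ∷_) (∂ʳ-linear σ))
∂ʳ-linear (inside ∷ σ)  = neg-linear (pullback-linear (inside ∷_) (∂ʳ-linear σ))

wedge-linear : ∀ {m} (v : Fin m) σ → Linear (λ c → wedge v c σ)
wedge-linear zero    (inside ∷ σ)  = eval-linear (outside ∷ σ)
wedge-linear zero    (outside ∷ σ) = 0-linear
wedge-linear (suc v) (inside ∷ σ)  = neg-linear (pullback-linear (inside ∷_) (wedge-linear v σ))
wedge-linear (suc v) (outside ∷ σ) = pullback-linear (outside ∷_) (wedge-linear v σ)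

δ-linear : ∀ {n} (I : Subset n) → Linear (λ T → δ T I)
δ-linear []            = 0-linear
δ-linear (outside ∷ I) = pullback-linear (outside ∷_) (δ-linear I)
δ-linear (inside ∷ I)  = +-linear (eval-linear (outside ∷ I)) (neg-linear (pullback-linear (inside ∷_) (δ-linear I)))

-- `∂ʳ` is the antiderivation with value 1 on every generator, and this is its Leibniz rule. The
-- boundaries of monomials, of ordered simplices and of images under `Λ` all reduce to it.
∂ʳ-wedge : ∀ {m} (v : Fin m) c σ → ∂ʳ (wedge v c) σ ≡ c σ ℚ.- wedge v (∂ʳ c) σ
∂ʳ-wedge zero c (outside ∷ σ) =
  trans (cong (c (outside ∷ σ) ℚ.+_) (vanish (∂ʳ-linear σ) _ (λ _ → refl))) (eq (c (outside ∷ σ)))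
  where
  eq : ∀ a → a ℚ.+ 0ℚ ≡ a ℚ.- 0ℚ
  eq = solve-∀ ℚ-ring
∂ʳ-wedge zero c (inside ∷ σ) = eq (c (inside ∷ σ)) (∂ʳ (c ∘ (outside ∷_)) σ)
  where
  eq : ∀ a b → ℚ.- b ≡ a ℚ.- (a ℚ.+ b)
  eq = solve-∀ ℚ-ring
∂ʳ-wedge (suc v) c (outside ∷ σ) = trans
  (cong (ℚ.- wedge v (c ∘ (inside ∷_)) σ ℚ.+_) (∂ʳ-wedge v (c ∘ (outside ∷_)) σ))
  (trans (eq (wedge v (c ∘ (inside ∷_)) σ) (c (outside ∷ σ)) (wedge v (∂ʳ (c ∘ (outside ∷_))) σ)) (cong (λ z → c (outside ∷ σ) ℚ.- z) (sym (additive (wedge-linear v σ) (c ∘ (inside ∷_)) (∂ʳ (c ∘ (outside ∷_)))))))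
  where
  eq : ∀ a b d → ℚ.- a ℚ.+ (b ℚ.- d) ≡ b ℚ.- (a ℚ.+ d)
  eq = solve-∀ ℚ-ring
∂ʳ-wedge (suc v) c (inside ∷ σ) = trans
  (cong ℚ.-_ (trans (negate (∂ʳ-linear σ) _) (cong ℚ.-_ (∂ʳ-wedge v (c ∘ (inside ∷_)) σ))))
  (trans (eq (c (inside ∷ σ)) (wedge v (∂ʳ (c ∘ (inside ∷_))) σ)) (cong (λ z → c (inside ∷ σ) ℚ.- ℚ.- z) (sym (negate (wedge-linear v σ) (∂ʳ (c ∘ (inside ∷_)))))))
  where
  eq : ∀ b d → ℚ.- ℚ.- (b ℚ.- d) ≡ b ℚ.- (ℚ.- ℚ.- d)
  eq = solve-∀ ℚ-ring

wedge-wedge-0 : ∀ {m} (v : Fin m) c σ → wedge v (wedge v c) σ ≡ 0ℚ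
wedge-wedge-0 zero    c (outside ∷ σ) = refl
wedge-wedge-0 zero    c (inside ∷ σ)  = refl
wedge-wedge-0 (suc v) c (outside ∷ σ) = wedge-wedge-0 v _ σ
wedge-wedge-0 (suc v) c (inside ∷ σ)  =
  cong ℚ.-_ (trans (negate (wedge-linear v σ) (wedge v (c ∘ (inside ∷_)))) (cong ℚ.-_ (wedge-wedge-0 v _ σ)))

wedge-anticomm : ∀ {m} (v w : Fin m) c σ → wedge v (wedge w c) σ ≡ ℚ.- wedge w (wedge v c) σ
wedge-anticomm zero zero c (outside ∷ σ) = refl
wedge-anticomm zero zero c (inside ∷ σ) = refl
wedge-anticomm zero (suc w) c (outside ∷ σ) = cong ℚ.-_ (sym (vanish (wedge-linear w σ) _ (λ _ → refl)))
wedge-anticomm zero (suc w) c (inside ∷ σ) = eq _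
  where
  eq : ∀ a → a ≡ ℚ.- ℚ.- a
  eq = solve-∀ ℚ-ring
wedge-anticomm (suc v) zero c (outside ∷ σ) = vanish (wedge-linear v σ) _ (λ _ → refl)
wedge-anticomm (suc v) zero c (inside ∷ σ) = refl
wedge-anticomm (suc v) (suc w) c (outside ∷ σ) = wedge-anticomm v w _ σ
wedge-anticomm (suc v) (suc w) c (inside ∷ σ) = cong ℚ.-_ (trans (negate (wedge-linear v σ) (wedge w (c ∘ (inside ∷_))))
   (trans (cong ℚ.-_ (wedge-anticomm v w _ σ)) (cong ℚ.-_ (sym (negate (wedge-linear w σ) (wedge v (c ∘ (inside ∷_))))))))

∂ʳ-∂ʳ : ∀ {m} (c : Subset m → ℚ) σ → ∂ʳ (∂ʳ c) σ ≡ 0ℚ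
∂ʳ-∂ʳ c [] = refl
∂ʳ-∂ʳ c (outside ∷ σ) = trans
  (cong (ℚ.- ∂ʳ (c ∘ (inside ∷_)) σ ℚ.+_) (trans (additive (∂ʳ-linear σ) (c ∘ (inside ∷_)) (∂ʳ (c ∘ (outside ∷_))))
    (cong (∂ʳ (c ∘ (inside ∷_)) σ ℚ.+_) (∂ʳ-∂ʳ _ σ)))) (eq (∂ʳ (c ∘ (inside ∷_)) σ))
  where
  eq : ∀ a → ℚ.- a ℚ.+ (a ℚ.+ 0ℚ) ≡ 0ℚ
  eq = solve-∀ ℚ-ring
∂ʳ-∂ʳ c (inside ∷ σ) = cong ℚ.-_ (trans (negate (∂ʳ-linear σ) (∂ʳ (c ∘ (inside ∷_)))) (cong ℚ.-_ (∂ʳ-∂ʳ _ σ)))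

δ-δ : ∀ {n} (T : Subset n → ℚ) I → δ (δ T) I ≡ 0ℚ
δ-δ T [] = refl
δ-δ T (outside ∷ I) = δ-δ _ I
δ-δ T (inside ∷ I) = trans
  (cong (λ z → δ (T ∘ (outside ∷_)) I ℚ.- z) (trans (minus (δ-linear I) (T ∘ (outside ∷_)) (δ (T ∘ (inside ∷_))))
    (cong (λ z → δ (T ∘ (outside ∷_)) I ℚ.- z) (δ-δ _ I)))) (eq (δ (T ∘ (outside ∷_)) I))
  where
  eq : ∀ a → a ℚ.- (a ℚ.- 0ℚ) ≡ 0ℚ
  eq = solve-∀ ℚ-ring

-- `δ` at `I` is a signed sum over the facets of `I`, so every linear functional passes through it.
-- With chains as values of `T`, this moves `∂ʳ` or a degree from a sum of chains to its members.
δ-commutes : ∀ {A : Set} {F : (A → ℚ) → ℚ} → Linear F → ∀ {n} (T : Subset n → A → ℚ) I →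
  F (λ s → δ (λ J → T J s) I) ≡ δ (λ J → F (T J)) I
δ-commutes f T []            = vanish f _ (λ _ → refl)
δ-commutes f T (outside ∷ I) = δ-commutes f _ I
δ-commutes {F = F} f T (inside ∷ I)  = trans
  (minus f (T (outside ∷ I)) (λ s → δ (λ J → T (inside ∷ J) s) I))
  (cong (λ z → F (T (outside ∷ I)) ℚ.- z) (δ-commutes f (T ∘ (inside ∷_)) I))

δ-local : ∀ {n} {S T : Subset n → ℚ} (I : Subset n) →
  (∀ J → J ⊆ I → suc ∣ J ∣ ≡ ∣ I ∣ → S J ≡ T J) → δ S I ≡ δ T I
δ-local [] h = refl
δ-local (outside ∷ I) h = δ-local I λ J J⊆I eq → h (outside ∷ J) (λ { (there x) → there (J⊆I x) }) eq
δ-local (inside ∷ I) h = cong₂ ℚ._-_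
  (h (outside ∷ I) (λ { (there x) → there x }) refl)
  (δ-local I λ J J⊆I eq → h (inside ∷ J) (λ { here → here ; (there x) → there (J⊆I x) }) (cong suc eq))

-- Basis elements, and the boundary map in recursive form

indicator : ∀ {m} → Subset m → (Subset m → ℚ)
indicator []            []            = 1ℚ
indicator (inside ∷ σ)  (inside ∷ τ)  = indicator σ τ
indicator (inside ∷ σ)  (outside ∷ τ) = 0ℚ
indicator (outside ∷ σ) (inside ∷ τ)  = 0ℚ
indicator (outside ∷ σ) (outside ∷ τ) = indicator σ τ

indicator-self : ∀ {m} (σ : Subset m) → indicator σ σ ≡ 1ℚ
indicator-self [] = refl
indicator-self (inside ∷ σ) = indicator-self σ
indicator-self (outside ∷ σ) = indicator-self σ

indicator-≢ : ∀ {m} (σ τ : Subset m) → σ ≢ τ → indicator σ τ ≡ 0ℚ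
indicator-≢ [] [] ne = ⊥-elim (ne refl)
indicator-≢ (inside ∷ σ) (inside ∷ τ) ne = indicator-≢ σ τ (ne ∘ cong (inside ∷_))
indicator-≢ (inside ∷ σ) (outside ∷ τ) ne = refl
indicator-≢ (outside ∷ σ) (inside ∷ τ) ne = refl
indicator-≢ (outside ∷ σ) (outside ∷ τ) ne = indicator-≢ σ τ (ne ∘ cong (outside ∷_))

∂ʳ-indicator : ∀ {m} (σ τ : Subset m) → ∂ʳ (indicator σ) τ ≡ δ (λ ρ → indicator ρ τ) σ
∂ʳ-indicator [] [] = refl
∂ʳ-indicator (inside ∷ σ) (inside ∷ τ) = trans (cong ℚ.-_ (∂ʳ-indicator σ τ)) (sym (ℚ.+-identityˡ _))
∂ʳ-indicator (inside ∷ σ) (outside ∷ τ) = cong (indicator σ τ ℚ.+_)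
  (trans (vanish (∂ʳ-linear τ) _ (λ _ → refl)) (sym (cong ℚ.-_ (vanish (δ-linear σ) _ (λ _ → refl)))))
∂ʳ-indicator (outside ∷ σ) (inside ∷ τ) =
  trans (cong ℚ.-_ (vanish (∂ʳ-linear τ) _ (λ _ → refl))) (sym (vanish (δ-linear σ) _ (λ _ → refl)))
∂ʳ-indicator (outside ∷ σ) (outside ∷ τ) = trans (ℚ.+-identityˡ _) (∂ʳ-indicator σ τ)

-- Nothing lies above the full set. The degree argument for d = 0 ends here.
∂ʳ-full : ∀ {n} (c : Subset n → ℚ) → ∂ʳ c full ≡ 0ℚ
∂ʳ-full {zero}  c = refl
∂ʳ-full {suc n} c = cong ℚ.-_ (∂ʳ-full (c ∘ (inside ∷_)))

∂ʳ-local : ∀ {m} {c c′ : Subset m → ℚ} (τ : Subset m) →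
  (∀ ω → τ ⊆ ω → ∣ ω ∣ ≡ suc ∣ τ ∣ → c ω ≡ c′ ω) → ∂ʳ c τ ≡ ∂ʳ c′ τ
∂ʳ-local [] h = refl
∂ʳ-local (outside ∷ τ) h = cong₂ ℚ._+_
  (h (inside ∷ τ) (λ { (there x) → there x }) refl)
  (∂ʳ-local τ λ ω τ⊆ω eq → h (outside ∷ ω) (λ { (there x) → there (τ⊆ω x) }) eq)
∂ʳ-local (inside ∷ τ) h = cong ℚ.-_
  (∂ʳ-local τ λ ω τ⊆ω eq → h (inside ∷ ω) (λ { here → here ; (there x) → there (τ⊆ω x) }) (cong suc eq))

∂-summand : ∀ {m} → (Subset m → ℚ) → Subset m → Fin m → ℚ
∂-summand c τ v = if does (v ∈? τ) then 0ℚ else sgn ∣ τ ∩ below v ∣ ℚ.* c (τ ∪ ⁅ v ⁆)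

foldr-cong : ∀ {m} {f g : Fin m → ℚ} → (∀ v → f v ≡ g v) →
  Vector.foldr ℚ._+_ 0ℚ f ≡ Vector.foldr ℚ._+_ 0ℚ g
foldr-cong {zero}  h = refl
foldr-cong {suc m} h = cong₂ ℚ._+_ (h zero) (foldr-cong (h ∘ suc))

foldr-neg : ∀ {m} (f : Fin m → ℚ) →
  Vector.foldr ℚ._+_ 0ℚ (λ v → ℚ.- f v) ≡ ℚ.- Vector.foldr ℚ._+_ 0ℚ f
foldr-neg {zero}  f = refl
foldr-neg {suc m} f = trans (cong (ℚ.- f zero ℚ.+_) (foldr-neg (f ∘ suc))) (sym (ℚ.neg-distrib-+ (f zero) _))

∩-below-zero : ∀ {m} (τ : Subset m) → ∣ τ ∩ tabulate (λ u → does (suc u Fin.<? zero {m})) ∣ ≡ 0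
∩-below-zero [] = refl
∩-below-zero (inside ∷ τ) = ∩-below-zero τ
∩-below-zero (outside ∷ τ) = ∩-below-zero τ

∪-∅ : ∀ {m} (τ : Subset m) → τ ∪ ∅ ≡ τ
∪-∅ [] = refl
∪-∅ (inside ∷ τ) = cong (inside ∷_) (∪-∅ τ)
∪-∅ (outside ∷ τ) = cong (outside ∷_) (∪-∅ τ)

-- The generator `zero` precedes all others. If it lies in the face, it shifts the position of every
-- other inserted vertex by one, which is the sign in the recursion; otherwise it can itself be
-- inserted, in position 0.
∂≗∂ʳ : ∀ {m} (c : Subset m → ℚ) → ∂ c ≗ ∂ʳ c
∂≗∂ʳ c [] = refl
∂≗∂ʳ c (outside ∷ τ) = cong₂ ℚ._+_
  (trans (cong₂ (λ k ρ → sgn k ℚ.* c (inside ∷ ρ)) (∩-below-zero τ) (∪-∅ τ)) (ℚ.*-identityˡ (c (inside ∷ τ))))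
  (trans (foldr-cong {f = λ v → ∂-summand c (outside ∷ τ) (suc v)} {g = ∂-summand (c ∘ (outside ∷_)) τ} (λ v → refl)) (∂≗∂ʳ (c ∘ (outside ∷_)) τ))
∂≗∂ʳ c (inside ∷ τ) = trans (ℚ.+-identityˡ _) (trans
  (trans (foldr-cong {f = λ v → ∂-summand c (inside ∷ τ) (suc v)} {g = λ v → ℚ.- ∂-summand (c ∘ (inside ∷_)) τ v} step)
  (foldr-neg (∂-summand (c ∘ (inside ∷_)) τ))) (cong ℚ.-_ (∂≗∂ʳ (c ∘ (inside ∷_)) τ)))
  where
  step : ∀ v → ∂-summand c (inside ∷ τ) (suc v) ≡ ℚ.- ∂-summand (c ∘ (inside ∷_)) τ v
  step v with does (v ∈? τ)
  ... | true  = refl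
  ... | false = sym (ℚ.neg-distribˡ-* (sgn ∣ τ ∩ below v ∣) (c (inside ∷ (τ ∪ ⁅ v ⁆))))

-- Reachability in finite graphs

-- Floyd–Warshall: walks whose inner nodes lie in a given list.
module Reachability {A : Set} (R : A → A → Set) where

  Via : List A → A → A → Set
  Via []       x y = x ≡ y ⊎ R x y
  Via (z ∷ zs) x y = Via zs x y ⊎ (Via zs x z × Via zs z y)

  via? : (∀ x y → Dec (x ≡ y)) → (∀ x y → Dec (R x y)) → ∀ zs x y → Dec (Via zs x y)
  via? _≟_ R? []       x y = (x ≟ y) ⊎-dec R? x y
  via? _≟_ R? (z ∷ zs) x y = via? _≟_ R? zs x y ⊎-dec (via? _≟_ R? zs x z ×-dec via? _≟_ R? zs z y)

  via⇒star : ∀ zs {x y} → Via zs x y → Star R x y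
  via⇒star []       (inj₁ refl)    = done
  via⇒star []       (inj₂ r)       = r ◅ done
  via⇒star (z ∷ zs) (inj₁ p)       = via⇒star zs p
  via⇒star (z ∷ zs) (inj₂ (p , q)) = via⇒star zs p ◅◅ via⇒star zs q

  refl-via : ∀ zs {x} → Via zs x x
  refl-via []       = inj₁ refl
  refl-via (z ∷ zs) = inj₁ (refl-via zs)

  step-via : ∀ zs {x y} → R x y → Via zs x y
  step-via []       r = inj₂ r
  step-via (z ∷ zs) r = inj₁ (step-via zs r)

  -- A composite walk that would visit the head of the list twice has a loop between the two visits.
  -- Discarding the loop leaves a single visit, as `Via` permits.
  via-trans : ∀ zs {x y z} → z ∈ˡ zs → Via zs x z → Via zs z y → Via zs x y
  via-trans (a ∷ zs) (here refl) (inj₁ p)       (inj₁ q)       = inj₂ (p , q)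
  via-trans (a ∷ zs) (here refl) (inj₁ p)       (inj₂ (_ , q)) = inj₂ (p , q)
  via-trans (a ∷ zs) (here refl) (inj₂ (p , _)) (inj₁ q)       = inj₂ (p , q)
  via-trans (a ∷ zs) (here refl) (inj₂ (p , _)) (inj₂ (_ , q)) = inj₂ (p , q)
  via-trans (a ∷ zs) (there i)   (inj₁ p)       (inj₁ q)       = inj₁ (via-trans zs i p q)
  via-trans (a ∷ zs) (there i)   (inj₁ p)       (inj₂ (q , r)) = inj₂ (via-trans zs i p q , r)
  via-trans (a ∷ zs) (there i)   (inj₂ (p , q)) (inj₁ r)       = inj₂ (p , via-trans zs i q r)
  via-trans (a ∷ zs) (there i)   (inj₂ (p , _)) (inj₂ (_ , q)) = inj₂ (p , q)

  star⇒via : ∀ zs → (∀ a → a ∈ˡ zs) → ∀ {x y} → Star R x y → Via zs x y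
  star⇒via zs all done        = refl-via zs
  star⇒via zs all (r ◅ rs) = via-trans zs (all _) (step-via zs r) (star⇒via zs all rs)

  star? : (∀ x y → Dec (x ≡ y)) → (∀ x y → Dec (R x y)) →
    (zs : List A) → (∀ a → a ∈ˡ zs) → ∀ x y → Dec (Star R x y)
  star? _≟_ R? zs all x y = map′ (via⇒star zs) (star⇒via zs all) (via? _≟_ R? zs x y)

subsets : ∀ m → List (Subset m)
subsets zero    = [] ∷ []
subsets (suc m) = map (inside ∷_) (subsets m) List.++ map (outside ∷_) (subsets m)

∈-subsets : ∀ {m} (σ : Subset m) → σ ∈ˡ subsets m
∈-subsets []            = here refl
∈-subsets (inside ∷ σ)  = ∈-++⁺ˡ (∈-map⁺ (inside ∷_) (∈-subsets σ))
∈-subsets {suc m} (outside ∷ σ) = ∈-++⁺ʳ (map (inside ∷_) (subsets m)) (∈-map⁺ (outside ∷_) (∈-subsets σ))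

-- Colorful sets and reconfiguration moves

⊆∧∣∣≡⇒≡ : ∀ {m} {σ τ : Subset m} → σ ⊆ τ → ∣ τ ∣ ℕ.≤ ∣ σ ∣ → σ ≡ τ
⊆∧∣∣≡⇒≡ {σ = σ} {τ} σ⊆τ le = ⊆-antisym σ⊆τ τ⊆σ
  where
  τ⊆σ : τ ⊆ σ
  τ⊆σ {x} x∈τ with x ∈? σ
  ... | yes x∈σ = x∈σ
  ... | no  x∉σ = ⊥-elim (ℕ.<⇒≱ (p⊂q⇒∣p∣<∣q∣ (σ⊆τ , x , x∈τ , x∉σ)) le)

image : ∀ {m n} → (Fin m → Fin n) → Subset m → Subset n
image κ []            = ∅
image κ (outside ∷ ρ) = image (κ ∘ suc) ρ
image κ (inside ∷ ρ)  = ⁅ κ zero ⁆ ∪ image (κ ∘ suc) ρ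

∈-image⁺ : ∀ {m n} (κ : Fin m → Fin n) {ρ v} → v ∈ ρ → κ v ∈ image κ ρ
∈-image⁺ κ here = p⊆p∪q _ (x∈⁅x⁆ (κ zero))
∈-image⁺ κ {outside ∷ ρ} (there v∈ρ) = ∈-image⁺ (κ ∘ suc) v∈ρ
∈-image⁺ κ {inside ∷ ρ}  (there v∈ρ) = q⊆p∪q ⁅ κ zero ⁆ _ (∈-image⁺ (κ ∘ suc) v∈ρ)

∈-image⁻ : ∀ {m n} (κ : Fin m → Fin n) {i} ρ → i ∈ image κ ρ → ∃[ v ] (v ∈ ρ × κ v ≡ i)
∈-image⁻ κ [] i∈ = ⊥-elim (∉⊥ i∈)
∈-image⁻ κ (outside ∷ ρ) i∈ = let v , v∈ , e = ∈-image⁻ (κ ∘ suc) ρ i∈ in suc v , there v∈ , e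
∈-image⁻ κ (inside ∷ ρ) i∈ with x∈p∪q⁻ ⁅ κ zero ⁆ _ i∈
... | inj₁ i∈₁ = zero , here , sym (x∈⁅y⁆⇒x≡y _ i∈₁)
... | inj₂ i∈₂ = let v , v∈ , e = ∈-image⁻ (κ ∘ suc) ρ i∈₂ in suc v , there v∈ , e

∣∪∣+∣∩∣ : ∀ {m} (p q : Subset m) → ∣ p ∪ q ∣ ℕ.+ ∣ p ∩ q ∣ ≡ ∣ p ∣ ℕ.+ ∣ q ∣
∣∪∣+∣∩∣ [] [] = refl
∣∪∣+∣∩∣ (outside ∷ p) (outside ∷ q) = ∣∪∣+∣∩∣ p q
∣∪∣+∣∩∣ (outside ∷ p) (inside ∷ q)  = trans (cong suc (∣∪∣+∣∩∣ p q)) (sym (ℕ.+-suc ∣ p ∣ ∣ q ∣))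
∣∪∣+∣∩∣ (inside ∷ p)  (outside ∷ q) = cong suc (∣∪∣+∣∩∣ p q)
∣∪∣+∣∩∣ (inside ∷ p)  (inside ∷ q)  = cong suc (trans (ℕ.+-suc ∣ p ∪ q ∣ ∣ p ∩ q ∣)
  (trans (cong suc (∣∪∣+∣∩∣ p q)) (sym (ℕ.+-suc ∣ p ∣ ∣ q ∣))))

∣⁅x⁆∪p∣≤ : ∀ {n} (x : Fin n) p → ∣ ⁅ x ⁆ ∪ p ∣ ℕ.≤ suc ∣ p ∣
∣⁅x⁆∪p∣≤ x p = ℕ.≤-trans (ℕ.m≤m+n _ ∣ ⁅ x ⁆ ∩ p ∣)
  (ℕ.≤-reflexive (trans (∣∪∣+∣∩∣ ⁅ x ⁆ p) (cong (ℕ._+ ∣ p ∣) (∣⁅x⁆∣≡1 x))))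

∣⁅x⁆∪p∣≡ : ∀ {n} (x : Fin n) p → x ∉ p → ∣ ⁅ x ⁆ ∪ p ∣ ≡ suc ∣ p ∣
∣⁅x⁆∪p∣≡ zero    (outside ∷ p) _   = cong (suc ∘ ∣_∣) (⊆-antisym sub (q⊆p∪q ∅ p))
  where
  sub : ∅ ∪ p ⊆ p
  sub x∈ with x∈p∪q⁻ ∅ p x∈
  ... | inj₁ y = ⊥-elim (∉⊥ y)
  ... | inj₂ y = y
∣⁅x⁆∪p∣≡ zero    (inside ∷ p)  x∉p = ⊥-elim (x∉p here)
∣⁅x⁆∪p∣≡ (suc x) (outside ∷ p) x∉p = ∣⁅x⁆∪p∣≡ x p (x∉p ∘ there)
∣⁅x⁆∪p∣≡ (suc x) (inside ∷ p)  x∉p = cong suc (∣⁅x⁆∪p∣≡ x p (x∉p ∘ there))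

∣image∣≤ : ∀ {m n} (κ : Fin m → Fin n) ρ → ∣ image κ ρ ∣ ℕ.≤ ∣ ρ ∣
∣image∣≤ {n = n} κ [] = ℕ.≤-reflexive (∣⊥∣≡0 n)
∣image∣≤ κ (outside ∷ ρ) = ∣image∣≤ (κ ∘ suc) ρ
∣image∣≤ κ (inside ∷ ρ)  = ℕ.≤-trans (∣⁅x⁆∪p∣≤ (κ zero) _) (s≤s (∣image∣≤ (κ ∘ suc) ρ))

InjectiveOn : ∀ {m n} → (Fin m → Fin n) → Subset m → Set
InjectiveOn κ ρ = ∀ {u v} → u ∈ ρ → v ∈ ρ → κ u ≡ κ v → u ≡ v

∣image∣≡ : ∀ {m n} (κ : Fin m → Fin n) ρ → InjectiveOn κ ρ → ∣ image κ ρ ∣ ≡ ∣ ρ ∣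
∣image∣≡ {n = n} κ [] inj = ∣⊥∣≡0 n
∣image∣≡ κ (outside ∷ ρ) inj = ∣image∣≡ (κ ∘ suc) ρ (λ u v e → Fin.suc-injective (inj (there u) (there v) e))
∣image∣≡ κ (inside ∷ ρ) inj = trans (∣⁅x⁆∪p∣≡ (κ zero) _ λ k∈ → let v , v∈ , e = ∈-image⁻ (κ ∘ suc) ρ k∈ in
    Fin.0≢1+n (sym (inj (there v∈) here e)))
  (cong suc (∣image∣≡ (κ ∘ suc) ρ (λ u v e → Fin.suc-injective (inj (there u) (there v) e))))

subset-of-size : ∀ {m} r (A : Subset m) → r ℕ.≤ ∣ A ∣ → ∃[ S ] (S ⊆ A × ∣ S ∣ ≡ r)
subset-of-size {m} zero A le = ∅ , ⊥⊆ , ∣⊥∣≡0 m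
subset-of-size (suc r) (outside ∷ A) le = let S , S⊆A , e = subset-of-size (suc r) A le in
  outside ∷ S , (λ { (there x) → there (S⊆A x) }) , e
subset-of-size (suc r) (inside ∷ A) (s≤s le) = let S , S⊆A , e = subset-of-size r A le in
  inside ∷ S , (λ { here → here ; (there x) → there (S⊆A x) }) , cong suc e

module _ {m n} (κ : Fin m → Fin n) where

  covers⇒n≤ : ∀ ρ → (∀ i → ∃[ v ] (v ∈ ρ × κ v ≡ i)) → n ℕ.≤ ∣ ρ ∣
  covers⇒n≤ ρ cov = ℕ.≤-trans
    (ℕ.≤-trans (ℕ.≤-reflexive (sym (∣⊤∣≡n n)))
      (p⊆q⇒∣p∣≤∣q∣ {p = full} {q = image κ ρ} (λ {i} _ → let v , v∈ , e = cov i in subst (_∈ _) e (∈-image⁺ κ v∈))))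
    (∣image∣≤ κ ρ)

  injective⇒covers : ∀ ρ → InjectiveOn κ ρ → ∣ ρ ∣ ≡ n → ∀ i → ∃[ v ] (v ∈ ρ × κ v ≡ i)
  injective⇒covers ρ inj ∣ρ∣ i = ∈-image⁻ κ ρ (subst (i ∈_) (sym (∣p∣≡n⇒p≡⊤ (trans (∣image∣≡ κ ρ inj) ∣ρ∣))) ∈⊤)

  -- If two vertices shared a color, one of them could be deleted and fewer than n vertices would
  -- still meet all n colors.
  covers⇒injective : ∀ ρ → (∀ i → ∃[ v ] (v ∈ ρ × κ v ≡ i)) → ∣ ρ ∣ ≡ n → InjectiveOn κ ρ
  covers⇒injective ρ cov ∣ρ∣ {u} {v} u∈ v∈ κu≡κv with u Fin.≟ v
  ... | yes u≡v = u≡v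
  ... | no  u≢v = ⊥-elim (ℕ.<⇒≱ (subst (∣ ρ ∖ u ∣ ℕ.<_) ∣ρ∣ (x∈p⇒∣p-x∣<∣p∣ u∈)) (covers⇒n≤ (ρ ∖ u) cov′))
    where
    cov′ : ∀ i → ∃[ w ] (w ∈ ρ ∖ u × κ w ≡ i)
    cov′ i with cov i
    ... | w , w∈ , e with w Fin.≟ u
    ...   | no  w≢u  = w , x∈p∧x≢y⇒x∈p-y w∈ w≢u , e
    ...   | yes refl = v , x∈p∧x≢y⇒x∈p-y v∈ (u≢v ∘ sym) , trans (sym κu≡κv) e

  missing-color : ∀ ρ → ∣ ρ ∣ ℕ.< n → ∃[ i ] (∀ {v} → v ∈ ρ → κ v ≢ i)
  missing-color ρ lt with Fin.all? (λ i → Fin.any? (λ v → (v ∈? ρ) ×-dec (κ v Fin.≟ i)))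
  ... | yes cov = ⊥-elim (ℕ.<⇒≱ lt (covers⇒n≤ ρ cov))
  ... | no ¬cov = let i , ¬c = Fin.¬∀⟶∃¬ n _ (λ i → Fin.any? (λ v → (v ∈? ρ) ×-dec (κ v Fin.≟ i))) ¬cov in
    i , λ v∈ e → ¬c (_ , v∈ , e)

module Reconfiguration {m n} (C : Complex m) (κ : Fin m → Fin n) (r : ℕ) where

  Config : Subset m → Set
  Config ρ = Simplex C ρ × InjectiveOn κ ρ × ∣ ρ ∣ ≡ r

  Move : Subset m → Subset m → Set
  Move ρ ρ′ = Config ρ × Config ρ′ × Simplex C (ρ ∪ ρ′) × ∣ ρ ∪ ρ′ ∣ ≡ suc r

  -- `S ∪ T` has between r and r + 1 vertices. With r + 1 it is the union that a move requires; with
  -- r, both sets are equal to it and the walk is empty.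
  linked : ∀ {U S T} → Simplex C U → ∣ U ∣ ℕ.≤ suc r → S ⊆ U → T ⊆ U → Config S → Config T → Star Move S T
  linked {U} {S} {T} CU ∣U∣ S⊆U T⊆U s t with ∣ S ∪ T ∣ ℕ.≟ suc r
  ... | yes eq = (s , t , down-closed C ∪⊆U CU , eq) ◅ done
    where
    ∪⊆U : S ∪ T ⊆ U
    ∪⊆U x = [ S⊆U , T⊆U ]′ (x∈p∪q⁻ S T x)
  ... | no  ne = subst (Star Move S) (trans S≡∪ (sym T≡∪)) done
    where
    ∪⊆U : S ∪ T ⊆ U
    ∪⊆U x = [ S⊆U , T⊆U ]′ (x∈p∪q⁻ S T x)
    ∣∪∣≤r : ∣ S ∪ T ∣ ℕ.≤ r
    ∣∪∣≤r = ℕ.≤-pred (ℕ.≤∧≢⇒< (ℕ.≤-trans (p⊆q⇒∣p∣≤∣q∣ ∪⊆U) ∣U∣) ne)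
    S≡∪ : S ≡ S ∪ T
    S≡∪ = ⊆∧∣∣≡⇒≡ (p⊆p∪q T) (ℕ.≤-trans ∣∪∣≤r (ℕ.≤-reflexive (sym (proj₂ (proj₂ s)))))
    T≡∪ : T ≡ S ∪ T
    T≡∪ = ⊆∧∣∣≡⇒≡ (q⊆p∪q S T) (ℕ.≤-trans ∣∪∣≤r (ℕ.≤-reflexive (sym (proj₂ (proj₂ t)))))

-- Chains, sections of the coloring, and the case d = 0

-- Stated contrapositively, a support condition concludes with an equation of rationals, so it
-- passes through sums and boundaries without `P` being decided.
On : ∀ {m} → (Subset m → Set) → (Subset m → ℚ) → Set
On P c = ∀ σ → ¬ P σ → c σ ≡ 0ℚ

-- `k` counts vertices: this is the vanishing of reduced homology in dimension k - 1, with k = 0 for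
-- multiples of the empty simplex.
Acyclic : ∀ {m} → (Subset m → Set) → ℕ → Set
Acyclic S k = ∀ z → On (λ σ → S σ × ∣ σ ∣ ≡ k) z → (∀ τ → ∂ʳ z τ ≡ 0ℚ) →
  Σ[ b ∈ _ ] (On (λ σ → S σ × ∣ σ ∣ ≡ suc k) b × (∂ʳ b ≗ z))

wedge-on : ∀ {m} (v : Fin m) (c : Subset m → ℚ) σ →
  (∀ ρ → ρ ⊆ σ → v ∈ σ → (∀ {u} → u ∈ σ → u ≡ v ⊎ u ∈ ρ) → suc ∣ ρ ∣ ≡ ∣ σ ∣ → c ρ ≡ 0ℚ) → wedge v c σ ≡ 0ℚ
wedge-on zero c (inside ∷ σ) h =
  h (outside ∷ σ) (λ { (there x) → there x }) here (λ { here → inj₁ refl ; (there x) → inj₂ (there x) }) refl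
wedge-on zero c (outside ∷ σ) h = refl
wedge-on (suc v) c (inside ∷ σ) h = cong ℚ.-_ (wedge-on v _ σ λ ρ ρ⊆σ v∈σ cov eq →
  h (inside ∷ ρ) (λ { here → here ; (there x) → there (ρ⊆σ x) }) (there v∈σ)
    (λ { here → inj₂ here ; (there x) → Sum.map (cong suc) there (cov x) }) (cong suc eq))
wedge-on (suc v) c (outside ∷ σ) h = wedge-on v _ σ λ ρ ρ⊆σ v∈σ cov eq →
  h (outside ∷ ρ) (λ { (there x) → there (ρ⊆σ x) }) (there v∈σ)
    (λ { (there x) → Sum.map (cong suc) there (cov x) }) eq

δ-∅ : ∀ {n} (T : Subset n → ℚ) → δ T ∅ ≡ 0ℚ
δ-∅ {zero} T = refl
δ-∅ {suc n} T = δ-∅ (T ∘ (outside ∷_))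

∂ʳ-cong-0 : ∀ {m} {c : Subset m → ℚ} (τ : Subset m) →
  (∀ ω → τ ⊆ ω → ∣ ω ∣ ≡ suc ∣ τ ∣ → c ω ≡ 0ℚ) → ∂ʳ c τ ≡ 0ℚ
∂ʳ-cong-0 τ h = trans (∂ʳ-local τ h) (vanish (∂ʳ-linear τ) _ (λ _ → refl))

δ-cong-0 : ∀ {n} {T : Subset n → ℚ} (I : Subset n) →
  (∀ J → J ⊆ I → suc ∣ J ∣ ≡ ∣ I ∣ → T J ≡ 0ℚ) → δ T I ≡ 0ℚ
δ-cong-0 I h = trans (δ-local I h) (vanish (δ-linear I) _ (λ _ → refl))

-- The simplex on the points `s i` with `i ∈ I`, as an exterior product. The signs of reordering and
-- the vanishing for repeated points come with the product.
monomial : ∀ {m n} → (Fin n → Fin m) → Subset n → (Subset m → ℚ)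
monomial s []            = indicator ∅
monomial s (outside ∷ I) = monomial (s ∘ suc) I
monomial s (inside ∷ I)  = wedge (s zero) (monomial (s ∘ suc) I)

∂ʳ-monomial : ∀ {m n} (s : Fin n → Fin m) I ρ → ∂ʳ (monomial s I) ρ ≡ δ (λ J → monomial s J ρ) I
∂ʳ-monomial s []            ρ = trans (∂ʳ-indicator ∅ ρ) (δ-∅ (λ ρ′ → indicator ρ′ ρ))
∂ʳ-monomial s (outside ∷ I) ρ = ∂ʳ-monomial (s ∘ suc) I ρ
∂ʳ-monomial s (inside ∷ I)  ρ = trans (∂ʳ-wedge (s zero) _ ρ)
  (cong (λ z → monomial (s ∘ suc) I ρ ℚ.- z) (trans
    (cong-≗ (wedge-linear (s zero) ρ) (∂ʳ-monomial (s ∘ suc) I))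
    (δ-commutes (wedge-linear (s zero) ρ) (monomial (s ∘ suc)) I)))

monomial-on : ∀ {m n} (s : Fin n → Fin m) I →
  On (λ ρ → (∀ {v} → v ∈ ρ → ∃[ i ] (i ∈ I × s i ≡ v)) × ∣ ρ ∣ ≡ ∣ I ∣) (monomial s I)
monomial-on {m} s [] ρ ¬p = indicator-≢ ∅ ρ λ { refl → ¬p ((λ v∈ → ⊥-elim (∉⊥ v∈)) , ∣⊥∣≡0 m) }
monomial-on s (outside ∷ I) ρ ¬p = monomial-on (s ∘ suc) I ρ λ (f , eq) →
  ¬p ((λ v∈ → let i , i∈ , e = f v∈ in suc i , there i∈ , e) , eq)
monomial-on s (inside ∷ I) ρ ¬p = wedge-on (s zero) _ ρ λ ρ′ _ s0∈ cov eq → monomial-on (s ∘ suc) I ρ′ λ (f , eq′) →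
  ¬p ((λ v∈ → g f (cov v∈)) , trans (sym eq) (cong suc eq′))
  where
  g : ∀ {ρ′ v} → (∀ {v} → v ∈ ρ′ → ∃[ i ] (i ∈ I × s (suc i) ≡ v)) → v ≡ s zero ⊎ v ∈ ρ′ → ∃[ i ] (i ∈ inside ∷ I × s i ≡ v)
  g f (inj₁ refl) = zero , here , refl
  g f (inj₂ v∈) = let i , i∈ , e = f v∈ in suc i , there i∈ , e

-- Λ κ is the chain map induced by a map κ of vertex sets.
Λ : ∀ {m n} → (Fin m → Fin n) → (Subset m → ℚ) → (Subset n → ℚ)
Λ {zero}  κ c I = c [] ℚ.* indicator ∅ I
Λ {suc m} κ c I = Λ (κ ∘ suc) (c ∘ (outside ∷_)) I ℚ.+ wedge (κ zero) (Λ (κ ∘ suc) (c ∘ (inside ∷_))) I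

Λ-linear : ∀ {m n} (κ : Fin m → Fin n) I → Linear (λ c → Λ κ c I)
Λ-linear {zero}  κ I = record
  { cong-≗ = λ p → cong (ℚ._* indicator ∅ I) (p [])
  ; lin    = λ a b x y → eq a b (x []) (y []) (indicator ∅ I) }
  where
  eq : ∀ a b x y i → (a ℚ.* x ℚ.+ b ℚ.* y) ℚ.* i ≡ a ℚ.* (x ℚ.* i) ℚ.+ b ℚ.* (y ℚ.* i)
  eq = solve-∀ ℚ-ring
Λ-linear {suc m} κ I = +-linear
  (pullback-linear (outside ∷_) (Λ-linear (κ ∘ suc) I))
  (pullback-linear (inside ∷_) (∘-linear (wedge-linear (κ zero) I) (Λ-linear (κ ∘ suc))))

∂ʳ-Λ : ∀ {m n} (κ : Fin m → Fin n) c → ∂ʳ (Λ κ c) ≗ Λ κ (∂ʳ c)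
∂ʳ-Λ {zero} κ c I = trans (scale (∂ʳ-linear I) (c []) (indicator ∅))
  (trans (cong (c [] ℚ.*_) (trans (∂ʳ-indicator ∅ I) (δ-∅ (λ ρ → indicator ρ I)))) (eq (c []) (indicator ∅ I)))
  where
  eq : ∀ a b → a ℚ.* 0ℚ ≡ 0ℚ ℚ.* b
  eq = solve-∀ ℚ-ring
∂ʳ-Λ {suc m} κ c I = begin
  ∂ʳ (λ J → Λ κ′ c₀ J ℚ.+ wedge v (Λ κ′ c₁) J) I          ≡⟨ additive (∂ʳ-linear I) (Λ κ′ c₀) (wedge v (Λ κ′ c₁)) ⟩
  ∂ʳ (Λ κ′ c₀) I ℚ.+ ∂ʳ (wedge v (Λ κ′ c₁)) I              ≡⟨ cong₂ ℚ._+_ (∂ʳ-Λ κ′ c₀ I) (∂ʳ-wedge v (Λ κ′ c₁) I) ⟩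
  Λ κ′ (∂ʳ c₀) I ℚ.+ (Λ κ′ c₁ I ℚ.- wedge v (∂ʳ (Λ κ′ c₁)) I)
    ≡⟨ cong (λ z → Λ κ′ (∂ʳ c₀) I ℚ.+ (Λ κ′ c₁ I ℚ.- z)) (cong-≗ (wedge-linear v I) (∂ʳ-Λ κ′ c₁)) ⟩
  Λ κ′ (∂ʳ c₀) I ℚ.+ (Λ κ′ c₁ I ℚ.- wedge v (Λ κ′ (∂ʳ c₁)) I)
    ≡⟨ eq (Λ κ′ (∂ʳ c₀) I) (Λ κ′ c₁ I) (wedge v (Λ κ′ (∂ʳ c₁)) I) ⟩
  (Λ κ′ c₁ I ℚ.+ Λ κ′ (∂ʳ c₀) I) ℚ.+ ℚ.- wedge v (Λ κ′ (∂ʳ c₁)) I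
    ≡⟨ cong₂ ℚ._+_ (sym (additive (Λ-linear κ′ I) c₁ (∂ʳ c₀)))
         (trans (sym (negate (wedge-linear v I) (Λ κ′ (∂ʳ c₁)))) (cong-≗ (wedge-linear v I) (λ J → sym (negate (Λ-linear κ′ J) (∂ʳ c₁))))) ⟩
  Λ κ (∂ʳ c) I ∎
  where
  open ≡-Reasoning
  κ′ = κ ∘ suc
  v = κ zero
  c₀ = c ∘ (outside ∷_)
  c₁ = c ∘ (inside ∷_)
  eq : ∀ a b w → a ℚ.+ (b ℚ.- w) ≡ (b ℚ.+ a) ℚ.+ ℚ.- w
  eq = solve-∀ ℚ-ring

-- `Λ κ` is a homomorphism of exterior algebras. For the generator `zero`, the half of `c` that
-- contains `zero` is lost on the left; on the right its image is killed because generators square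
-- to zero.
Λ-wedge : ∀ {m n} (κ : Fin m → Fin n) v c → Λ κ (wedge v c) ≗ wedge (κ v) (Λ κ c)
Λ-wedge {suc m} κ zero c I = begin
  Λ κ′ (λ _ → 0ℚ) I ℚ.+ wedge k (Λ κ′ c₀) I  ≡⟨ cong (ℚ._+ wedge k (Λ κ′ c₀) I) (vanish (Λ-linear κ′ I) _ (λ _ → refl)) ⟩
  0ℚ ℚ.+ wedge k (Λ κ′ c₀) I                   ≡⟨ ℚ.+-comm 0ℚ (wedge k (Λ κ′ c₀) I) ⟩
  wedge k (Λ κ′ c₀) I ℚ.+ 0ℚ                   ≡⟨ cong (wedge k (Λ κ′ c₀) I ℚ.+_) (sym (wedge-wedge-0 k (Λ κ′ c₁) I)) ⟩
  wedge k (Λ κ′ c₀) I ℚ.+ wedge k (wedge k (Λ κ′ c₁)) I ≡⟨ sym (additive (wedge-linear k I) (Λ κ′ c₀) (wedge k (Λ κ′ c₁))) ⟩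
  wedge k (Λ κ c) I ∎
  where
  open ≡-Reasoning
  κ′ = κ ∘ suc
  k = κ zero
  c₀ = c ∘ (outside ∷_)
  c₁ = c ∘ (inside ∷_)
Λ-wedge {suc m} κ (suc v) c I = begin
  Λ κ′ (wedge v c₀) I ℚ.+ wedge k (Λ κ′ (λ σ → ℚ.- wedge v c₁ σ)) I
    ≡⟨ cong₂ ℚ._+_ (Λ-wedge κ′ v c₀ I)
         (trans (cong-≗ (wedge-linear k I) (λ J → trans (negate (Λ-linear κ′ J) (wedge v c₁)) (cong ℚ.-_ (Λ-wedge κ′ v c₁ J))))
                (negate (wedge-linear k I) (wedge (κ (suc v)) (Λ κ′ c₁)))) ⟩
  wedge (κ (suc v)) (Λ κ′ c₀) I ℚ.+ ℚ.- wedge k (wedge (κ (suc v)) (Λ κ′ c₁)) I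
    ≡⟨ cong (wedge (κ (suc v)) (Λ κ′ c₀) I ℚ.+_) (sym (wedge-anticomm (κ (suc v)) k (Λ κ′ c₁) I)) ⟩
  wedge (κ (suc v)) (Λ κ′ c₀) I ℚ.+ wedge (κ (suc v)) (wedge k (Λ κ′ c₁)) I
    ≡⟨ sym (additive (wedge-linear (κ (suc v)) I) (Λ κ′ c₀) (wedge k (Λ κ′ c₁))) ⟩
  wedge (κ (suc v)) (Λ κ c) I ∎
  where
  open ≡-Reasoning
  κ′ = κ ∘ suc
  k = κ zero
  c₀ = c ∘ (outside ∷_)
  c₁ = c ∘ (inside ∷_)

Λ-indicator-∅ : ∀ {m n} (κ : Fin m → Fin n) → Λ κ (indicator ∅) ≗ indicator ∅
Λ-indicator-∅ {zero}  κ I = ℚ.*-identityˡ (indicator ∅ I)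
Λ-indicator-∅ {suc m} κ I = trans
  (cong₂ ℚ._+_ (Λ-indicator-∅ (κ ∘ suc) I) (vanish (wedge-linear (κ zero) I) _ (λ J → vanish (Λ-linear (κ ∘ suc) J) _ (λ _ → refl))))
  (ℚ.+-identityʳ (indicator ∅ I))

Λ-monomial : ∀ {l m n} (κ : Fin m → Fin n) (s : Fin l → Fin m) I → Λ κ (monomial s I) ≗ monomial (κ ∘ s) I
Λ-monomial κ s []            J = Λ-indicator-∅ κ J
Λ-monomial κ s (outside ∷ I) J = Λ-monomial κ (s ∘ suc) I J
Λ-monomial κ s (inside ∷ I)  J = trans (Λ-wedge κ (s zero) (monomial (s ∘ suc) I) J)
  (cong-≗ (wedge-linear (κ (s zero)) J) (Λ-monomial κ (s ∘ suc) I))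

monomial-cong : ∀ {m n} {s t : Fin n → Fin m} → s ≗ t → ∀ I → monomial s I ≗ monomial t I
monomial-cong p []            ρ = refl
monomial-cong p (outside ∷ I) ρ = monomial-cong (p ∘ suc) I ρ
monomial-cong {s = s} {t} p (inside ∷ I) ρ = trans (cong-≗ (wedge-linear (s zero) ρ) (monomial-cong (p ∘ suc) I))
  (cong (λ v → wedge v (monomial (t ∘ suc) I) ρ) (p zero))

monomial-suc : ∀ {m n} (s : Fin n → Fin m) I ρ → monomial (suc ∘ s) I (outside ∷ ρ) ≡ monomial s I ρ
monomial-suc s []            ρ = refl
monomial-suc s (outside ∷ I) ρ = monomial-suc (s ∘ suc) I ρ
monomial-suc s (inside ∷ I)  ρ = cong-≗ (wedge-linear (s zero) ρ) (monomial-suc (s ∘ suc) I)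

monomial-full : ∀ n → monomial {n} id full full ≡ 1ℚ
monomial-full zero    = refl
monomial-full (suc n) = trans (monomial-suc id (full {n}) full) (monomial-full n)

-- Only simplices meeting every color of `I` contribute to the coefficient at `I`. At `full` this
-- says that the degree sees only simplices with all colors.
Λ-on : ∀ {m n} (κ : Fin m → Fin n) c I →
  (∀ ρ → (∀ {i} → i ∈ I → ∃[ v ] (v ∈ ρ × κ v ≡ i)) → c ρ ≡ 0ℚ) → Λ κ c I ≡ 0ℚ
Λ-on {zero} κ c I h with nonempty? I
... | yes (i , i∈I) = trans (cong (c [] ℚ.*_) (indicator-≢ ∅ I λ { refl → ∉⊥ i∈I })) (ℚ.*-zeroʳ (c []))
... | no  I-empty   = trans (cong (ℚ._* indicator ∅ I) (h [] (λ i∈I → ⊥-elim (I-empty (_ , i∈I))))) (ℚ.*-zeroˡ (indicator ∅ I))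
Λ-on {suc m} κ c I h = cong₂ ℚ._+_
  (Λ-on (κ ∘ suc) _ I λ ρ cov → h (outside ∷ ρ) λ i∈ → let v , v∈ , e = cov i∈ in suc v , there v∈ , e)
  (wedge-on (κ zero) _ I λ J _ _ covJ _ → Λ-on (κ ∘ suc) _ J λ ρ cov → h (inside ∷ ρ) λ i∈ → g ρ cov (covJ i∈))
  where
  g : ∀ {J i} ρ → (∀ {i} → i ∈ J → ∃[ v ] (v ∈ ρ × κ (suc v) ≡ i)) → i ≡ κ zero ⊎ i ∈ J → ∃[ v ] (v ∈ inside ∷ ρ × κ v ≡ i)
  g ρ cov (inj₁ refl) = zero , here , refl
  g ρ cov (inj₂ i∈) = let v , v∈ , e = cov i∈ in suc v , there v∈ , e

-- Cutting a chain down to a decidable family of simplices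

restrict : ∀ {m} {P : Subset m → Set} → Decidable P → (Subset m → ℚ) → (Subset m → ℚ)
restrict P? c σ = if does (P? σ) then c σ else 0ℚ

restrict-linear : ∀ {m} {P : Subset m → Set} (P? : Decidable P) σ → Linear (λ c → restrict P? c σ)
restrict-linear P? σ with does (P? σ)
... | true  = eval-linear σ
... | false = 0-linear

restrict-yes : ∀ {m} {P : Subset m → Set} (P? : Decidable P) c σ → P σ → restrict P? c σ ≡ c σ
restrict-yes P? c σ p with P? σ
... | yes _ = refl
... | no ¬p = ⊥-elim (¬p p)

restrict-0 : ∀ {m} {P : Subset m → Set} (P? : Decidable P) c σ → c σ ≡ 0ℚ → restrict P? c σ ≡ 0ℚ
restrict-0 P? c σ e with does (P? σ)
... | true  = e
... | false = refl

module Colored {m n} (C : Complex m) (κ : Fin m → Fin n) where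

  Colors⊆ : Subset n → Subset m → Set
  Colors⊆ I σ = ∀ {v} → v ∈ σ → κ v ∈ I

  Over : Subset n → Subset m → Set
  Over I σ = Simplex C σ × Colors⊆ I σ

  Covers : Subset m → Set
  Covers ρ = ∀ i → ∃[ v ] (v ∈ ρ × κ v ≡ i)

  open Reconfiguration C κ n

  -- With n vertices and n colors, injectivity amounts to meeting every color, which is decided by
  -- searching for a vertex of each color.
  rainbow? : Decidable Config
  rainbow? ρ = map′ (λ (Cρ , cov , e) → Cρ , covers⇒injective κ ρ cov e , e) (λ (Cρ , inj , e) → Cρ , injective⇒covers κ ρ inj e , e)
    (simplex? C ρ ×-dec Fin.all? (λ i → Fin.any? (λ v → (v ∈? ρ) ×-dec (κ v Fin.≟ i))) ×-dec (∣ ρ ∣ ℕ.≟ n))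

  move? : ∀ ρ ρ′ → Dec (Move ρ ρ′)
  move? ρ ρ′ = rainbow? ρ ×-dec rainbow? ρ′ ×-dec simplex? C (ρ ∪ ρ′) ×-dec (∣ ρ ∪ ρ′ ∣ ℕ.≟ suc n)

  linked? : ∀ ρ ρ′ → Dec (Star Move ρ ρ′)
  linked? = Reachability.star? Move (Vec.≡-dec Bool._≟_) move? (subsets m) ∈-subsets

  -- A homotopy between two sections: filling the spheres of the prism over
  -- the simplex of colors, one face I at a time.
  module _ (acyclic : ∀ I → Nonempty I → Acyclic (Over I) ∣ I ∣)
    (s t : Fin n → Fin m) (κs : ∀ i → κ (s i) ≡ i) (κt : ∀ i → κ (t i) ≡ i)
    {σ τ : Subset m} (Cσ : Simplex C σ) (Cτ : Simplex C τ) (s∈σ : ∀ i → s i ∈ σ) (t∈τ : ∀ i → t i ∈ τ) where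

    ends : Subset n → Subset m → ℚ
    ends I ρ = monomial t I ρ ℚ.- monomial s I ρ

    Rim : (Subset n → Subset m → ℚ) → Subset n → Subset m → ℚ
    Rim T I ρ = ends I ρ ℚ.- δ (λ J → T J ρ) I

    Over# : Subset n → ℕ → Subset m → Set
    Over# I k ρ = Over I ρ × ∣ ρ ∣ ≡ k

    section-on : ∀ {u : Fin n → Fin m} {ω} → (∀ i → κ (u i) ≡ i) → Simplex C ω → (∀ i → u i ∈ ω) →
      ∀ I → On (Over# I ∣ I ∣) (monomial u I)
    section-on {u} κu Cω u∈ω I ρ ¬p = monomial-on u I ρ λ (f , eq) → ¬p
      ((down-closed C (λ v∈ → let i , _ , e = f v∈ in subst (_∈ _) e (u∈ω i)) Cω ,
        λ v∈ → let i , i∈ , e = f v∈ in subst (_∈ I) (trans (sym (κu i)) (cong κ e)) i∈) , eq)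

    FillsAt : (Subset n → Subset m → ℚ) → Subset n → Set
    FillsAt T I = On (Over# I (suc ∣ I ∣)) (T I) × (∂ʳ (T I) ≗ Rim T I)

    rim-on : ∀ T I → (∀ J → J ⊆ I → suc ∣ J ∣ ≡ ∣ I ∣ → FillsAt T J) → On (Over# I ∣ I ∣) (Rim T I)
    rim-on T I fills ρ ¬p = cong₂ ℚ._-_
      (cong₂ ℚ._-_ (section-on κt Cτ t∈τ I ρ ¬p) (section-on κs Cσ s∈σ I ρ ¬p))
      (δ-cong-0 I λ J J⊆I eq → proj₁ (fills J J⊆I eq) ρ λ ((Cρ , col) , ∣ρ∣) → ¬p ((Cρ , J⊆I ∘ col) , trans ∣ρ∣ eq))

    -- Sections are natural in the face: `∂ʳ` of the ends is `δ` of the ends. By the equations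
    -- already solved on the facets, `∂ʳ` of the side walls is `δ` of the ends minus a `δ` of a `δ`,
    -- so the two cancel.
    rim-cycle : ∀ T I → (∀ J → J ⊆ I → suc ∣ J ∣ ≡ ∣ I ∣ → FillsAt T J) → ∀ ρ → ∂ʳ (Rim T I) ρ ≡ 0ℚ
    rim-cycle T I fills ρ = begin
      ∂ʳ (Rim T I) ρ
        ≡⟨ minus (∂ʳ-linear ρ) (ends I) (λ ρ′ → δ (λ J → T J ρ′) I) ⟩
      ∂ʳ (ends I) ρ ℚ.- ∂ʳ (λ ρ′ → δ (λ J → T J ρ′) I) ρ
        ≡⟨ cong₂ ℚ._-_ (trans (minus (∂ʳ-linear ρ) (monomial t I) (monomial s I)) (trans (cong₂ ℚ._-_ (∂ʳ-monomial t I ρ) (∂ʳ-monomial s I ρ))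
             (sym (minus (δ-linear I) (λ J → monomial t J ρ) (λ J → monomial s J ρ)))))
             (trans (δ-commutes (∂ʳ-linear ρ) T I) (trans (δ-local I (λ J J⊆I eq → proj₂ (fills J J⊆I eq) ρ))
               (minus (δ-linear I) (λ J → ends J ρ) (δ (λ J → T J ρ))))) ⟩
      δ (λ J → ends J ρ) I ℚ.- (δ (λ J → ends J ρ) I ℚ.- δ (δ (λ J → T J ρ)) I)
        ≡⟨ cong (λ z → δ (λ J → ends J ρ) I ℚ.- (δ (λ J → ends J ρ) I ℚ.- z)) (δ-δ (λ J → T J ρ) I) ⟩
      δ (λ J → ends J ρ) I ℚ.- (δ (λ J → ends J ρ) I ℚ.- 0ℚ)
        ≡⟨ eq (δ (λ J → ends J ρ) I) ⟩
      0ℚ ∎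
      where
      open ≡-Reasoning
      eq : ∀ a → a ℚ.- (a ℚ.- 0ℚ) ≡ 0ℚ
      eq = solve-∀ ℚ-ring

    rim-local : ∀ T T′ I → (∀ J → suc ∣ J ∣ ≡ ∣ I ∣ → T J ≡ T′ J) → Rim T I ≗ Rim T′ I
    rim-local T T′ I h ρ = cong (λ z → ends I ρ ℚ.- z) (δ-local I λ J _ eq → cong (λ c → c ρ) (h J eq))

    private
      fill-rim : ∀ k T → (∀ I → ∣ I ∣ ℕ.≤ k → FillsAt T I) → ∀ I → ∣ I ∣ ≡ suc k →
        Σ[ b ∈ (Subset m → ℚ) ] (On (Over# I (suc ∣ I ∣)) b × (∂ʳ b ≗ Rim T I))
      fill-rim k T fills I ∣I∣ = acyclic I nonempty (Rim T I) (rim-on T I fills′) (rim-cycle T I fills′)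
        where
        fills′ : ∀ J → J ⊆ I → suc ∣ J ∣ ≡ ∣ I ∣ → FillsAt T J
        fills′ J _ eq = fills J (ℕ.≤-reflexive (ℕ.suc-injective (trans eq ∣I∣)))
        nonempty : Nonempty I
        nonempty with nonempty? I
        ... | yes ne = ne
        ... | no  em with trans (sym ∣I∣) (trans (cong ∣_∣ (Empty-unique em)) (∣⊥∣≡0 n))
        ...   | ()

    -- One step changes `T` only at color sets of size k + 1. Since `Rim T I` reads `T` only at
    -- facets of `I`, the equations solved earlier survive the change.
    filling : ∀ k → Σ[ T ∈ (Subset n → Subset m → ℚ) ] (∀ I → ∣ I ∣ ℕ.≤ k → FillsAt T I)
    -- Over the empty set of colors both sections are the empty simplex, so the zero chain fills the
    -- rim.
    filling zero = (λ _ _ → 0ℚ) , λ I ∣I∣≤0 → (λ _ _ → refl) , λ ρ →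
      trans (vanish (∂ʳ-linear ρ) _ (λ _ → refl)) (sym (rim-0 I (ℕ.n≤0⇒n≡0 ∣I∣≤0) ρ))
      where
      monomial-0 : ∀ {k l} {u u′ : Fin k → Fin l} (I : Subset k) → ∣ I ∣ ≡ 0 → monomial u I ≡ monomial u′ I
      monomial-0 []            _  = refl
      monomial-0 (outside ∷ I) eq = monomial-0 I eq
      rim-0 : ∀ I → ∣ I ∣ ≡ 0 → ∀ ρ → Rim (λ _ _ → 0ℚ) I ρ ≡ 0ℚ
      rim-0 I eq ρ = trans (cong₂ (λ a b → (a ℚ.- monomial s I ρ) ℚ.- b) (cong (λ c → c ρ) (monomial-0 I eq))
        (vanish (δ-linear I) _ (λ _ → refl))) (eq′ (monomial s I ρ))
        where
        eq′ : ∀ a → (a ℚ.- a) ℚ.- 0ℚ ≡ 0ℚ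
        eq′ = solve-∀ ℚ-ring
    filling (suc k) with filling k
    ... | T , fills = T′ , fills-T′
      where
      choose : ∀ I → Dec (∣ I ∣ ≡ suc k) → Subset m → ℚ
      choose I (yes eq) = proj₁ (fill-rim k T fills I eq)
      choose I (no  _)  = T I
      T′ : Subset n → Subset m → ℚ
      T′ I = choose I (∣ I ∣ ℕ.≟ suc k)
      T≡T′ : ∀ I → ∣ I ∣ ≢ suc k → T I ≡ T′ I
      T≡T′ I ne with ∣ I ∣ ℕ.≟ suc k
      ... | yes eq = ⊥-elim (ne eq)
      ... | no  _  = refl
      below-top : ∀ I → ∣ I ∣ ℕ.≤ suc k → ∀ J → suc ∣ J ∣ ≡ ∣ I ∣ → T J ≡ T′ J
      below-top I le J eq = T≡T′ J (ℕ.<⇒≢ (ℕ.≤-trans (ℕ.≤-reflexive eq) le))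
      fills-T′ : ∀ I → ∣ I ∣ ℕ.≤ suc k → FillsAt T′ I
      fills-T′ I le = aux (∣ I ∣ ℕ.≟ suc k) refl
        where
        aux : (d : Dec (∣ I ∣ ≡ suc k)) → choose I d ≡ T′ I → FillsAt T′ I
        aux (yes eq) e = let b , on , ∂b = fill-rim k T fills I eq in
          subst (λ c → On (Over# I (suc ∣ I ∣)) c × (∂ʳ c ≗ Rim T′ I)) e
            (on , λ ρ → trans (∂b ρ) (rim-local T T′ I (below-top I le) ρ))
        aux (no ne) e = let on , ∂T = fills I (ℕ.≤-pred (ℕ.≤∧≢⇒< le ne)) in
          subst (λ c → On (Over# I (suc ∣ I ∣)) c × (∂ʳ c ≗ Rim T′ I)) e
            (on , λ ρ → trans (∂T ρ) (rim-local T T′ I (below-top I le) ρ))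

    private
      T : Subset n → Subset m → ℚ
      T = proj₁ (filling n)

      T-fills : ∀ I → FillsAt T I
      T-fills I = proj₂ (filling n) I (∣p∣≤n I)

      c : Subset m → ℚ
      c = T full

      c-on : ∀ ω → ¬ (Simplex C ω × ∣ ω ∣ ≡ suc n) → c ω ≡ 0ℚ
      c-on ω ¬p = proj₁ (T-fills full) ω λ ((Cω , _) , eq) → ¬p (Cω , trans eq (cong suc (∣⊤∣≡n n)))

    module Component {P : Subset m → Set} (P? : Decidable P) (closed : ∀ {ρ ρ′} → P ρ → Star Move ρ ρ′ → P ρ′) where

      Meets : Subset m → Set
      Meets ω = ∃[ ρ ] (ρ ⊆ ω × Config ρ × P ρ)

      meets? : Decidable Meets
      meets? ω = anySubset? (λ ρ → (ρ ⊆? ω) ×-dec rainbow? ρ ×-dec P? ρ)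

      -- All rainbow facets of a simplex with n + 1 vertices are linked, so
      -- cutting down to a union of components commutes with ∂.
      restrict-∂ : ∀ ρ → Covers ρ → restrict P? (∂ʳ c) ρ ≡ ∂ʳ (restrict meets? c) ρ
      restrict-∂ ρ cov with rainbow? ρ
      -- A coface in the support of `c` has n + 1 vertices and would make `ρ` a simplex with n
      -- vertices and all colors, hence rainbow. So `c` vanishes on all cofaces and both sides are
      -- 0.
      ... | no ¬r = trans (restrict-0 P? (∂ʳ c) ρ (∂ʳ-cong-0 ρ off))
                          (sym (∂ʳ-cong-0 ρ λ ω ρ⊆ω eq → restrict-0 meets? c ω (off ω ρ⊆ω eq)))
        where
        rainbow : Simplex C ρ → ∣ ρ ∣ ≡ n → Config ρ
        rainbow Cρ ∣ρ∣ = Cρ , covers⇒injective κ ρ cov ∣ρ∣ , ∣ρ∣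
        off : ∀ ω → ρ ⊆ ω → ∣ ω ∣ ≡ suc ∣ ρ ∣ → c ω ≡ 0ℚ
        off ω ρ⊆ω eq = c-on ω λ (Cω , eq′) → ¬r (rainbow (down-closed C ρ⊆ω Cω) (ℕ.suc-injective (trans (sym eq) eq′)))
      ... | yes r with P? ρ
      ...   | yes p = ∂ʳ-local ρ λ ω ρ⊆ω _ → sym (restrict-yes meets? c ω (ρ , (λ {x} → ρ⊆ω {x}) , r , p))
      ...   | no ¬p = sym (∂ʳ-cong-0 ρ off)
        where
        off : ∀ ω → ρ ⊆ ω → ∣ ω ∣ ≡ suc ∣ ρ ∣ → restrict meets? c ω ≡ 0ℚ
        off ω ρ⊆ω eq with meets? ω
        ... | no _ = refl
        ... | yes (ρ′ , ρ′⊆ω , r′ , p′) =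
          c-on ω λ (Cω , ∣ω∣) → ¬p (closed p′ (linked Cω (ℕ.≤-reflexive ∣ω∣) (λ {x} → ρ′⊆ω {x}) ρ⊆ω r′ r))

      private
        ΛP : (Subset m → ℚ) → ℚ
        ΛP x = Λ κ (restrict P? x) full

        ΛP-linear : Linear ΛP
        ΛP-linear = ∘-linear (Λ-linear κ full) (restrict-linear P?)

      -- The degree only sees simplices meeting all colors, where cutting commutes with `∂ʳ`. It is
      -- therefore the degree of a boundary, and such a degree is 0 by `∂ʳ-full`.
      Λ-∂c : ΛP (∂ʳ c) ≡ 0ℚ
      Λ-∂c = begin
        ΛP (∂ʳ c)                                    ≡⟨ a-b≡0⇒a≡b (trans (sym (minus (Λ-linear κ full) (restrict P? (∂ʳ c)) (∂ʳ (restrict meets? c))))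
                                                          (Λ-on κ _ full λ ρ cov → trans (cong (ℚ._- ∂ʳ (restrict meets? c) ρ) (restrict-∂ ρ (λ i → cov ∈⊤)))
                                                            (ℚ.+-inverseʳ (∂ʳ (restrict meets? c) ρ)))) ⟩
        Λ κ (∂ʳ (restrict meets? c)) full            ≡⟨ sym (∂ʳ-Λ κ (restrict meets? c) full) ⟩
        ∂ʳ (Λ κ (restrict meets? c)) full            ≡⟨ ∂ʳ-full (Λ κ (restrict meets? c)) ⟩
        0ℚ                                           ∎
        where
        open ≡-Reasoning
        eq : ∀ a b → a ≡ (a ℚ.- b) ℚ.+ b
        eq = solve-∀ ℚ-ring
        a-b≡0⇒a≡b : ∀ {a b} → a ℚ.- b ≡ 0ℚ → a ≡ b
        a-b≡0⇒a≡b {a} {b} e = trans (eq a b) (trans (cong (ℚ._+ b) e) (ℚ.+-identityˡ b))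

      Λ-ends : ΛP (monomial t full) ≡ ΛP (monomial s full)
      Λ-ends = begin
        ΛP (monomial t full)
          ≡⟨ eq (ΛP (monomial t full)) (ΛP (monomial s full)) ⟩
        ((ΛP (monomial t full) ℚ.- ΛP (monomial s full)) ℚ.- 0ℚ) ℚ.+ ΛP (monomial s full)
          ≡⟨ cong (λ z → ((ΛP (monomial t full) ℚ.- ΛP (monomial s full)) ℚ.- z) ℚ.+ ΛP (monomial s full)) (sym δ-part) ⟩
        ((ΛP (monomial t full) ℚ.- ΛP (monomial s full)) ℚ.- δ (λ J → ΛP (T J)) full) ℚ.+ ΛP (monomial s full)
          ≡⟨ cong (ℚ._+ ΛP (monomial s full)) (sym expand) ⟩
        ΛP (∂ʳ c) ℚ.+ ΛP (monomial s full)
          ≡⟨ cong (ℚ._+ ΛP (monomial s full)) Λ-∂c ⟩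
        0ℚ ℚ.+ ΛP (monomial s full)
          ≡⟨ ℚ.+-identityˡ (ΛP (monomial s full)) ⟩
        ΛP (monomial s full) ∎
        where
        open ≡-Reasoning
        eq : ∀ a b → a ≡ ((a ℚ.- b) ℚ.- 0ℚ) ℚ.+ b
        eq = solve-∀ ℚ-ring
        -- The facets `J` of `full` lack a color, so the side walls `T J` have no simplex with all
        -- colors.
        δ-part : δ (λ J → ΛP (T J)) full ≡ 0ℚ
        δ-part = δ-cong-0 full λ J _ ∣J∣ → Λ-on κ _ full λ ρ cov → restrict-0 P? (T J) ρ (proj₁ (T-fills J) ρ
          λ ((_ , col) , _) → ℕ.1+n≰n (ℕ.≤-trans (ℕ.≤-reflexive ∣J∣)
            (p⊆q⇒∣p∣≤∣q∣ {p = full} {q = J} (λ {i} _ → let v , v∈ , e = cov (∈⊤ {x = i}) in subst (_∈ J) e (col v∈)))))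
        expand : ΛP (∂ʳ c) ≡ (ΛP (monomial t full) ℚ.- ΛP (monomial s full)) ℚ.- δ (λ J → ΛP (T J)) full
        expand = trans (cong-≗ ΛP-linear (proj₂ (T-fills full)))
          (trans (minus ΛP-linear (ends full) (λ ρ → δ (λ J → T J ρ) full))
            (cong₂ ℚ._-_ (minus ΛP-linear (monomial t full) (monomial s full)) (δ-commutes ΛP-linear T full)))

      Λ-section : ∀ {u : Fin n → Fin m} → (∀ i → κ (u i) ≡ i) → Λ κ (monomial u full) full ≡ 1ℚ
      Λ-section {u} κu = trans (Λ-monomial κ u full full) (trans (monomial-cong κu full full) (monomial-full n))

      monomial-at : ∀ {u : Fin n → Fin m} {ω} → (∀ i → u i ∈ ω) → ∣ ω ∣ ≡ n → ∀ ρ → ρ ≢ ω → monomial u full ρ ≡ 0ℚ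
      monomial-at {u} {ω} u∈ω ∣ω∣ ρ ρ≢ω = monomial-on u full ρ λ (f , eq) → ρ≢ω (⊆∧∣∣≡⇒≡
        (λ v∈ → let i , _ , e = f v∈ in subst (_∈ ω) e (u∈ω i)) (ℕ.≤-reflexive (trans ∣ω∣ (sym (trans eq (∣⊤∣≡n n))))))

      -- Otherwise cutting to `P` removes the section `t` altogether, leaving degree 0, while it
      -- keeps the section `s`, which has degree 1.
      transfer : ∣ σ ∣ ≡ n → ∣ τ ∣ ≡ n → P σ → P τ
      transfer ∣σ∣ ∣τ∣ Pσ with P? τ
      ... | yes Pτ = Pτ
      ... | no ¬Pτ = ⊥-elim (ℚ.1≢0 (trans (sym at-s) (trans (sym Λ-ends) at-t)))
        where
        at-s : ΛP (monomial s full) ≡ 1ℚ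
        at-s = trans (cong-≗ (Λ-linear κ full) agree) (Λ-section κs)
          where
          agree : restrict P? (monomial s full) ≗ monomial s full
          agree ρ with P? ρ
          ... | yes _  = refl
          ... | no ¬Pρ = sym (monomial-at s∈σ ∣σ∣ ρ λ { refl → ¬Pρ Pσ })
        at-t : ΛP (monomial t full) ≡ 0ℚ
        at-t = vanish (Λ-linear κ full) _ agree
          where
          agree : ∀ ρ → restrict P? (monomial t full) ρ ≡ 0ℚ
          agree ρ with P? ρ
          ... | yes Pρ = monomial-at t∈τ ∣τ∣ ρ λ { refl → ¬Pτ Pρ }
          ... | no _   = refl

  rainbow-connected : (∀ I → Nonempty I → Acyclic (Over I) ∣ I ∣) →
    ∀ {σ τ} → Config σ → Config τ → Star Move σ τ
  rainbow-connected acyclic {σ} {τ} (Cσ , inj-σ , ∣σ∣) (Cτ , inj-τ , ∣τ∣) =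
    Component.transfer acyclic (proj₁ ∘ cov-σ) (proj₁ ∘ cov-τ) (proj₂ ∘ proj₂ ∘ cov-σ) (proj₂ ∘ proj₂ ∘ cov-τ)
      Cσ Cτ (proj₁ ∘ proj₂ ∘ cov-σ) (proj₁ ∘ proj₂ ∘ cov-τ) (linked? σ) _◅◅_ ∣σ∣ ∣τ∣ done
    where
    cov-σ : Covers σ
    cov-σ = injective⇒covers κ σ inj-σ ∣σ∣
    cov-τ : Covers τ
    cov-τ = injective⇒covers κ τ inj-τ ∣τ∣

-- Joining isolated points: from d + 1 to d

++-∈⁺ˡ : ∀ {n m} {J : Subset n} {ρ : Subset m} {i} → i ∈ J → i ↑ˡ m ∈ J ++ ρ
++-∈⁺ˡ here      = here
++-∈⁺ˡ (there i) = there (++-∈⁺ˡ i)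

++-∈⁺ʳ : ∀ {n m} (J : Subset n) {ρ : Subset m} {v} → v ∈ ρ → n ↑ʳ v ∈ J ++ ρ
++-∈⁺ʳ []      v = v
++-∈⁺ʳ (_ ∷ J) v = there (++-∈⁺ʳ J v)

++-∈⁻ : ∀ {n m} (J : Subset n) {ρ : Subset m} {x} → x ∈ J ++ ρ →
  (∃[ i ] (i ∈ J × x ≡ i ↑ˡ m)) ⊎ (∃[ v ] (v ∈ ρ × x ≡ n ↑ʳ v))
++-∈⁻ []      x∈       = inj₂ (_ , x∈ , refl)
++-∈⁻ (_ ∷ J) here     = inj₁ (zero , here , refl)
++-∈⁻ (_ ∷ J) (there x∈) with ++-∈⁻ J x∈
... | inj₁ (i , i∈ , refl) = inj₁ (suc i , there i∈ , refl)
... | inj₂ (v , v∈ , refl) = inj₂ (v , v∈ , refl)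

∣++∣ : ∀ {n m} (J : Subset n) (ρ : Subset m) → ∣ J ++ ρ ∣ ≡ ∣ J ∣ ℕ.+ ∣ ρ ∣
∣++∣ []            ρ = refl
∣++∣ (outside ∷ J) ρ = ∣++∣ J ρ
∣++∣ (inside ∷ J)  ρ = cong suc (∣++∣ J ρ)

take-++ : ∀ {n m} (J : Subset n) (ρ : Subset m) → take n (J ++ ρ) ≡ J
take-++ []      ρ = refl
take-++ (x ∷ J) ρ = cong (x ∷_) (take-++ J ρ)

drop-++ : ∀ {n m} (J : Subset n) (ρ : Subset m) → drop n (J ++ ρ) ≡ ρ
drop-++ []      ρ = refl
drop-++ (x ∷ J) ρ = drop-++ J ρ

∂ʳ-++ : ∀ {n m} (c : Subset (n ℕ.+ m) → ℚ) (J : Subset n) (ρ : Subset m) →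
  ∂ʳ c (J ++ ρ) ≡ ∂ʳ (λ J′ → c (J′ ++ ρ)) J ℚ.+ sgn ∣ J ∣ ℚ.* ∂ʳ (λ ρ′ → c (J ++ ρ′)) ρ
∂ʳ-++ c [] ρ = eq (∂ʳ c ρ)
  where
  eq : ∀ a → a ≡ 0ℚ ℚ.+ 1ℚ ℚ.* a
  eq = solve-∀ ℚ-ring
∂ʳ-++ c (outside ∷ J) ρ = trans (cong (c (inside ∷ (J ++ ρ)) ℚ.+_) (∂ʳ-++ (c ∘ (outside ∷_)) J ρ)) (sym (ℚ.+-assoc (c (inside ∷ (J ++ ρ)))
  (∂ʳ (λ J′ → c (outside ∷ (J′ ++ ρ))) J) (sgn ∣ J ∣ ℚ.* ∂ʳ (λ ρ′ → c (outside ∷ (J ++ ρ′))) ρ)))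
∂ʳ-++ c (inside ∷ J) ρ = trans (cong ℚ.-_ (∂ʳ-++ (c ∘ (inside ∷_)) J ρ))
  (eq (∂ʳ (λ J′ → c (inside ∷ (J′ ++ ρ))) J) (sgn ∣ J ∣) (∂ʳ (λ ρ′ → c (inside ∷ (J ++ ρ′))) ρ))
  where
  eq : ∀ a s b → ℚ.- (a ℚ.+ s ℚ.* b) ≡ ℚ.- a ℚ.+ (ℚ.- s) ℚ.* b
  eq = solve-∀ ℚ-ring

sum : ∀ {n} → (Fin n → ℚ) → ℚ
sum = Vector.foldr ℚ._+_ 0ℚ

∂ʳ-∅ : ∀ {n} (c : Subset n → ℚ) → ∂ʳ c ∅ ≡ sum (λ i → c ⁅ i ⁆)
∂ʳ-∅ {zero}  c = refl
∂ʳ-∅ {suc n} c = cong (c ⁅ zero ⁆ ℚ.+_) (∂ʳ-∅ (c ∘ (outside ∷_)))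

sum-commutes : ∀ {A : Set} {F : (A → ℚ) → ℚ} → Linear F → ∀ {n} (g : Fin n → A → ℚ) →
  F (λ s → sum (λ i → g i s)) ≡ sum (λ i → F (g i))
sum-commutes f {zero}  g = vanish f _ (λ _ → refl)
sum-commutes {F = F} f {suc n} g = trans (additive f (g zero) (λ s → sum (λ i → g (suc i) s))) (cong (F (g zero) ℚ.+_) (sum-commutes f (g ∘ suc)))

sum-0 : ∀ {n} (g : Fin n → ℚ) → (∀ i → g i ≡ 0ℚ) → sum g ≡ 0ℚ
sum-0 {zero}  g h = refl
sum-0 {suc n} g h = cong₂ ℚ._+_ (h zero) (sum-0 (g ∘ suc) (h ∘ suc))

sum-minus : ∀ {n} (g h : Fin n → ℚ) → sum (λ i → g i ℚ.- h i) ≡ sum g ℚ.- sum h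
sum-minus {zero}  g h = refl
sum-minus {suc n} g h = trans (cong (g zero ℚ.- h zero ℚ.+_) (sum-minus (g ∘ suc) (h ∘ suc)))
  (eq (g zero) (h zero) (sum (g ∘ suc)) (sum (h ∘ suc)))
  where
  eq : ∀ a b x y → (a ℚ.- b) ℚ.+ (x ℚ.- y) ≡ (a ℚ.+ x) ℚ.- (b ℚ.+ y)
  eq = solve-∀ ℚ-ring

sum-single : ∀ {n} (g : Fin n → ℚ) i → (∀ j → j ≢ i → g j ≡ 0ℚ) → sum g ≡ g i
sum-single g zero h = trans (cong (g zero ℚ.+_) (sum-0 (g ∘ suc) (λ j → h (suc j) λ ()))) (ℚ.+-identityʳ (g zero))
sum-single g (suc i) h = trans (cong₂ ℚ._+_ (h zero λ ()) (sum-single (g ∘ suc) i (λ j ne → h (suc j) (ne ∘ Fin.suc-injective))))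
  (ℚ.+-identityˡ (g (suc i)))

⁅⁆-injective : ∀ {n} {i j : Fin n} → ⁅ i ⁆ ≡ ⁅ j ⁆ → i ≡ j
⁅⁆-injective {i = i} {j} e = x∈⁅y⁆⇒x≡y j (subst (i ∈_) e (x∈⁅x⁆ i))

∣J∣≤1⇒ : ∀ {n} (J : Subset n) → ∣ J ∣ ℕ.≤ 1 → J ≡ ∅ ⊎ ∃[ i ] J ≡ ⁅ i ⁆
∣J∣≤1⇒ [] _ = inj₁ refl
∣J∣≤1⇒ (outside ∷ J) le with ∣J∣≤1⇒ J le
... | inj₁ refl       = inj₁ refl
... | inj₂ (i , refl) = inj₂ (suc i , refl)
∣J∣≤1⇒ (inside ∷ J) (s≤s le) = inj₂ (zero , cong (inside ∷_) (⊆-antisym (λ x∈ → ⊥-elim (none J (ℕ.n≤0⇒n≡0 le) x∈)) ⊥⊆))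
  where
  none : ∀ {n} (J : Subset n) → ∣ J ∣ ≡ 0 → ∀ {x} → x ∉ J
  none (outside ∷ J) e (there x∈) = none J e x∈
  none (inside ∷ J) () here


data Split (n : ℕ) {m : ℕ} : Subset (n ℕ.+ m) → Set where
  _⊹_ : (J : Subset n) (ρ : Subset m) → Split n (J ++ ρ)

split : ∀ n {m} (ω : Subset (n ℕ.+ m)) → Split n ω
split zero    ω       = [] ⊹ ω
split (suc n) (x ∷ ω) with split n ω
... | J ⊹ ρ = (x ∷ J) ⊹ ρ

++-⊆ˡ : ∀ {n m} {J J′ : Subset n} {ρ ρ′ : Subset m} → J ++ ρ ⊆ J′ ++ ρ′ → J ⊆ J′
++-⊆ˡ {J = x ∷ J} {x′ ∷ J′} h here with h here
... | here = here
++-⊆ˡ {J = x ∷ J} {x′ ∷ J′} h (there i) = there (++-⊆ˡ (drop-there ∘ h ∘ there) i)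

++-⊆ʳ : ∀ {n m} (J J′ : Subset n) {ρ ρ′ : Subset m} → J ++ ρ ⊆ J′ ++ ρ′ → ρ ⊆ ρ′
++-⊆ʳ []      []       h = h
++-⊆ʳ (x ∷ J) (_ ∷ J′) h = ++-⊆ʳ J J′ (drop-there ∘ h ∘ there)

∅++∅ : ∀ n m → ∅ {n ℕ.+ m} ≡ ∅ {n} ++ ∅ {m}
∅++∅ zero    m = refl
∅++∅ (suc n) m = cong (outside ∷_) (∅++∅ n m)

-- The join of C with n isolated points, the i-th of color i.
module Join {m n} (C : Complex m) (κ : Fin m → Fin n) where

  Simplex⁺ : Subset (n ℕ.+ m) → Set
  Simplex⁺ ω = ∣ take n ω ∣ ℕ.≤ 1 × Simplex C (drop n ω)

  simplex⁺ : ∀ {J ρ} → ∣ J ∣ ℕ.≤ 1 → Simplex C ρ → Simplex⁺ (J ++ ρ)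
  simplex⁺ {J} {ρ} le s = subst (λ K → ∣ K ∣ ℕ.≤ 1) (sym (take-++ J ρ)) le , subst (Simplex C) (sym (drop-++ J ρ)) s

  simplex⁺⁻ : ∀ J ρ → Simplex⁺ (J ++ ρ) → ∣ J ∣ ℕ.≤ 1 × Simplex C ρ
  simplex⁺⁻ J ρ (le , s) = subst (λ K → ∣ K ∣ ℕ.≤ 1) (take-++ J ρ) le , subst (Simplex C) (drop-++ J ρ) s

  C⁺ : Complex (n ℕ.+ m)
  C⁺ = record
    { Simplex     = Simplex⁺
    ; simplex?    = λ ω → (∣ take n ω ∣ ℕ.≤? 1) ×-dec simplex? C (drop n ω)
    ; ∅-simplex   = subst Simplex⁺ (sym (∅++∅ n m)) (simplex⁺ {∅} {∅} (ℕ.≤-trans (ℕ.≤-reflexive (∣⊥∣≡0 n)) z≤n) (∅-simplex C))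
    ; down-closed = λ {σ} {τ} → closed (split n σ) (split n τ)
    }
    where
    closed : ∀ {σ τ} → Split n σ → Split n τ → τ ⊆ σ → Simplex⁺ σ → Simplex⁺ τ
    closed (J ⊹ ρ) (J′ ⊹ ρ′) τ⊆σ s with simplex⁺⁻ J ρ s
    ... | le , Cρ = simplex⁺ (ℕ.≤-trans (p⊆q⇒∣p∣≤∣q∣ {p = J′} {q = J} (++-⊆ˡ τ⊆σ)) le) (down-closed C (++-⊆ʳ J′ J τ⊆σ) Cρ)

  κ⁺ : Fin (n ℕ.+ m) → Fin n
  κ⁺ x = [ id , κ ]′ (splitAt n x)

  κ⁺-↑ˡ : ∀ i → κ⁺ (i ↑ˡ m) ≡ i
  κ⁺-↑ˡ i = cong [ id , κ ]′ (Fin.splitAt-↑ˡ n i m)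

  κ⁺-↑ʳ : ∀ v → κ⁺ (n ↑ʳ v) ≡ κ v
  κ⁺-↑ʳ v = cong [ id , κ ]′ (Fin.splitAt-↑ʳ n m v)

  open Colored C κ using (Over; Colors⊆)
  open Colored C⁺ κ⁺ using () renaming (Over to Over⁺; Colors⊆ to Colors⊆⁺)

  over⁺ : ∀ {I J ρ} → ∣ J ∣ ℕ.≤ 1 → J ⊆ I → Over I ρ → Over⁺ I (J ++ ρ)
  over⁺ {I} {J} {ρ} le J⊆I (Cρ , col) = simplex⁺ le Cρ , col⁺
    where
    col⁺ : Colors⊆⁺ I (J ++ ρ)
    col⁺ x∈ with ++-∈⁻ J x∈
    ... | inj₁ (i , i∈ , refl) = subst (_∈ I) (sym (κ⁺-↑ˡ i)) (J⊆I i∈)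
    ... | inj₂ (v , v∈ , refl) = subst (_∈ I) (sym (κ⁺-↑ʳ v)) (col v∈)

  over⁺⁻ : ∀ {I} J ρ → Over⁺ I (J ++ ρ) → ∣ J ∣ ℕ.≤ 1 × J ⊆ I × Over I ρ
  over⁺⁻ {I} J ρ (s , col) = proj₁ (simplex⁺⁻ J ρ s) , (λ {i} i∈ → subst (_∈ I) (κ⁺-↑ˡ i) (col (++-∈⁺ˡ i∈))) ,
    proj₂ (simplex⁺⁻ J ρ s) , (λ {v} v∈ → subst (_∈ I) (κ⁺-↑ʳ v) (col (++-∈⁺ʳ J v∈)))

  -- The chain z is z₀ + Σᵢ wᵢ ∧ zᵢ for the new points wᵢ; filling zᵢ by bᵢ
  -- makes y = z₀ + Σᵢ bᵢ a cycle of C, which is then coned off.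
  join-acyclic : ∀ {I} s → Nonempty I →
    (∀ z → On (λ ρ → Over I ρ × suc ∣ ρ ∣ ≡ s) z → (∀ τ → ∂ʳ z τ ≡ 0ℚ) →
      Σ[ b ∈ (Subset m → ℚ) ] (On (λ ρ → Over I ρ × ∣ ρ ∣ ≡ s) b × (∂ʳ b ≗ z))) →
    Acyclic (Over⁺ I) s
  join-acyclic {I} s (i₀ , i₀∈I) fill z z-on ∂z = b , b-on , ∂b
    where
    zᵢ : Fin n → Subset m → ℚ
    zᵢ i ρ = z (⁅ i ⁆ ++ ρ)

    ∣⁅i⁆++ρ∣ : ∀ i (ρ : Subset m) → ∣ ⁅ i ⁆ ++ ρ ∣ ≡ suc ∣ ρ ∣
    ∣⁅i⁆++ρ∣ i ρ = trans (∣++∣ ⁅ i ⁆ ρ) (cong (ℕ._+ ∣ ρ ∣) (∣⁅x⁆∣≡1 i))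

    zᵢ-on : ∀ i → On (λ ρ → Over I ρ × suc ∣ ρ ∣ ≡ s) (zᵢ i)
    zᵢ-on i ρ ¬p = z-on _ λ (o , eq) → ¬p (proj₂ (proj₂ (over⁺⁻ ⁅ i ⁆ ρ o)) , trans (sym (∣⁅i⁆++ρ∣ i ρ)) eq)

    z-big : ∀ J ρ → 2 ℕ.≤ ∣ J ∣ → z (J ++ ρ) ≡ 0ℚ
    z-big J ρ le = z-on _ λ (o , _) → ℕ.<⇒≱ le (proj₁ (over⁺⁻ J ρ o))

    sgn-⁅⁆ : ∀ i x → sgn ∣ ⁅ i ⁆ ∣ ℚ.* x ≡ ℚ.- x
    sgn-⁅⁆ i x = trans (cong (λ k → sgn k ℚ.* x) (∣⁅x⁆∣≡1 i)) (eq x)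
      where
      eq : ∀ x → (ℚ.- 1ℚ) ℚ.* x ≡ ℚ.- x
      eq = solve-∀ ℚ-ring

    ∂-at-⁅⁆ : ∀ c → (∀ J ρ → 2 ℕ.≤ ∣ J ∣ → c (J ++ ρ) ≡ 0ℚ) → ∀ i ρ → ∂ʳ c (⁅ i ⁆ ++ ρ) ≡ ℚ.- ∂ʳ (λ ρ′ → c (⁅ i ⁆ ++ ρ′)) ρ
    ∂-at-⁅⁆ c big i ρ = trans (∂ʳ-++ c ⁅ i ⁆ ρ) (trans
      (cong₂ ℚ._+_ (∂ʳ-cong-0 ⁅ i ⁆ (λ J _ eq → big J ρ (ℕ.≤-reflexive (sym (trans eq (cong suc (∣⁅x⁆∣≡1 i))))))) (sgn-⁅⁆ i (∂ʳ (λ ρ′ → c (⁅ i ⁆ ++ ρ′)) ρ)))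
      (ℚ.+-identityˡ (ℚ.- ∂ʳ (λ ρ′ → c (⁅ i ⁆ ++ ρ′)) ρ)))

    ∂-at-∅ : ∀ c ρ → ∂ʳ c (∅ ++ ρ) ≡ sum (λ i → c (⁅ i ⁆ ++ ρ)) ℚ.+ ∂ʳ (λ ρ′ → c (∅ ++ ρ′)) ρ
    ∂-at-∅ c ρ = trans (∂ʳ-++ c ∅ ρ) (cong₂ ℚ._+_ (∂ʳ-∅ (λ J → c (J ++ ρ)))
      (trans (cong (λ k → sgn k ℚ.* ∂ʳ (λ ρ′ → c (∅ ++ ρ′)) ρ) (∣⊥∣≡0 n)) (ℚ.*-identityˡ _)))

    ∂-at-big : ∀ (c : Subset (n ℕ.+ m) → ℚ) → (∀ (J : Subset n) (ρ : Subset m) → 2 ℕ.≤ ∣ J ∣ → c (J ++ ρ) ≡ 0ℚ) → ∀ (J : Subset n) (ρ : Subset m) → 2 ℕ.≤ ∣ J ∣ → ∂ʳ c (J ++ ρ) ≡ 0ℚ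
    ∂-at-big c big J ρ le = trans (∂ʳ-++ c J ρ) (trans
      (cong₂ (λ x y → x ℚ.+ sgn ∣ J ∣ ℚ.* y)
        (∂ʳ-cong-0 J (λ J′ _ eq → big J′ ρ (ℕ.≤-trans le (ℕ.≤-trans (ℕ.n≤1+n _) (ℕ.≤-reflexive (sym eq))))))
        (vanish (∂ʳ-linear ρ) _ (λ ρ′ → big J ρ′ le)))
      (eq (sgn ∣ J ∣)))
      where
      eq : ∀ a → 0ℚ ℚ.+ a ℚ.* 0ℚ ≡ 0ℚ
      eq = solve-∀ ℚ-ring

    ∂zᵢ : ∀ i ρ → ∂ʳ (zᵢ i) ρ ≡ 0ℚ
    ∂zᵢ i ρ = trans (eq (∂ʳ (zᵢ i) ρ)) (cong ℚ.-_ (trans (sym (∂-at-⁅⁆ z z-big i ρ)) (∂z (⁅ i ⁆ ++ ρ))))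
      where
      eq : ∀ a → a ≡ ℚ.- ℚ.- a
      eq = solve-∀ ℚ-ring

    -- The support records `i ∈ I`, so that joining `bᵢ` with the new point of color i stays over
    -- `I`. For the other colors `zᵢ` is zero already.
    fills : ∀ i → Σ[ b ∈ (Subset m → ℚ) ] (On (λ ρ → i ∈ I × Over I ρ × ∣ ρ ∣ ≡ s) b × (∂ʳ b ≗ zᵢ i))
    fills i with i ∈? I
    ... | yes i∈I = let b , on , e = fill (zᵢ i) (zᵢ-on i) (∂zᵢ i) in b , (λ ρ ¬p → on ρ λ p → ¬p (i∈I , p)) , e
    ... | no  i∉I = (λ _ → 0ℚ) , (λ _ _ → refl) , λ ρ → trans (vanish (∂ʳ-linear ρ) _ (λ _ → refl))
                      (sym (z-on _ λ (o , _) → i∉I (proj₁ (proj₂ (over⁺⁻ ⁅ i ⁆ ρ o)) (x∈⁅x⁆ i))))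

    bᵢ : Fin n → Subset m → ℚ
    bᵢ i = proj₁ (fills i)

    y : Subset m → ℚ
    y ρ = z (∅ ++ ρ) ℚ.+ sum (λ i → bᵢ i ρ)

    y-on : On (λ ρ → Over I ρ × ∣ ρ ∣ ≡ s) y
    y-on ρ ¬p = cong₂ ℚ._+_
      (z-on _ λ (o , eq) → ¬p (proj₂ (proj₂ (over⁺⁻ ∅ ρ o)) , trans (sym (trans (∣++∣ (∅ {n}) ρ) (cong (ℕ._+ ∣ ρ ∣) (∣⊥∣≡0 n)))) eq))
      (sum-0 _ λ i → proj₁ (proj₂ (fills i)) ρ λ (_ , p) → ¬p p)

    ∂y : ∀ ρ → ∂ʳ y ρ ≡ 0ℚ
    ∂y ρ = begin
      ∂ʳ y ρ
        ≡⟨ additive (∂ʳ-linear ρ) (λ ρ → z (∅ ++ ρ)) (λ ρ → sum (λ i → bᵢ i ρ)) ⟩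
      ∂ʳ (λ ρ → z (∅ ++ ρ)) ρ ℚ.+ ∂ʳ (λ ρ → sum (λ i → bᵢ i ρ)) ρ
        ≡⟨ cong (∂ʳ (λ ρ → z (∅ ++ ρ)) ρ ℚ.+_) (trans (sum-commutes (∂ʳ-linear ρ) bᵢ) (foldr-cong (λ i → proj₂ (proj₂ (fills i)) ρ))) ⟩
      ∂ʳ (λ ρ → z (∅ ++ ρ)) ρ ℚ.+ sum (λ i → zᵢ i ρ)
        ≡⟨ ℚ.+-comm (∂ʳ (λ ρ → z (∅ ++ ρ)) ρ) (sum (λ i → zᵢ i ρ)) ⟩
      sum (λ i → zᵢ i ρ) ℚ.+ ∂ʳ (λ ρ → z (∅ ++ ρ)) ρ
        ≡⟨ sym (∂-at-∅ z ρ) ⟩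
      ∂ʳ z (∅ ++ ρ)
        ≡⟨ ∂z (∅ ++ ρ) ⟩
      0ℚ ∎
      where open ≡-Reasoning

    apex : Fin n → Subset m → ℚ
    apex i ρ with i Fin.≟ i₀
    ... | yes _ = y ρ
    ... | no  _ = 0ℚ

    apex-i₀ : ∀ ρ → apex i₀ ρ ≡ y ρ
    apex-i₀ ρ with i₀ Fin.≟ i₀
    ... | yes _ = refl
    ... | no ne = ⊥-elim (ne refl)

    apex-≢ : ∀ i ρ → i ≢ i₀ → apex i ρ ≡ 0ℚ
    apex-≢ i ρ ne with i Fin.≟ i₀
    ... | yes e = ⊥-elim (ne e)
    ... | no _  = refl

    apex-on : ∀ i → On (λ ρ → i ∈ I × Over I ρ × ∣ ρ ∣ ≡ s) (apex i)
    apex-on i ρ ¬p with i Fin.≟ i₀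
    ... | yes refl = y-on ρ λ p → ¬p (i₀∈I , p)
    ... | no _     = refl

    ∂apex : ∀ i ρ → ∂ʳ (apex i) ρ ≡ 0ℚ
    ∂apex i ρ with i Fin.≟ i₀
    ... | yes _ = ∂y ρ
    ... | no _  = vanish (∂ʳ-linear ρ) _ (λ _ → refl)

    -- The filling is the sum of the products wᵢ ∧ `g i`. Away from the new points its boundary is
    -- `y` minus the sum of the `bᵢ`, which is z₀; along wᵢ it is minus the boundary of `g i`, which
    -- is `zᵢ` because `y` is a cycle.
    g : Fin n → Subset m → ℚ
    g i ρ = apex i ρ ℚ.- bᵢ i ρ

    single? : (J : Subset n) → Dec (∃[ i ] J ≡ ⁅ i ⁆)
    single? J = Fin.any? (λ i → Vec.≡-dec Bool._≟_ J ⁅ i ⁆)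

    at : Subset n → Subset m → ℚ
    at J ρ with single? J
    ... | yes (i , _) = g i ρ
    ... | no  _       = 0ℚ

    b : Subset (n ℕ.+ m) → ℚ
    b ω = at (take n ω) (drop n ω)

    b-++ : ∀ J ρ → b (J ++ ρ) ≡ at J ρ
    b-++ J ρ = cong₂ at (take-++ J ρ) (drop-++ J ρ)

    b-⁅⁆ : ∀ i ρ → b (⁅ i ⁆ ++ ρ) ≡ g i ρ
    b-⁅⁆ i ρ = trans (b-++ ⁅ i ⁆ ρ) lemma
      where
      lemma : at ⁅ i ⁆ ρ ≡ g i ρ
      lemma with single? ⁅ i ⁆
      ... | yes (j , e) = cong (λ k → g k ρ) (sym (⁅⁆-injective e))
      ... | no ¬p       = ⊥-elim (¬p (i , refl))

    b-other : ∀ J ρ → ∣ J ∣ ≢ 1 → b (J ++ ρ) ≡ 0ℚ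
    b-other J ρ ne = trans (b-++ J ρ) lemma
      where
      lemma : at J ρ ≡ 0ℚ
      lemma with single? J
      ... | yes (j , refl) = ⊥-elim (ne (∣⁅x⁆∣≡1 j))
      ... | no _           = refl

    b-big : ∀ J ρ → 2 ℕ.≤ ∣ J ∣ → b (J ++ ρ) ≡ 0ℚ
    b-big J ρ le = b-other J ρ λ e → ℕ.1+n≰n (subst (2 ℕ.≤_) e le)

    b-∅ : ∀ ρ → b (∅ ++ ρ) ≡ 0ℚ
    b-∅ ρ = b-other ∅ ρ λ e → ℕ.0≢1+n (trans (sym (∣⊥∣≡0 n)) e)

    b-on : On (λ ω → Over⁺ I ω × ∣ ω ∣ ≡ suc s) b
    b-on ω ¬p with split n ω
    ... | J ⊹ ρ with single? J
    ...   | no ¬single = b-other J ρ λ e → [ (λ { refl → ℕ.0≢1+n (trans (sym (∣⊥∣≡0 n)) e) }) , ¬single ]′ (∣J∣≤1⇒ J (ℕ.≤-reflexive e))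
    ...   | yes (i , refl) = trans (b-⁅⁆ i ρ) (cong₂ ℚ._-_ (apex-on i ρ ¬q) (proj₁ (proj₂ (fills i)) ρ ¬q))
      where
      ¬q : ¬ (i ∈ I × Over I ρ × ∣ ρ ∣ ≡ s)
      ¬q (i∈I , o , eq) = ¬p (over⁺ (ℕ.≤-reflexive (∣⁅x⁆∣≡1 i)) (λ j∈ → subst (_∈ I) (sym (x∈⁅y⁆⇒x≡y i j∈)) i∈I) o ,
        trans (∣⁅i⁆++ρ∣ i ρ) (cong suc eq))

    ∂b : ∂ʳ b ≗ z
    ∂b ω with split n ω
    ... | J ⊹ ρ with ∣ J ∣ ℕ.≤? 1
    ...   | no  big = trans (∂-at-big b b-big J ρ (ℕ.≰⇒> big)) (sym (z-big J ρ (ℕ.≰⇒> big)))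
    ...   | yes le with ∣J∣≤1⇒ J le
    ...     | inj₁ refl = begin
      ∂ʳ b (∅ ++ ρ)
        ≡⟨ ∂-at-∅ b ρ ⟩
      sum (λ i → b (⁅ i ⁆ ++ ρ)) ℚ.+ ∂ʳ (λ ρ′ → b (∅ ++ ρ′)) ρ
        ≡⟨ cong₂ ℚ._+_ (trans (foldr-cong (λ i → b-⁅⁆ i ρ)) (sum-minus (λ i → apex i ρ) (λ i → bᵢ i ρ))) (vanish (∂ʳ-linear ρ) _ b-∅) ⟩
      (sum (λ i → apex i ρ) ℚ.- sum (λ i → bᵢ i ρ)) ℚ.+ 0ℚ
        ≡⟨ cong (λ x → (x ℚ.- sum (λ i → bᵢ i ρ)) ℚ.+ 0ℚ) (trans (sum-single (λ i → apex i ρ) i₀ (λ i → apex-≢ i ρ)) (apex-i₀ ρ)) ⟩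
      (y ρ ℚ.- sum (λ i → bᵢ i ρ)) ℚ.+ 0ℚ
        ≡⟨ eq (z (∅ ++ ρ)) (sum (λ i → bᵢ i ρ)) ⟩
      z (∅ ++ ρ) ∎
      where
      open ≡-Reasoning
      eq : ∀ a b → ((a ℚ.+ b) ℚ.- b) ℚ.+ 0ℚ ≡ a
      eq = solve-∀ ℚ-ring
    ...     | inj₂ (i , refl) = begin
      ∂ʳ b (⁅ i ⁆ ++ ρ)
        ≡⟨ ∂-at-⁅⁆ b b-big i ρ ⟩
      ℚ.- ∂ʳ (λ ρ′ → b (⁅ i ⁆ ++ ρ′)) ρ
        ≡⟨ cong ℚ.-_ (trans (cong-≗ (∂ʳ-linear ρ) (b-⁅⁆ i)) (trans (minus (∂ʳ-linear ρ) (apex i) (bᵢ i)) (cong₂ ℚ._-_ (∂apex i ρ) (proj₂ (proj₂ (fills i)) ρ)))) ⟩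
      ℚ.- (0ℚ ℚ.- z (⁅ i ⁆ ++ ρ))
        ≡⟨ eq (z (⁅ i ⁆ ++ ρ)) ⟩
      z (⁅ i ⁆ ++ ρ) ∎
      where
      open ≡-Reasoning
      eq : ∀ a → ℚ.- (0ℚ ℚ.- a) ≡ a
      eq = solve-∀ ℚ-ring

  -- Pushing walks in the join back to the complex

  module _ (r : ℕ) where
    open Reconfiguration C κ r
    open Reconfiguration C⁺ κ⁺ (suc r) using () renaming (Config to Config⁺; Move to Move⁺)

    config⁻ : ∀ J ρ → Config⁺ (J ++ ρ) → ∣ J ∣ ℕ.≤ 1 × Simplex C ρ × InjectiveOn κ ρ × ∣ J ∣ ℕ.+ ∣ ρ ∣ ≡ suc r
    config⁻ J ρ (s , inj , eq) = proj₁ (simplex⁺⁻ J ρ s) , proj₂ (simplex⁺⁻ J ρ s) ,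
      (λ {u} {v} u∈ v∈ e → Fin.↑ʳ-injective n u v (inj (++-∈⁺ʳ J u∈) (++-∈⁺ʳ J v∈) (trans (κ⁺-↑ʳ u) (trans e (sym (κ⁺-↑ʳ v)))))) ,
      trans (sym (∣++∣ J ρ)) eq

    config⁺ : ∀ i ρ → Config ρ → (∀ {v} → v ∈ ρ → κ v ≢ i) → Config⁺ (⁅ i ⁆ ++ ρ)
    config⁺ i ρ (Cρ , inj , eq) missing = simplex⁺ (ℕ.≤-reflexive (∣⁅x⁆∣≡1 i)) Cρ , inj⁺ ,
      trans (∣++∣ ⁅ i ⁆ ρ) (cong₂ ℕ._+_ (∣⁅x⁆∣≡1 i) eq)
      where
      inj⁺ : InjectiveOn κ⁺ (⁅ i ⁆ ++ ρ)
      inj⁺ u∈ v∈ e with ++-∈⁻ ⁅ i ⁆ u∈ | ++-∈⁻ ⁅ i ⁆ v∈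
      ... | inj₁ (j , j∈ , refl) | inj₁ (k , k∈ , refl) = cong (_↑ˡ m) (trans (x∈⁅y⁆⇒x≡y i j∈) (sym (x∈⁅y⁆⇒x≡y i k∈)))
      ... | inj₁ (j , j∈ , refl) | inj₂ (v , v∈ρ , refl) =
        ⊥-elim (missing v∈ρ (trans (sym (κ⁺-↑ʳ v)) (trans (sym e) (trans (κ⁺-↑ˡ j) (x∈⁅y⁆⇒x≡y i j∈)))))
      ... | inj₂ (v , v∈ρ , refl) | inj₁ (j , j∈ , refl) =
        ⊥-elim (missing v∈ρ (trans (sym (κ⁺-↑ʳ v)) (trans e (trans (κ⁺-↑ˡ j) (x∈⁅y⁆⇒x≡y i j∈)))))
      ... | inj₂ (u , u∈ρ , refl) | inj₂ (v , v∈ρ , refl) =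
        cong (n ↑ʳ_) (inj u∈ρ v∈ρ (trans (sym (κ⁺-↑ʳ u)) (trans e (κ⁺-↑ʳ v))))

    subconfig : ∀ {S A} → S ⊆ A → Simplex C A → InjectiveOn κ A → ∣ S ∣ ≡ r → Config S
    subconfig S⊆A CA inj e = down-closed C S⊆A CA , (λ u v → inj (S⊆A u) (S⊆A v)) , e

    ∪-++ : ∀ {n m} (J J′ : Subset n) (ρ ρ′ : Subset m) → (J ++ ρ) ∪ (J′ ++ ρ′) ≡ (J ∪ J′) ++ (ρ ∪ ρ′)
    ∪-++ []      []        ρ ρ′ = refl
    ∪-++ (x ∷ J) (x′ ∷ J′) ρ ρ′ = cong ((x ∨ x′) ∷_) (∪-++ J J′ ρ ρ′)

    -- Let A and B be the old vertices of the two configurations. If `A ∪ B` has at most r + 1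
    -- elements, all r-subsets of A and B that are configurations are linked inside it. Otherwise
    -- `A ∪ B` is the whole union with r + 2 elements; then no new point occurs, A and B have r + 1
    -- elements each, and `A ∩ B` has r elements and is linked to `T` inside B.
    move⁻ : ∀ J ρ J′ ρ′ → Move⁺ (J ++ ρ) (J′ ++ ρ′) → ∀ {T} → T ⊆ ρ′ → ∣ T ∣ ≡ r →
      ∃[ S ] (S ⊆ ρ × ∣ S ∣ ≡ r × Star Move S T)
    move⁻ J A J′ B (cA , cB , s∪ , ∣∪∣) {T} T⊆B ∣T∣
      with config⁻ J A cA | config⁻ J′ B cB
         | simplex⁺⁻ (J ∪ J′) (A ∪ B) (subst Simplex⁺ (∪-++ J J′ A B) s∪)
         | trans (sym (trans (cong ∣_∣ (∪-++ J J′ A B)) (∣++∣ (J ∪ J′) (A ∪ B)))) ∣∪∣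
    ... | ∣J∣≤1 , CA , injA , eA | ∣J′∣≤1 , CB , injB , eB | _ , C∪ | e∪ with ∣ A ∪ B ∣ ℕ.≤? suc r
    ...   | yes le = let S , S⊆A , ∣S∣ = subset-of-size r A (ℕ.≤-pred (ℕ.≤-trans (ℕ.≤-reflexive (sym eA)) (ℕ.+-monoˡ-≤ ∣ A ∣ ∣J∣≤1))) in
      S , S⊆A , ∣S∣ , linked C∪ le (⊆-trans {i = S} {A} S⊆A (p⊆p∪q B)) (⊆-trans {i = T} {B} T⊆B (q⊆p∪q A B))
        (subconfig S⊆A CA injA ∣S∣) (subconfig T⊆B CB injB ∣T∣)
    ...   | no ≰ = A ∩ B , p∩q⊆p A B , ∣A∩B∣ , linked CB (ℕ.≤-reflexive ∣B∣) (p∩q⊆q A B) T⊆B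
        (subconfig (p∩q⊆q A B) CB injB ∣A∩B∣) (subconfig T⊆B CB injB ∣T∣)
      where
      ∣J∪J′∣≡0 : ∣ J ∪ J′ ∣ ≡ 0
      ∣J∪J′∣≡0 = ℕ.n≤0⇒n≡0 (ℕ.+-cancelʳ-≤ (suc (suc r)) _ 0 (ℕ.≤-trans (ℕ.+-monoʳ-≤ ∣ J ∪ J′ ∣ (ℕ.≰⇒> ≰)) (ℕ.≤-reflexive e∪)))
      ∣J∣≡0 : ∣ J ∣ ≡ 0
      ∣J∣≡0 = ℕ.n≤0⇒n≡0 (ℕ.≤-trans (p⊆q⇒∣p∣≤∣q∣ (p⊆p∪q {p = J} J′)) (ℕ.≤-reflexive ∣J∪J′∣≡0))
      ∣J′∣≡0 : ∣ J′ ∣ ≡ 0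
      ∣J′∣≡0 = ℕ.n≤0⇒n≡0 (ℕ.≤-trans (p⊆q⇒∣p∣≤∣q∣ (q⊆p∪q J J′)) (ℕ.≤-reflexive ∣J∪J′∣≡0))
      ∣A∣ : ∣ A ∣ ≡ suc r
      ∣A∣ = trans (cong (ℕ._+ ∣ A ∣) (sym ∣J∣≡0)) eA
      ∣B∣ : ∣ B ∣ ≡ suc r
      ∣B∣ = trans (cong (ℕ._+ ∣ B ∣) (sym ∣J′∣≡0)) eB
      ∣A∪B∣ : ∣ A ∪ B ∣ ≡ suc (suc r)
      ∣A∪B∣ = trans (cong (ℕ._+ ∣ A ∪ B ∣) (sym ∣J∪J′∣≡0)) e∪
      ∣A∩B∣ : ∣ A ∩ B ∣ ≡ r
      ∣A∩B∣ = ℕ.+-cancelˡ-≡ (suc (suc r)) _ _ (trans (cong (ℕ._+ ∣ A ∩ B ∣) (sym ∣A∪B∣))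
        (trans (∣∪∣+∣∩∣ A B) (trans (cong₂ ℕ._+_ ∣A∣ ∣B∣) (cong suc (ℕ.+-suc r r)))))

    walk⁻ : ∀ {ω ω′} → Star Move⁺ ω ω′ → ∀ {T} → T ⊆ drop n ω′ → ∣ T ∣ ≡ r → Config T →
      ∃[ S ] (S ⊆ drop n ω × ∣ S ∣ ≡ r × Star Move S T)
    walk⁻ done {T} T⊆ ∣T∣ _ = T , T⊆ , ∣T∣ , done
    walk⁻ {ω} (_◅_ {j = ω₁} mv mvs) T⊆ ∣T∣ cT with walk⁻ mvs T⊆ ∣T∣ cT | split n ω | split n ω₁
    ... | S , S⊆ , ∣S∣ , path | J ⊹ ρ | J′ ⊹ ρ′ with move⁻ J ρ J′ ρ′ mv (subst (_ ∈_) (drop-++ J′ ρ′) ∘ S⊆) ∣S∣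
    ...   | S′ , S′⊆ , ∣S′∣ , path′ = S′ , subst (_ ∈_) (sym (drop-++ J ρ)) ∘ S′⊆ , ∣S′∣ , path′ ◅◅ path

    -- A set of r < n vertices misses a color and is lifted by the new point of that color. A walk
    -- in the join, traced back from `τ`, starts at an r-subset of `σ`, which can only be `σ`.
    connected⁻ : r ℕ.< n → (∀ {ω ω′} → Config⁺ ω → Config⁺ ω′ → Star Move⁺ ω ω′) →
      ∀ {σ τ} → Config σ → Config τ → Star Move σ τ
    connected⁻ r<n conn {σ} {τ} cσ@(_ , _ , ∣σ∣) cτ@(_ , _ , ∣τ∣)
      with missing-color κ σ (subst (ℕ._< n) (sym ∣σ∣) r<n) | missing-color κ τ (subst (ℕ._< n) (sym ∣τ∣) r<n)
    ... | i , mi | j , mj with walk⁻ (conn (config⁺ i σ cσ mi) (config⁺ j τ cτ mj)) (subst (_ ∈_) (sym (drop-++ ⁅ j ⁆ τ))) ∣τ∣ cτ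
    ...   | S , S⊆ , ∣S∣ , path = subst (λ ρ → Star Move ρ τ)
      (⊆∧∣∣≡⇒≡ (subst (_ ∈_) (drop-++ ⁅ i ⁆ σ) ∘ S⊆) (ℕ.≤-reflexive (trans ∣σ∣ (sym ∣S∣)))) path

-- Passing to the join lowers d by one and raises r and every s by one, so both sums are preserved.
-- Sums are used in place of differences to avoid truncated subtraction.
reconfiguration-connected : ∀ d {m n} (C : Complex m) (κ : Fin m → Fin n) r → r ℕ.+ d ≡ n →
  (∀ I → Nonempty I → ∀ s → s ℕ.+ d ≡ ∣ I ∣ → Acyclic (Colored.Over C κ I) s) →
  ∀ {σ τ} → Reconfiguration.Config C κ r σ → Reconfiguration.Config C κ r τ → Star (Reconfiguration.Move C κ r) σ τ
reconfiguration-connected zero C κ r r≡n acyclic with trans (sym (ℕ.+-identityʳ r)) r≡n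
... | refl = Colored.rainbow-connected C κ (λ I ne → acyclic I ne ∣ I ∣ (ℕ.+-identityʳ ∣ I ∣))
reconfiguration-connected (suc d) {m} {n} C κ r r+d≡n acyclic =
  connected⁻ r (subst (suc r ℕ.≤_) r+d≡n (ℕ.≤-trans (s≤s (ℕ.m≤m+n r d)) (ℕ.≤-reflexive (sym (ℕ.+-suc r d)))))
    (reconfiguration-connected d C⁺ κ⁺ (suc r) (trans (sym (ℕ.+-suc r d)) r+d≡n) acyclic⁺)
  where
  open Join C κ
  acyclic⁺ : ∀ I → Nonempty I → ∀ s → s ℕ.+ d ≡ ∣ I ∣ → Acyclic (Colored.Over C⁺ κ⁺ I) s
  -- No simplex satisfies `suc ∣ ρ ∣ ≡ 0`, so the chain to be filled is zero.
  acyclic⁺ I ne zero    eq = join-acyclic 0 ne λ z z-on _ → (λ _ → 0ℚ) , (λ _ _ → refl) ,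
    λ ρ → trans (vanish (∂ʳ-linear ρ) _ (λ _ → refl)) (sym (z-on ρ λ ()))
  acyclic⁺ I ne (suc s) eq = join-acyclic (suc s) ne λ z z-on → acyclic I ne s (trans (ℕ.+-suc s d) eq) z
    λ ρ ¬p → z-on ρ λ (o , e) → ¬p (o , ℕ.suc-injective e)

-- Cubical grids: from maps of cones to acyclicity

sumℕ : ℕ → (ℕ → ℚ) → ℚ
sumℕ zero    f = 0ℚ
sumℕ (suc N) f = sumℕ N f ℚ.+ f N

sumℕ-linear : ∀ {A : Set} N {F : ℕ → (A → ℚ) → ℚ} → (∀ t → Linear (F t)) → Linear (λ x → sumℕ N (λ t → F t x))
sumℕ-linear zero    f = 0-linear
sumℕ-linear (suc N) f = +-linear (sumℕ-linear N f) (f N)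

sumℕ-cong : ∀ N {f g : ℕ → ℚ} → (∀ t → t ℕ.< N → f t ≡ g t) → sumℕ N f ≡ sumℕ N g
sumℕ-cong zero    h = refl
sumℕ-cong (suc N) h = cong₂ ℚ._+_ (sumℕ-cong N (λ t lt → h t (ℕ.m<n⇒m<1+n lt))) (h N (ℕ.n<1+n N))

sumℕ-0 : ∀ N {f : ℕ → ℚ} → (∀ t → t ℕ.< N → f t ≡ 0ℚ) → sumℕ N f ≡ 0ℚ
sumℕ-0 zero    h = refl
sumℕ-0 (suc N) h = cong₂ ℚ._+_ (sumℕ-0 N (λ t lt → h t (ℕ.m<n⇒m<1+n lt))) (h N (ℕ.n<1+n N))

sumℕ-minus : ∀ N (f g : ℕ → ℚ) → sumℕ N (λ t → f t ℚ.- g t) ≡ sumℕ N f ℚ.- sumℕ N g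
sumℕ-minus zero    f g = refl
sumℕ-minus (suc N) f g = trans (cong (ℚ._+ (f N ℚ.- g N)) (sumℕ-minus N f g)) (eq (sumℕ N f) (sumℕ N g) (f N) (g N))
  where
  eq : ∀ a b c d → (a ℚ.- b) ℚ.+ (c ℚ.- d) ≡ (a ℚ.+ c) ℚ.- (b ℚ.+ d)
  eq = solve-∀ ℚ-ring

telescope : ∀ N (f : ℕ → ℚ) → sumℕ N (λ t → f (suc t) ℚ.- f t) ≡ f N ℚ.- f 0
telescope zero    f = sym (ℚ.+-inverseʳ (f 0))
telescope (suc N) f = trans (cong (ℚ._+ (f (suc N) ℚ.- f N)) (telescope N f)) (eq (f N) (f 0) (f (suc N)))
  where
  eq : ∀ a b c → (a ℚ.- b) ℚ.+ (c ℚ.- a) ≡ c ℚ.- b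
  eq = solve-∀ ℚ-ring

sumℕ-commutes : ∀ {A : Set} {F : (A → ℚ) → ℚ} → Linear F → ∀ N (g : ℕ → A → ℚ) →
  F (λ s → sumℕ N (λ t → g t s)) ≡ sumℕ N (λ t → F (g t))
sumℕ-commutes f zero g = vanish f _ (λ _ → refl)
sumℕ-commutes {F = F} f (suc N) g = trans (additive f (λ s → sumℕ N (λ t → g t s)) (g N)) (cong (ℚ._+ F (g N)) (sumℕ-commutes f N g))

-- Ordered simplices with vertices in X are lists; everything is phrased
-- dually, for cochains φ : List X → ℚ.
d : ∀ {X : Set} → (List X → ℚ) → List X → ℚ
d φ []      = 0ℚ
d φ (a ∷ l) = φ l ℚ.- d (φ ∘ (a ∷_)) l

-- The dual of the prism operator, which sends a₀,...,aₖ to the alternating sum of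
-- i₀a₀,...,i₀aᵢ,i₁aᵢ,...,i₁aₖ.
prism : ∀ {X Y : Set} → (X → Y) → (X → Y) → (List Y → ℚ) → List X → ℚ
prism i₀ i₁ φ []      = 0ℚ
prism i₀ i₁ φ (a ∷ l) = φ (i₀ a ∷ i₁ a ∷ map i₁ l) ℚ.- prism i₀ i₁ (φ ∘ (i₀ a ∷_)) l

d-linear : ∀ {X : Set} (l : List X) → Linear (λ φ → d φ l)
d-linear []      = 0-linear
d-linear (a ∷ l) = +-linear (eval-linear l) (neg-linear (pullback-linear (a ∷_) (d-linear l)))

prism-linear : ∀ {X Y : Set} (i₀ i₁ : X → Y) l → Linear (λ φ → prism i₀ i₁ φ l)
prism-linear i₀ i₁ []      = 0-linear
prism-linear i₀ i₁ (a ∷ l) = +-linear (eval-linear (i₀ a ∷ i₁ a ∷ map i₁ l)) (neg-linear (pullback-linear (i₀ a ∷_) (prism-linear i₀ i₁ l)))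

d-map : ∀ {X Y : Set} (f : X → Y) φ l → d φ (map f l) ≡ d (φ ∘ map f) l
d-map f φ []      = refl
d-map f φ (a ∷ l) = cong (λ z → φ (map f l) ℚ.- z) (d-map f (φ ∘ (f a ∷_)) l)

prism-homotopy : ∀ {X Y : Set} (i₀ i₁ : X → Y) φ l →
  prism i₀ i₁ (d φ) l ≡ (φ (map i₁ l) ℚ.- φ (map i₀ l)) ℚ.- d (prism i₀ i₁ φ) l
prism-homotopy i₀ i₁ φ [] = eq (φ [])
  where
  eq : ∀ a → 0ℚ ≡ (a ℚ.- a) ℚ.- 0ℚ
  eq = solve-∀ ℚ-ring
prism-homotopy i₀ i₁ φ (a ∷ l) = begin
  (φ (map i₁ (a ∷ l)) ℚ.- (φ₀ (map i₁ l) ℚ.- d φ₀₁ (map i₁ l))) ℚ.- prism i₀ i₁ (λ l → φ l ℚ.- d φ₀ l) l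
    ≡⟨ cong₂ (λ x y → (φ (map i₁ (a ∷ l)) ℚ.- (φ₀ (map i₁ l) ℚ.- x)) ℚ.- y)
         (d-map i₁ φ₀₁ l)
         (trans (minus (prism-linear i₀ i₁ l) φ (d φ₀)) (cong (λ z → prism i₀ i₁ φ l ℚ.- z) (prism-homotopy i₀ i₁ φ₀ l))) ⟩
  (φ (map i₁ (a ∷ l)) ℚ.- (φ₀ (map i₁ l) ℚ.- A)) ℚ.- (B ℚ.- ((φ₀ (map i₁ l) ℚ.- φ₀ (map i₀ l)) ℚ.- E))
    ≡⟨ eq (φ (map i₁ (a ∷ l))) (φ₀ (map i₁ l)) A B (φ₀ (map i₀ l)) E ⟩
  (φ (map i₁ (a ∷ l)) ℚ.- φ₀ (map i₀ l)) ℚ.- (B ℚ.- (A ℚ.- E))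
    ≡⟨ cong (λ z → (φ (map i₁ (a ∷ l)) ℚ.- φ₀ (map i₀ l)) ℚ.- (B ℚ.- z)) (sym (minus (d-linear l) (φ₀₁ ∘ map i₁) (prism i₀ i₁ φ₀))) ⟩
  (φ (map i₁ (a ∷ l)) ℚ.- φ (map i₀ (a ∷ l))) ℚ.- d (prism i₀ i₁ φ) (a ∷ l) ∎
  where
  open ≡-Reasoning
  φ₀ = φ ∘ (i₀ a ∷_)
  φ₀₁ = φ₀ ∘ (i₁ a ∷_)
  A = d (φ₀₁ ∘ map i₁) l
  B = prism i₀ i₁ φ l
  E = d (prism i₀ i₁ φ₀) l
  eq : ∀ p q A B r E → (p ℚ.- (q ℚ.- A)) ℚ.- (B ℚ.- ((q ℚ.- r) ℚ.- E)) ≡ (p ℚ.- r) ℚ.- (B ℚ.- (A ℚ.- E))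
  eq = solve-∀ ℚ-ring

d-commutes : ∀ {A X : Set} {F : (A → ℚ) → ℚ} → Linear F → ∀ (g : List X → A → ℚ) l →
  F (λ s → d (λ l → g l s) l) ≡ d (λ l → F (g l)) l
d-commutes f g [] = vanish f _ (λ _ → refl)
d-commutes {F = F} f g (a ∷ l) = trans (minus f (g l) (λ s → d (λ l → g (a ∷ l) s) l)) (cong (λ z → F (g l) ℚ.- z) (d-commutes f (g ∘ (a ∷_)) l))

prism-commutes : ∀ {A X Y : Set} {F : (A → ℚ) → ℚ} → Linear F → ∀ (i₀ i₁ : X → Y) (g : List Y → A → ℚ) l →
  F (λ s → prism i₀ i₁ (λ l → g l s) l) ≡ prism i₀ i₁ (λ l → F (g l)) l
prism-commutes f i₀ i₁ g [] = vanish f _ (λ _ → refl)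
prism-commutes {F = F} f i₀ i₁ g (a ∷ l) = trans (minus f (g (i₀ a ∷ i₁ a ∷ map i₁ l)) (λ s → prism i₀ i₁ (λ l → g (i₀ a ∷ l) s) l))
  (cong (λ z → F (g (i₀ a ∷ i₁ a ∷ map i₁ l)) ℚ.- z) (prism-commutes f i₀ i₁ (g ∘ (i₀ a ∷_)) l))

data PrismOf {X Y : Set} (i₀ i₁ : X → Y) : List X → List Y → Set where
  here  : ∀ {a l} → PrismOf i₀ i₁ (a ∷ l) (i₀ a ∷ i₁ a ∷ map i₁ l)
  there : ∀ {a l l′} → PrismOf i₀ i₁ l l′ → PrismOf i₀ i₁ (a ∷ l) (i₀ a ∷ l′)

prism-on : ∀ {X Y : Set} (i₀ i₁ : X → Y) φ l → (∀ l′ → PrismOf i₀ i₁ l l′ → φ l′ ≡ 0ℚ) → prism i₀ i₁ φ l ≡ 0ℚ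
prism-on i₀ i₁ φ []      h = refl
prism-on i₀ i₁ φ (a ∷ l) h = cong₂ ℚ._-_ (h _ here) (prism-on i₀ i₁ (φ ∘ (i₀ a ∷_)) l (λ l′ p → h _ (there p)))

module _ {X Y : Set} {i₀ i₁ : X → Y} where
  prism-length : ∀ {l l′} → PrismOf i₀ i₁ l l′ → length l′ ≡ suc (length l)
  prism-length (here {l = l}) = cong (λ k → suc (suc k)) (List.length-map i₁ l)
  prism-length (there p)      = cong suc (prism-length p)

  prism-All : ∀ {P : X → Set} {Q : Y → Set} → (∀ {a} → P a → Q (i₀ a)) → (∀ {a} → P a → Q (i₁ a)) →
    ∀ {l l′} → PrismOf i₀ i₁ l l′ → All P l → All Q l′
  prism-All q₀ q₁ here      (pa ∷ pl) = q₀ pa ∷ q₁ pa ∷ All.map⁺ (All.map q₁ pl)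
  prism-All q₀ q₁ (there p) (pa ∷ pl) = q₀ pa ∷ prism-All q₀ q₁ p pl

module Cubes (N : ℕ) where

  -- The fundamental chain of [0,N]^σ × 0, as a functional on cochains.
  cube : ∀ {m} → Subset m → (List (Vec ℕ m) → ℚ) → ℚ
  cube []            φ = φ ([] ∷ [])
  cube (outside ∷ σ) φ = cube σ (φ ∘ map (0 ∷_))
  cube (inside ∷ σ)  φ = sumℕ N (λ t → cube σ (prism (t ∷_) (suc t ∷_) φ))

  -- The part of its boundary where some coordinate is N.
  top : ∀ {m} → Subset m → (List (Vec ℕ m) → ℚ) → ℚ
  top []            φ = φ []
  top (outside ∷ σ) φ = top σ (φ ∘ map (0 ∷_))
  top (inside ∷ σ)  φ = cube σ (φ ∘ map (N ∷_)) ℚ.- sumℕ N (λ t → top σ (prism (t ∷_) (suc t ∷_) φ))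

  cube-linear : ∀ {m} (σ : Subset m) → Linear (cube σ)
  cube-linear []            = eval-linear ([] ∷ [])
  cube-linear (outside ∷ σ) = pullback-linear (map (0 ∷_)) (cube-linear σ)
  cube-linear (inside ∷ σ)  = sumℕ-linear N (λ t → ∘-linear (cube-linear σ) (prism-linear (t ∷_) (suc t ∷_)))

  -- Every layer from t to t + 1 contributes its upper face minus its lower face, and the layers
  -- telescope. What is left at 0 is the cube over a facet of `σ`, and what is left at N belongs to
  -- `top`.
  stokes : ∀ {m} (σ : Subset m) φ → cube σ (d φ) ≡ top σ φ ℚ.- δ (λ ρ → cube ρ φ) σ
  stokes []            φ = refl
  stokes (outside ∷ σ) φ = trans (cong-≗ (cube-linear σ) (d-map (0 ∷_) φ)) (stokes σ (φ ∘ map (0 ∷_)))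
  stokes (inside ∷ σ)  φ = begin
    sumℕ N (λ t → cube σ (prism (t ∷_) (suc t ∷_) (d φ)))
      ≡⟨ sumℕ-cong N (λ t _ → layer t) ⟩
    sumℕ N (λ t → (f (suc t) ℚ.- f t) ℚ.- (g t ℚ.- h t))
      ≡⟨ trans (sumℕ-minus N (λ t → f (suc t) ℚ.- f t) (λ t → g t ℚ.- h t)) (cong₂ ℚ._-_ (telescope N f) (sumℕ-minus N g h)) ⟩
    (f N ℚ.- f 0) ℚ.- (sumℕ N g ℚ.- sumℕ N h)
      ≡⟨ eq (f N) (f 0) (sumℕ N g) (sumℕ N h) ⟩
    (f N ℚ.- sumℕ N g) ℚ.- (f 0 ℚ.- sumℕ N h)
      ≡⟨ cong (λ z → (f N ℚ.- sumℕ N g) ℚ.- (f 0 ℚ.- z)) (sym (sumℕ-commutes (δ-linear σ) N (λ t ρ → cube ρ (prism (t ∷_) (suc t ∷_) φ)))) ⟩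
    top (inside ∷ σ) φ ℚ.- δ (λ ρ → cube ρ φ) (inside ∷ σ) ∎
    where
    open ≡-Reasoning
    f g h : ℕ → ℚ
    f t = cube σ (φ ∘ map (t ∷_))
    g t = top σ (prism (t ∷_) (suc t ∷_) φ)
    h t = δ (λ ρ → cube ρ (prism (t ∷_) (suc t ∷_) φ)) σ
    layer : ∀ t → cube σ (prism (t ∷_) (suc t ∷_) (d φ)) ≡ (f (suc t) ℚ.- f t) ℚ.- (g t ℚ.- h t)
    layer t = trans (cong-≗ (cube-linear σ) (prism-homotopy (t ∷_) (suc t ∷_) φ))
      (trans (minus (cube-linear σ) (λ l → φ (map (suc t ∷_) l) ℚ.- φ (map (t ∷_) l)) (d (prism (t ∷_) (suc t ∷_) φ)))
        (cong₂ ℚ._-_ (minus (cube-linear σ) (φ ∘ map (suc t ∷_)) (φ ∘ map (t ∷_))) (stokes σ (prism (t ∷_) (suc t ∷_) φ))))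
    eq : ∀ a b x y → (a ℚ.- b) ℚ.- (x ℚ.- y) ≡ (a ℚ.- x) ℚ.- (b ℚ.- y)
    eq = solve-∀ ℚ-ring

  cube-commutes : ∀ {A : Set} {F : (A → ℚ) → ℚ} → Linear F → ∀ {m} (σ : Subset m) (g : List (Vec ℕ m) → A → ℚ) →
    F (λ s → cube σ (λ l → g l s)) ≡ cube σ (λ l → F (g l))
  cube-commutes f []            g = refl
  cube-commutes f (outside ∷ σ) g = cube-commutes f σ (g ∘ map (0 ∷_))
  cube-commutes f (inside ∷ σ)  g = trans (sumℕ-commutes f N (λ t s → cube σ (prism (t ∷_) (suc t ∷_) (λ l → g l s))))
    (sumℕ-cong N (λ t _ → trans (cube-commutes f σ (λ l s → prism (t ∷_) (suc t ∷_) (λ l → g l s) l))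
      (cong-≗ (cube-linear σ) (prism-commutes f (t ∷_) (suc t ∷_) g))))

  InCube : ∀ {m} → Subset m → Vec ℕ m → Set
  InCube σ t = ∀ i → lookup t i ℕ.≤ N × (i ∉ σ → lookup t i ≡ 0)

  -- All that is retained of the triangulation of the cube is that the vertices of a simplex are
  -- pairwise at sup distance at most 1. Grid maps are asked to be simplicial on every such set.
  Close : ∀ {m} → Vec ℕ m → Vec ℕ m → Set
  Close t u = ∀ i → lookup t i ℕ.≤ suc (lookup u i) × lookup u i ℕ.≤ suc (lookup t i)

  CubeSimplex : ∀ {m} → Subset m → List (Vec ℕ m) → Set
  CubeSimplex σ l = length l ≡ suc ∣ σ ∣ × All (InCube σ) l × AllPairs Close l

  TopSimplex : ∀ {m} → Subset m → List (Vec ℕ m) → Set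
  TopSimplex σ l = length l ≡ ∣ σ ∣ × All (λ t → InCube σ t × ∃[ v ] lookup t v ≡ N) l

  inCube-∷ : ∀ {m} {b} {σ : Subset m} {t x} → x ℕ.≤ N → (b ≡ outside → x ≡ 0) → InCube σ t → InCube (b ∷ σ) (x ∷ t)
  inCube-∷ {b = inside}  x≤N x≡0 t∈ zero = x≤N , λ out → ⊥-elim (out here)
  inCube-∷ {b = outside} x≤N x≡0 t∈ zero = x≤N , λ _ → x≡0 refl
  inCube-∷ x≤N x≡0 t∈ (suc i) = proj₁ (t∈ i) , λ out → proj₂ (t∈ i) (out ∘ there)

  close-∷ : ∀ {m} {t u : Vec ℕ m} {x y} → x ℕ.≤ suc y → y ℕ.≤ suc x → Close t u → Close (x ∷ t) (y ∷ u)
  close-∷ p q c zero    = p , q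
  close-∷ p q c (suc i) = c i

  close-refl : ∀ {m} (t : Vec ℕ m) → Close t t
  close-refl t i = ℕ.n≤1+n _ , ℕ.n≤1+n _

  map-closed : ∀ {m} {l : List (Vec ℕ m)} x → AllPairs Close l → AllPairs Close (map (x ∷_) l)
  map-closed x []       = []
  map-closed x (a ∷ ps) = All.map⁺ (All.map (close-∷ (ℕ.n≤1+n x) (ℕ.n≤1+n x)) a) ∷ map-closed x ps

  prism-close : ∀ {m} t {l : List (Vec ℕ m)} {l′} → PrismOf (t ∷_) (suc t ∷_) l l′ → AllPairs Close l → AllPairs Close l′
  prism-close t (here {a} {l}) (pa ∷ ps) =
    (close-∷ t≤ t≥ (close-refl a) ∷ All.map⁺ (All.map (close-∷ t≤ t≥) pa)) ∷
    (All.map⁺ (All.map (close-∷ (ℕ.n≤1+n _) (ℕ.n≤1+n _)) pa) ∷ map-closed (suc t) ps)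
    where
    t≤ : t ℕ.≤ suc (suc t)
    t≤ = ℕ.m≤n+m t 2
    t≥ : suc t ℕ.≤ suc t
    t≥ = ℕ.≤-refl
  prism-close t (there p) (pa ∷ ps) =
    prism-All (close-∷ (ℕ.n≤1+n _) (ℕ.n≤1+n _)) (close-∷ (ℕ.m≤n+m t 2) ℕ.≤-refl) p pa ∷ prism-close t p ps

  cube-on : ∀ {m} (σ : Subset m) φ → (∀ l → CubeSimplex σ l → φ l ≡ 0ℚ) → cube σ φ ≡ 0ℚ
  cube-on [] φ h = h _ (refl , ((λ ()) ∷ []) , ([] ∷ []))
  cube-on (outside ∷ σ) φ h = cube-on σ _ λ l (len , ins , cl) → h _
    (trans (List.length-map (0 ∷_) l) len , All.map⁺ (All.map (inCube-∷ z≤n (λ _ → refl)) ins) , map-closed 0 cl)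
  cube-on (inside ∷ σ) φ h = sumℕ-0 N λ t t<N → cube-on σ _ λ l (len , ins , cl) → prism-on _ _ φ l λ l′ p → h l′
    (trans (prism-length p) (cong suc len) ,
     prism-All (inCube-∷ (ℕ.<⇒≤ t<N) λ ()) (inCube-∷ t<N λ ()) p ins , prism-close t p cl)

  top-on : ∀ {m} (σ : Subset m) φ → (∀ l → TopSimplex σ l → φ l ≡ 0ℚ) → top σ φ ≡ 0ℚ
  top-on [] φ h = h [] (refl , [])
  top-on (outside ∷ σ) φ h = top-on σ _ λ l (len , ins) → h _
    (trans (List.length-map (0 ∷_) l) len , All.map⁺ (All.map (λ (c , v , e) → inCube-∷ z≤n (λ _ → refl) c , suc v , e) ins))
  top-on (inside ∷ σ) φ h = cong₂ ℚ._-_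
    (cube-on σ _ λ l (len , ins , _) → h _
      (trans (List.length-map (N ∷_) l) len , All.map⁺ (All.map (λ c → inCube-∷ ℕ.≤-refl (λ ()) c , zero , refl) ins)))
    (sumℕ-0 N λ t t<N → top-on σ _ λ l (len , ins) → prism-on _ _ φ l λ l′ p → h l′
      (trans (prism-length p) (cong suc len) ,
       prism-All (λ (c , v , e) → inCube-∷ (ℕ.<⇒≤ t<N) (λ ()) c , suc v , e) (λ (c , v , e) → inCube-∷ t<N (λ ()) c , suc v , e) p ins))

  top-∅ : ∀ {m} (φ : List (Vec ℕ m) → ℚ) → top ∅ φ ≡ φ []
  top-∅ {zero}  φ = refl
  top-∅ {suc m} φ = top-∅ (φ ∘ map (0 ∷_))

-- The alternating chain of an ordered simplex. Lists with a repetition give zero, so `map Q`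
-- respects boundaries even where `Q` identifies vertices.
⟦_⟧ : ∀ {m} → List (Fin m) → Subset m → ℚ
⟦ [] ⟧    = indicator ∅
⟦ v ∷ l ⟧ = wedge v ⟦ l ⟧

∂ʳ-⟦⟧ : ∀ {m} (l : List (Fin m)) ρ → ∂ʳ ⟦ l ⟧ ρ ≡ d (λ l → ⟦ l ⟧ ρ) l
∂ʳ-⟦⟧ []      ρ = trans (∂ʳ-indicator ∅ ρ) (δ-∅ (λ σ → indicator σ ρ))
∂ʳ-⟦⟧ (v ∷ l) ρ = trans (∂ʳ-wedge v ⟦ l ⟧ ρ) (cong (λ z → ⟦ l ⟧ ρ ℚ.- z)
  (trans (cong-≗ (wedge-linear v ρ) (∂ʳ-⟦⟧ l)) (d-commutes (wedge-linear v ρ) ⟦_⟧ l)))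

⟦⟧-on : ∀ {m} (l : List (Fin m)) → On (λ ρ → (∀ {v} → v ∈ ρ → v ∈ˡ l) × ∣ ρ ∣ ≡ length l) ⟦ l ⟧
⟦⟧-on {m} [] ρ ¬p = indicator-≢ ∅ ρ λ { refl → ¬p ((λ v∈ → ⊥-elim (∉⊥ v∈)) , ∣⊥∣≡0 m) }
⟦⟧-on (v ∷ l) ρ ¬p = wedge-on v ⟦ l ⟧ ρ λ ρ′ _ _ cov eq → ⟦⟧-on l ρ′ λ (f , len) →
  ¬p ((λ u∈ → g f (cov u∈)) , trans (sym eq) (cong suc len))
  where
  g : ∀ {ρ′ u} → (∀ {u} → u ∈ ρ′ → u ∈ˡ l) → u ≡ v ⊎ u ∈ ρ′ → u ∈ˡ v ∷ l
  g f (inj₁ e)  = here e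
  g f (inj₂ u∈) = there (f u∈)

-- The pairing for which `∂ʳ` and `δ` are adjoint

pair : ∀ {m} → (Subset m → ℚ) → (Subset m → ℚ) → ℚ
pair {zero}  z g = z [] ℚ.* g []
pair {suc m} z g = pair (z ∘ (outside ∷_)) (g ∘ (outside ∷_)) ℚ.+ pair (z ∘ (inside ∷_)) (g ∘ (inside ∷_))

pair-linear : ∀ {m} (z : Subset m → ℚ) → Linear (pair z)
pair-linear {zero}  z = *-linear (z []) (eval-linear [])
pair-linear {suc m} z = +-linear (pullback-linear (outside ∷_) (pair-linear (z ∘ (outside ∷_))))
                                 (pullback-linear (inside ∷_) (pair-linear (z ∘ (inside ∷_))))

pair-comm : ∀ {m} (z g : Subset m → ℚ) → pair z g ≡ pair g z
pair-comm {zero}  z g = ℚ.*-comm (z []) (g [])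
pair-comm {suc m} z g = cong₂ ℚ._+_ (pair-comm (z ∘ (outside ∷_)) _) (pair-comm (z ∘ (inside ∷_)) _)

pair-on : ∀ {m} (z g : Subset m → ℚ) → (∀ σ → z σ ≡ 0ℚ ⊎ g σ ≡ 0ℚ) → pair z g ≡ 0ℚ
pair-on {zero} z g h with h []
... | inj₁ e = trans (cong (ℚ._* g []) e) (ℚ.*-zeroˡ (g []))
... | inj₂ e = trans (cong (z [] ℚ.*_) e) (ℚ.*-zeroʳ (z []))
pair-on {suc m} z g h = cong₂ ℚ._+_ (pair-on (z ∘ (outside ∷_)) _ (h ∘ (outside ∷_))) (pair-on (z ∘ (inside ∷_)) _ (h ∘ (inside ∷_)))

pair-indicator : ∀ {m} (z : Subset m → ℚ) τ → pair z (λ σ → indicator σ τ) ≡ z τ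
pair-indicator z []            = ℚ.*-identityʳ (z [])
pair-indicator z (outside ∷ τ) = trans
  (cong₂ ℚ._+_ (pair-indicator (z ∘ (outside ∷_)) τ) (vanish (pair-linear (z ∘ (inside ∷_))) _ (λ _ → refl))) (ℚ.+-identityʳ (z (outside ∷ τ)))
pair-indicator z (inside ∷ τ)  = trans
  (cong₂ ℚ._+_ (vanish (pair-linear (z ∘ (outside ∷_))) _ (λ _ → refl)) (pair-indicator (z ∘ (inside ∷_)) τ)) (ℚ.+-identityˡ (z (inside ∷ τ)))

pair-δ : ∀ {m} (z g : Subset m → ℚ) → pair z (δ g) ≡ pair (∂ʳ z) g
pair-δ {zero}  z g = trans (ℚ.*-zeroʳ (z [])) (sym (ℚ.*-zeroˡ (g [])))
pair-δ {suc m} z g = begin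
  pair z₀ (δ g₀) ℚ.+ pair z₁ (λ I → g₀ I ℚ.- δ g₁ I)
    ≡⟨ cong₂ ℚ._+_ (pair-δ z₀ g₀) (trans (minus (pair-linear z₁) g₀ (δ g₁)) (cong₂ ℚ._-_ (pair-comm z₁ g₀) (pair-δ z₁ g₁))) ⟩
  pair (∂ʳ z₀) g₀ ℚ.+ (pair g₀ z₁ ℚ.- pair (∂ʳ z₁) g₁)
    ≡⟨ cong₂ (λ x y → x ℚ.+ (pair g₀ z₁ ℚ.- y)) (pair-comm (∂ʳ z₀) g₀) (pair-comm (∂ʳ z₁) g₁) ⟩
  pair g₀ (∂ʳ z₀) ℚ.+ (pair g₀ z₁ ℚ.- pair g₁ (∂ʳ z₁))
    ≡⟨ eq (pair g₀ (∂ʳ z₀)) (pair g₀ z₁) (pair g₁ (∂ʳ z₁)) ⟩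
  (pair g₀ z₁ ℚ.+ pair g₀ (∂ʳ z₀)) ℚ.+ (ℚ.- pair g₁ (∂ʳ z₁))
    ≡⟨ cong₂ ℚ._+_ (sym (additive (pair-linear g₀) z₁ (∂ʳ z₀))) (sym (negate (pair-linear g₁) (∂ʳ z₁))) ⟩
  pair g₀ (λ σ → z₁ σ ℚ.+ ∂ʳ z₀ σ) ℚ.+ pair g₁ (λ σ → ℚ.- ∂ʳ z₁ σ)
    ≡⟨ cong₂ ℚ._+_ (pair-comm g₀ _) (pair-comm g₁ _) ⟩
  pair (∂ʳ z) g ∎
  where
  open ≡-Reasoning
  z₀ = z ∘ (outside ∷_)
  z₁ = z ∘ (inside ∷_)
  g₀ = g ∘ (outside ∷_)
  g₁ = g ∘ (inside ∷_)
  eq : ∀ a b c → a ℚ.+ (b ℚ.- c) ≡ (b ℚ.+ a) ℚ.+ (ℚ.- c)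
  eq = solve-∀ ℚ-ring

pair-commutes : ∀ {A : Set} {F : (A → ℚ) → ℚ} → Linear F → ∀ {m} (z : Subset m → ℚ) (g : Subset m → A → ℚ) →
  F (λ s → pair z (λ σ → g σ s)) ≡ pair z (λ σ → F (g σ))
pair-commutes f {zero}  z g = scale f (z []) (g [])
pair-commutes f {suc m} z g = trans (additive f (λ s → pair (z ∘ (outside ∷_)) (λ σ → g (outside ∷ σ) s)) (λ s → pair (z ∘ (inside ∷_)) (λ σ → g (inside ∷ σ) s)))
  (cong₂ ℚ._+_ (pair-commutes f (z ∘ (outside ∷_)) (g ∘ (outside ∷_))) (pair-commutes f (z ∘ (inside ∷_)) (g ∘ (inside ∷_))))

-- Removing the smallest vertex carries the sign +1. The facet serves to read off a degree from a
-- boundary.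
facet : ∀ {m} (σ : Subset m) → ∣ σ ∣ ≢ 0 → ∃[ τ ] δ (λ ρ → indicator ρ τ) σ ≡ 1ℚ
facet [] ne = ⊥-elim (ne refl)
facet (outside ∷ σ) ne = let τ , e = facet σ ne in outside ∷ τ , e
facet (inside ∷ σ) ne = outside ∷ σ , cong₂ ℚ._-_ (indicator-self σ) (vanish (δ-linear σ) _ (λ _ → refl))

∣σ∣≡0⇒∅ : ∀ {m} (σ : Subset m) → ∣ σ ∣ ≡ 0 → σ ≡ ∅
∣σ∣≡0⇒∅ []            _ = refl
∣σ∣≡0⇒∅ (outside ∷ σ) e = cong (outside ∷_) (∣σ∣≡0⇒∅ σ e)

-- A grid model of a map from the s-skeleton of the cone over K to K: the
-- cone over σ is the cube [0,N]^σ with apex 0, its base being the faces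
-- where some coordinate is N.
module _ {m} (K : Complex m) where

  record GridMap (N s : ℕ) (Q : Vec ℕ m → Fin m) : Set where
    open Cubes N
    field
      simplicial : ∀ {σ} → Simplex K σ → ∣ σ ∣ ℕ.≤ s → ∀ τ (p : Fin m → Vec ℕ m) →
        (∀ {v} → v ∈ τ → InCube σ (p v) × Q (p v) ≡ v) →
        (∀ {u v} → u ∈ τ → v ∈ τ → Close (p u) (p v)) → Simplex K τ
      -- A Sperner condition: at a point of the base the label is one of the coordinates that do not
      -- vanish there.
      base : ∀ t v → lookup t v ≡ N → 0 ℕ.< lookup t (Q t)

  module _ {N s Q} (G : GridMap N s Q) where
    open GridMap G
    open Cubes N

    coneChain : Subset m → Subset m → ℚ
    coneChain σ ρ = cube σ (λ l → ⟦ map Q l ⟧ ρ)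

    baseChain : Subset m → Subset m → ℚ
    baseChain σ ρ = top σ (λ l → ⟦ map Q l ⟧ ρ)

    ∂ʳ-coneChain : ∀ σ τ → ∂ʳ (coneChain σ) τ ≡ baseChain σ τ ℚ.- δ (λ ρ → coneChain ρ τ) σ
    ∂ʳ-coneChain σ τ = trans (cube-commutes (∂ʳ-linear τ) σ (λ l → ⟦ map Q l ⟧))
      (trans (cong-≗ (cube-linear σ) (λ l → trans (∂ʳ-⟦⟧ (map Q l) τ) (d-map Q (λ l → ⟦ l ⟧ τ) l))) (stokes σ (λ l → ⟦ map Q l ⟧ τ)))

    baseChain-on : ∀ σ τ → σ ≢ τ → baseChain σ τ ≡ 0ℚ
    baseChain-on σ τ σ≢τ = top-on σ _ λ l (len , ins) → ⟦⟧-on (map Q l) τ λ (f , eq) → σ≢τ (sym (⊆∧∣∣≡⇒≡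
      (λ v∈ → let t , t∈ , e = ∈-map⁻ Q (f v∈) in subst (_∈ σ) (sym e) (Q∈σ (All.lookup ins t∈)))
      (ℕ.≤-reflexive (sym (trans eq (trans (List.length-map Q l) len))))))
      where
      Q∈σ : ∀ {t} → InCube σ t × ∃[ v ] lookup t v ≡ N → Q t ∈ σ
      Q∈σ {t} (c , v , e) with Q t ∈? σ
      ... | yes q = q
      ... | no ¬q = ⊥-elim (ℕ.<⇒≢ (base t v e) (sym (proj₂ (c (Q t)) ¬q)))

    -- The base is the boundary of the cone plus the cones over the facets. Under another boundary
    -- the first part dies, and the second gives the bases of the facets up to a `δ` of a `δ`.
    ∂ʳ-baseChain : ∀ σ τ → ∂ʳ (baseChain σ) τ ≡ δ (λ ρ → baseChain ρ τ) σ
    ∂ʳ-baseChain σ τ = begin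
      ∂ʳ (baseChain σ) τ
        ≡⟨ cong-≗ (∂ʳ-linear τ) (λ τ′ → trans (eq₁ (baseChain σ τ′) (δ (λ ρ → coneChain ρ τ′) σ)) (cong (ℚ._+ δ (λ ρ → coneChain ρ τ′) σ) (sym (∂ʳ-coneChain σ τ′)))) ⟩
      ∂ʳ (λ τ′ → ∂ʳ (coneChain σ) τ′ ℚ.+ δ (λ ρ → coneChain ρ τ′) σ) τ
        ≡⟨ trans (additive (∂ʳ-linear τ) (∂ʳ (coneChain σ)) (λ τ′ → δ (λ ρ → coneChain ρ τ′) σ)) (cong₂ ℚ._+_ (∂ʳ-∂ʳ (coneChain σ) τ) (δ-commutes (∂ʳ-linear τ) coneChain σ)) ⟩
      0ℚ ℚ.+ δ (λ ρ → ∂ʳ (coneChain ρ) τ) σ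
        ≡⟨ cong (0ℚ ℚ.+_) (trans (cong-≗ (δ-linear σ) (λ ρ → ∂ʳ-coneChain ρ τ)) (trans (minus (δ-linear σ) (λ ρ → baseChain ρ τ) (δ (λ ρ → coneChain ρ τ)))
             (cong (λ z → δ (λ ρ → baseChain ρ τ) σ ℚ.- z) (δ-δ (λ ρ → coneChain ρ τ) σ)))) ⟩
      0ℚ ℚ.+ (δ (λ ρ → baseChain ρ τ) σ ℚ.- 0ℚ)
        ≡⟨ eq₂ (δ (λ ρ → baseChain ρ τ) σ) ⟩
      δ (λ ρ → baseChain ρ τ) σ ∎
      where
      open ≡-Reasoning
      eq₁ : ∀ a b → a ≡ (a ℚ.- b) ℚ.+ b
      eq₁ = solve-∀ ℚ-ring
      eq₂ : ∀ a → 0ℚ ℚ.+ (a ℚ.- 0ℚ) ≡ a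
      eq₂ = solve-∀ ℚ-ring

    -- The base of the cone over σ is mapped to σ with degree 1: the degree
    -- is the same for σ and its facets because baseChain commutes with boundaries.
    baseChain≗indicator : ∀ k σ → ∣ σ ∣ ≡ k → ∀ τ → baseChain σ τ ≡ indicator σ τ
    baseChain≗indicator zero σ ∣σ∣ τ = trans (cong (λ ρ → baseChain ρ τ) (∣σ∣≡0⇒∅ σ ∣σ∣))
      (trans (top-∅ (λ l → ⟦ map Q l ⟧ τ)) (cong (λ ρ → indicator ρ τ) (sym (∣σ∣≡0⇒∅ σ ∣σ∣))))
    baseChain≗indicator (suc k) σ ∣σ∣ τ with facet σ (λ e → ℕ.0≢1+n (trans (sym e) ∣σ∣))
    ... | τ₀ , facet≡1 = trans (multiple τ) (trans (cong (ℚ._* indicator σ τ) degree) (ℚ.*-identityˡ (indicator σ τ)))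
      where
      open ≡-Reasoning
      multiple : ∀ τ → baseChain σ τ ≡ baseChain σ σ ℚ.* indicator σ τ
      multiple τ with Vec.≡-dec Bool._≟_ σ τ
      ... | yes refl = sym (trans (cong (baseChain σ σ ℚ.*_) (indicator-self σ)) (ℚ.*-identityʳ (baseChain σ σ)))
      ... | no  ne   = trans (baseChain-on σ τ ne) (sym (trans (cong (baseChain σ σ ℚ.*_) (indicator-≢ σ τ ne)) (ℚ.*-zeroʳ (baseChain σ σ))))
      degree : baseChain σ σ ≡ 1ℚ
      degree = begin
        baseChain σ σ                                        ≡⟨ sym (trans (cong (baseChain σ σ ℚ.*_) (trans (∂ʳ-indicator σ τ₀) facet≡1)) (ℚ.*-identityʳ (baseChain σ σ))) ⟩
        baseChain σ σ ℚ.* ∂ʳ (indicator σ) τ₀                ≡⟨ sym (scale (∂ʳ-linear τ₀) (baseChain σ σ) (indicator σ)) ⟩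
        ∂ʳ (λ τ → baseChain σ σ ℚ.* indicator σ τ) τ₀        ≡⟨ sym (cong-≗ (∂ʳ-linear τ₀) multiple) ⟩
        ∂ʳ (baseChain σ) τ₀                                  ≡⟨ ∂ʳ-baseChain σ τ₀ ⟩
        δ (λ ρ → baseChain ρ τ₀) σ                           ≡⟨ δ-local σ (λ J _ e → baseChain≗indicator k J (ℕ.suc-injective (trans e ∣σ∣)) τ₀) ⟩
        δ (λ ρ → indicator ρ τ₀) σ                   ≡⟨ facet≡1 ⟩
        1ℚ                                           ∎

    coneChain-on : ∀ {σ} → Simplex K σ → ∣ σ ∣ ≡ s → On (λ ρ → Simplex K ρ × ∣ ρ ∣ ≡ suc s) (coneChain σ)
    coneChain-on {σ} Kσ ∣σ∣ ρ ¬p = cube-on σ _ λ l (len , ins , cl) → ⟦⟧-on (map Q l) ρ λ (f , eq) → ¬p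
      (simplicial Kσ (ℕ.≤-reflexive ∣σ∣) ρ (point l f) (λ v∈ → let t∈ , e = point-spec l f v∈ in All.lookup ins t∈ , e)
        (λ u∈ v∈ → pairwise cl (proj₁ (point-spec l f u∈)) (proj₁ (point-spec l f v∈))) ,
       trans eq (trans (List.length-map Q l) (trans len (cong suc ∣σ∣))))
      where
      point : ∀ l → (∀ {v} → v ∈ ρ → v ∈ˡ map Q l) → Fin m → Vec ℕ m
      point l f v with v ∈? ρ
      ... | yes v∈ = proj₁ (∈-map⁻ Q (f v∈))
      ... | no  _  = replicate m 0
      point-spec : ∀ l (f : ∀ {v} → v ∈ ρ → v ∈ˡ map Q l) {v} → v ∈ ρ → point l f v ∈ˡ l × Q (point l f v) ≡ v
      point-spec l f {v} v∈ with v ∈? ρ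
      ... | yes v∈′ = let _ , t∈ , e = ∈-map⁻ Q (f v∈′) in t∈ , sym e
      ... | no  v∉  = ⊥-elim (v∉ v∈)
      pairwise : ∀ {l t u} → AllPairs Close l → t ∈ˡ l → u ∈ˡ l → Close t u
      pairwise (_ ∷ _)  (here refl) (here refl) = λ i → ℕ.n≤1+n _ , ℕ.n≤1+n _
      pairwise (a ∷ _)  (here refl) (there u∈)  = All.lookup a u∈
      pairwise (a ∷ _)  (there t∈)  (here refl) = λ i → let p , q = All.lookup a t∈ i in q , p
      pairwise (_ ∷ ps) (there t∈)  (there u∈)  = pairwise ps t∈ u∈

    -- The cone is extended linearly to `z`. The part of its boundary outside the base is, by
    -- adjointness, the cone extended to `∂ʳ z`, hence zero.
    gridMap⇒acyclic : Decidable (Simplex K) → Acyclic (Simplex K) s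
    gridMap⇒acyclic K? z z-on ∂z = b , b-on , ∂b
      where
      b : Subset m → ℚ
      b ρ = pair z (λ σ → coneChain σ ρ)
      b-on : On (λ σ → Simplex K σ × ∣ σ ∣ ≡ suc s) b
      b-on ρ ¬p = pair-on z _ cases
        where
        cases : ∀ σ → z σ ≡ 0ℚ ⊎ coneChain σ ρ ≡ 0ℚ
        cases σ with K? σ ×-dec (∣ σ ∣ ℕ.≟ s)
        ... | yes (Kσ , e) = inj₂ (coneChain-on Kσ e ρ ¬p)
        ... | no ¬q        = inj₁ (z-on σ ¬q)
      ∂b : ∂ʳ b ≗ z
      ∂b τ = begin
        ∂ʳ b τ
          ≡⟨ pair-commutes (∂ʳ-linear τ) z coneChain ⟩
        pair z (λ σ → ∂ʳ (coneChain σ) τ)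
          ≡⟨ cong-≗ (pair-linear z) (λ σ → trans (∂ʳ-coneChain σ τ) (cong (ℚ._- δ (λ ρ → coneChain ρ τ) σ) (baseChain≗indicator ∣ σ ∣ σ refl τ))) ⟩
        pair z (λ σ → indicator σ τ ℚ.- δ (λ ρ → coneChain ρ τ) σ)
          ≡⟨ minus (pair-linear z) (λ σ → indicator σ τ) (δ (λ ρ → coneChain ρ τ)) ⟩
        pair z (λ σ → indicator σ τ) ℚ.- pair z (δ (λ ρ → coneChain ρ τ))
          ≡⟨ cong₂ ℚ._-_ (pair-indicator z τ) (trans (pair-δ z (λ ρ → coneChain ρ τ)) (pair-on (∂ʳ z) _ (inj₁ ∘ ∂z))) ⟩
        z τ ℚ.- 0ℚ
          ≡⟨ ℚ.+-identityʳ (z τ) ⟩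
        z τ ∎
        where open ≡-Reasoning

-- Rational arithmetic and multilinear interpolation

p≤q⇒0≤q-p : ∀ {p q} → p ℚ.≤ q → 0ℚ ℚ.≤ q ℚ.- p
p≤q⇒0≤q-p {p} {q} le = subst (ℚ._≤ q ℚ.- p) (ℚ.+-inverseʳ p) (ℚ.+-monoˡ-≤ (ℚ.- p) le)

p<q⇒0<q-p : ∀ {p q} → p ℚ.< q → 0ℚ ℚ.< q ℚ.- p
p<q⇒0<q-p {p} {q} lt = subst (ℚ._< q ℚ.- p) (ℚ.+-inverseʳ p) (ℚ.+-monoˡ-< (ℚ.- p) lt)

-- Most inequalities below are proved by naming the difference as a visibly nonnegative expression;
-- the remaining identity is left to the ring solver.
≤-excess : ∀ {p q} x → 0ℚ ℚ.≤ x → q ≡ p ℚ.+ x → p ℚ.≤ q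
≤-excess {p} {q} x 0≤x e = subst₂ ℚ._≤_ (ℚ.+-identityʳ p) (sym e) (ℚ.+-monoʳ-≤ p 0≤x)

<-excess : ∀ {p q} x → 0ℚ ℚ.< x → q ≡ p ℚ.+ x → p ℚ.< q
<-excess {p} {q} x 0<x e = subst₂ ℚ._<_ (ℚ.+-identityʳ p) (sym e) (ℚ.+-monoʳ-< p 0<x)

0≤+ : ∀ {a b} → 0ℚ ℚ.≤ a → 0ℚ ℚ.≤ b → 0ℚ ℚ.≤ a ℚ.+ b
0≤+ = ℚ.+-mono-≤

0<+ : ∀ {a b} → 0ℚ ℚ.< a → 0ℚ ℚ.≤ b → 0ℚ ℚ.< a ℚ.+ b
0<+ = ℚ.+-mono-<-≤

*-monoˡ : ∀ {a b c} → 0ℚ ℚ.≤ a → b ℚ.≤ c → a ℚ.* b ℚ.≤ a ℚ.* c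
*-monoˡ {a} 0≤a b≤c = ℚ.*-monoˡ-≤-nonNeg a {{ℚ.nonNegative 0≤a}} b≤c

*-monoʳ : ∀ {a b c} → 0ℚ ℚ.≤ a → b ℚ.≤ c → b ℚ.* a ℚ.≤ c ℚ.* a
*-monoʳ {a} 0≤a b≤c = ℚ.*-monoʳ-≤-nonNeg a {{ℚ.nonNegative 0≤a}} b≤c

0≤* : ∀ {a b} → 0ℚ ℚ.≤ a → 0ℚ ℚ.≤ b → 0ℚ ℚ.≤ a ℚ.* b
0≤* {a} {b} 0≤a 0≤b = subst (ℚ._≤ a ℚ.* b) (ℚ.*-zeroʳ a) (*-monoˡ 0≤a 0≤b)

0<* : ∀ {a b} → 0ℚ ℚ.< a → 0ℚ ℚ.< b → 0ℚ ℚ.< a ℚ.* b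
0<* {a} {b} 0<a 0<b = subst (ℚ._< a ℚ.* b) (ℚ.*-zeroʳ a) (ℚ.*-monoʳ-<-pos a {{ℚ.positive 0<a}} 0<b)

*-mono : ∀ {a b c d} → 0ℚ ℚ.≤ a → 0ℚ ℚ.≤ d → a ℚ.≤ b → c ℚ.≤ d → a ℚ.* c ℚ.≤ b ℚ.* d
*-mono 0≤a 0≤d a≤b c≤d = ℚ.≤-trans (*-monoˡ 0≤a c≤d) (*-monoʳ 0≤d a≤b)

0≤1 : 0ℚ ℚ.≤ 1ℚ
0≤1 = ℚ.nonNegative⁻¹ 1ℚ

0≤½ : 0ℚ ℚ.≤ ½
0≤½ = ℚ.nonNegative⁻¹ ½

0<½ : 0ℚ ℚ.< ½
0<½ = ℚ.positive⁻¹ ½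

p≤∣p∣ : ∀ p → p ℚ.≤ ℚ.∣ p ∣
p≤∣p∣ p with ℚ.≤-total 0ℚ p
... | inj₁ 0≤p = ℚ.≤-reflexive (sym (ℚ.0≤p⇒∣p∣≡p 0≤p))
... | inj₂ p≤0 = ℚ.≤-trans p≤0 (ℚ.0≤∣p∣ p)

∣∣≤ : ∀ {p a} → p ℚ.≤ a → ℚ.- p ℚ.≤ a → ℚ.∣ p ∣ ℚ.≤ a
∣∣≤ {p} le le′ with ℚ.∣p∣≡p∨∣p∣≡-p p
... | inj₁ e = subst (ℚ._≤ _) (sym e) le
... | inj₂ e = subst (ℚ._≤ _) (sym e) le′

ι : ℕ → ℚ
ι zero    = 0ℚ
ι (suc n) = 1ℚ ℚ.+ ι n

0≤ι : ∀ n → 0ℚ ℚ.≤ ι n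
0≤ι zero    = ℚ.≤-refl
0≤ι (suc n) = 0≤+ 0≤1 (0≤ι n)

0<ι : ∀ {n} → 0 ℕ.< n → 0ℚ ℚ.< ι n
0<ι {suc n} _ = 0<+ (ℚ.positive⁻¹ 1ℚ) (0≤ι n)

ι-mono : ∀ {a b} → a ℕ.≤ b → ι a ℚ.≤ ι b
ι-mono {b = b} z≤n = 0≤ι b
ι-mono (s≤s le)    = ℚ.+-monoʳ-≤ 1ℚ (ι-mono le)

ι-+ : ∀ a b → ι (a ℕ.+ b) ≡ ι a ℚ.+ ι b
ι-+ zero    b = sym (ℚ.+-identityˡ (ι b))
ι-+ (suc a) b = trans (cong (1ℚ ℚ.+_) (ι-+ a b)) (sym (ℚ.+-assoc 1ℚ (ι a) (ι b)))

ι-* : ∀ a b → ι (a ℕ.* b) ≡ ι a ℚ.* ι b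
ι-* zero    b = sym (ℚ.*-zeroˡ (ι b))
ι-* (suc a) b = trans (ι-+ b (a ℕ.* b)) (trans (cong (ι b ℚ.+_) (ι-* a b)) (eq (ι a) (ι b)))
  where
  eq : ∀ a b → b ℚ.+ a ℚ.* b ≡ (1ℚ ℚ.+ a) ℚ.* b
  eq = solve-∀ ℚ-ring

private
  ιᵘ : ∀ n → ℚ.toℚᵘ (ι n) ℚᵘ.≃ ℚᵘ.mkℚᵘ (ℤ.+ n) 0
  ιᵘ zero    = ℚᵘ.≃-refl
  ιᵘ (suc n) = ℚᵘ.≃-trans (ℚ.toℚᵘ-homo-+ 1ℚ (ι n)) (ℚᵘ.≃-trans (ℚᵘ.+-congʳ ℚᵘ.1ℚᵘ (ιᵘ n))
    (ℚᵘ.*≡* (cong (ℤ._* ℤ.1ℤ) (cong (λ z → ℤ.1ℤ ℤ.+ z) (ℤ.*-identityʳ (ℤ.+ n))))))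

abstract
  archimedean : ∀ q → ∃[ n ] q ℚ.≤ ι n
  archimedean q@(mkℚ p d _) = ℤ.∣ p ∣ , ℚ.toℚᵘ-cancel-≤ (ℚᵘ.≤-respʳ-≃ (ℚᵘ.≃-sym (ιᵘ ℤ.∣ p ∣)) (ℚᵘ.*≤* le))
    where
    le : p ℤ.* ℤ.1ℤ ℤ.≤ (ℤ.+ ℤ.∣ p ∣) ℤ.* ℤ.+ suc d
    le = ℤ.≤-trans (ℤ.≤-reflexive (ℤ.*-identityʳ p)) (ℤ.≤-trans (p≤ p)
      (ℤ.≤-trans (ℤ.+≤+ (ℕ.m≤m*n ℤ.∣ p ∣ (suc d))) (ℤ.≤-reflexive (ℤ.pos-* ℤ.∣ p ∣ (suc d)))))
      where
      p≤ : ∀ p → p ℤ.≤ ℤ.+ ℤ.∣ p ∣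
      p≤ (ℤ.+ n)      = ℤ.≤-refl
      p≤ (ℤ.-[1+ n ]) = ℤ.-≤+

clamp : ℚ → ℚ
clamp u = 0ℚ ℚ.⊔ (1ℚ ℚ.⊓ u)

0≤clamp : ∀ u → 0ℚ ℚ.≤ clamp u
0≤clamp u = ℚ.p≤p⊔q 0ℚ (1ℚ ℚ.⊓ u)

clamp≤1 : ∀ u → clamp u ℚ.≤ 1ℚ
clamp≤1 u = ℚ.⊔-lub 0≤1 (ℚ.p⊓q≤p 1ℚ u)

clamp-mono : ∀ {u v} → u ℚ.≤ v → clamp u ℚ.≤ clamp v
clamp-mono {u} {v} le = ℚ.⊔-monoʳ-≤ 0ℚ (ℚ.⊓-monoʳ-≤ 1ℚ le)

clamp-≤0 : ∀ {u} → u ℚ.≤ 0ℚ → clamp u ≡ 0ℚ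
clamp-≤0 {u} le = ℚ.p≥q⇒p⊔q≡p (ℚ.≤-trans (ℚ.p⊓q≤q 1ℚ u) le)

clamp-≥1 : ∀ {u} → 1ℚ ℚ.≤ u → clamp u ≡ 1ℚ
clamp-≥1 {u} le = trans (cong (0ℚ ℚ.⊔_) (ℚ.p≤q⇒p⊓q≡p le)) (ℚ.p≤q⇒p⊔q≡q 0≤1)

clamp-≤ : ∀ {u} → 0ℚ ℚ.≤ u → clamp u ℚ.≤ u
clamp-≤ {u} 0≤u = ℚ.⊔-lub 0≤u (ℚ.p⊓q≤q 1ℚ u)

clamp-≥ : ∀ {u} → u ℚ.≤ 1ℚ → u ℚ.≤ clamp u
clamp-≥ {u} u≤1 = ℚ.≤-trans (ℚ.≤-reflexive (sym (ℚ.p≥q⇒p⊓q≡q u≤1))) (ℚ.p≤q⊔p 0ℚ (1ℚ ℚ.⊓ u))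

∣∣-sym : ∀ a b → ℚ.∣ a ℚ.- b ∣ ≡ ℚ.∣ b ℚ.- a ∣
∣∣-sym a b = trans (sym (ℚ.∣-p∣≡∣p∣ (a ℚ.- b))) (cong ℚ.∣_∣ (eq a b))
  where
  eq : ∀ a b → ℚ.- (a ℚ.- b) ≡ b ℚ.- a
  eq = solve-∀ ℚ-ring

clamp-Lipschitz-≤ : ∀ {u v} → u ℚ.≤ v → clamp v ℚ.- clamp u ℚ.≤ v ℚ.- u
clamp-Lipschitz-≤ {u} {v} u≤v with ℚ.≤-total 1ℚ u | ℚ.≤-total v 0ℚ
... | inj₁ 1≤u | _ = begin
  clamp v ℚ.- clamp u   ≡⟨ cong (λ z → clamp v ℚ.- z) (clamp-≥1 1≤u) ⟩
  clamp v ℚ.- 1ℚ        ≤⟨ ℚ.+-monoˡ-≤ (ℚ.- 1ℚ) (clamp≤1 v) ⟩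
  0ℚ                    ≤⟨ p≤q⇒0≤q-p u≤v ⟩
  v ℚ.- u               ∎
  where open ℚ.≤-Reasoning
... | inj₂ u≤1 | inj₁ v≤0 = begin
  clamp v ℚ.- clamp u   ≡⟨ cong₂ ℚ._-_ (clamp-≤0 v≤0) (clamp-≤0 (ℚ.≤-trans u≤v v≤0)) ⟩
  0ℚ                    ≤⟨ p≤q⇒0≤q-p u≤v ⟩
  v ℚ.- u               ∎
  where open ℚ.≤-Reasoning
... | inj₂ u≤1 | inj₂ 0≤v = ℚ.+-mono-≤ (clamp-≤ 0≤v) (ℚ.neg-antimono-≤ (clamp-≥ u≤1))

clamp-Lipschitz : ∀ u v → ℚ.∣ clamp u ℚ.- clamp v ∣ ℚ.≤ ℚ.∣ u ℚ.- v ∣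
clamp-Lipschitz u v with ℚ.≤-total u v
... | inj₂ v≤u = subst (ℚ._≤ ℚ.∣ u ℚ.- v ∣) (sym (ℚ.0≤p⇒∣p∣≡p (p≤q⇒0≤q-p (clamp-mono v≤u))))
                   (ℚ.≤-trans (clamp-Lipschitz-≤ v≤u) (p≤∣p∣ (u ℚ.- v)))
... | inj₁ u≤v = subst₂ ℚ._≤_ (∣∣-sym (clamp v) (clamp u)) (∣∣-sym v u)
                   (subst (ℚ._≤ ℚ.∣ v ℚ.- u ∣) (sym (ℚ.0≤p⇒∣p∣≡p (p≤q⇒0≤q-p (clamp-mono u≤v))))
                     (ℚ.≤-trans (clamp-Lipschitz-≤ u≤v) (p≤∣p∣ (v ℚ.- u))))

sumℕ-mono : ∀ n {f g : ℕ → ℚ} → (∀ a → f a ℚ.≤ g a) → sumℕ n f ℚ.≤ sumℕ n g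
sumℕ-mono zero    h = ℚ.≤-refl
sumℕ-mono (suc n) h = ℚ.+-mono-≤ (sumℕ-mono n h) (h n)

sumℕ-≥0 : ∀ n {f : ℕ → ℚ} → (∀ a → 0ℚ ℚ.≤ f a) → 0ℚ ℚ.≤ sumℕ n f
sumℕ-≥0 zero    h = ℚ.≤-refl
sumℕ-≥0 (suc n) h = 0≤+ (sumℕ-≥0 n h) (h n)

sumℕ-term : ∀ n {f : ℕ → ℚ} → (∀ a → 0ℚ ℚ.≤ f a) → ∀ {a} → a ℕ.< n → f a ℚ.≤ sumℕ n f
sumℕ-term (suc n) {f} h {a} (s≤s a≤n) with ℕ.m≤n⇒m<n∨m≡n a≤n
... | inj₁ a<n  = subst (ℚ._≤ sumℕ (suc n) f) (ℚ.+-identityʳ (f a)) (ℚ.+-mono-≤ (sumℕ-term n h a<n) (h n))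
... | inj₂ refl = subst (ℚ._≤ sumℕ (suc n) f) (ℚ.+-identityˡ (f a)) (ℚ.+-monoˡ-≤ (f a) (sumℕ-≥0 n h))

sumℕ>0 : ∀ n {f : ℕ → ℚ} → 0ℚ ℚ.< sumℕ n f → ∃[ a ] 0ℚ ℚ.< f a
sumℕ>0 zero lt = ⊥-elim (ℚ.<-irrefl refl lt)
sumℕ>0 (suc n) {f} lt with 0ℚ ℚ.<? f n
... | yes p = n , p
... | no ¬p = sumℕ>0 n (ℚ.<-≤-trans lt (subst (sumℕ (suc n) f ℚ.≤_) (ℚ.+-identityʳ (sumℕ n f)) (ℚ.+-monoʳ-≤ (sumℕ n f) (ℚ.≮⇒≥ ¬p))))

sumℕ-diff : ∀ n (f g : ℕ → ℚ) {B} → (∀ a → ℚ.∣ f a ℚ.- g a ∣ ℚ.≤ B) → ℚ.∣ sumℕ n f ℚ.- sumℕ n g ∣ ℚ.≤ ι n ℚ.* B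
sumℕ-diff zero f g {B} h = ℚ.≤-reflexive (sym (ℚ.*-zeroˡ B))
sumℕ-diff (suc n) f g {B} h = begin
  ℚ.∣ (sumℕ n f ℚ.+ f n) ℚ.- (sumℕ n g ℚ.+ g n) ∣       ≡⟨ cong ℚ.∣_∣ (eq₁ (sumℕ n f) (f n) (sumℕ n g) (g n)) ⟩
  ℚ.∣ (sumℕ n f ℚ.- sumℕ n g) ℚ.+ (f n ℚ.- g n) ∣       ≤⟨ ℚ.∣p+q∣≤∣p∣+∣q∣ (sumℕ n f ℚ.- sumℕ n g) (f n ℚ.- g n) ⟩
  ℚ.∣ sumℕ n f ℚ.- sumℕ n g ∣ ℚ.+ ℚ.∣ f n ℚ.- g n ∣     ≤⟨ ℚ.+-mono-≤ (sumℕ-diff n f g h) (h n) ⟩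
  ι n ℚ.* B ℚ.+ B                                       ≡⟨ eq₂ (ι n) B ⟩
  ι (suc n) ℚ.* B                                       ∎
  where
  open ℚ.≤-Reasoning
  eq₁ : ∀ a b c d → (a ℚ.+ b) ℚ.- (c ℚ.+ d) ≡ (a ℚ.- c) ℚ.+ (b ℚ.- d)
  eq₁ = solve-∀ ℚ-ring
  eq₂ : ∀ a c → a ℚ.* c ℚ.+ c ≡ (1ℚ ℚ.+ a) ℚ.* c
  eq₂ = solve-∀ ℚ-ring

∣diff*∣ : ∀ {w w′ I I′ A B} → 0ℚ ℚ.≤ w′ → w′ ℚ.≤ 1ℚ → 0ℚ ℚ.≤ I → I ℚ.≤ 1ℚ →
  ℚ.∣ w ℚ.- w′ ∣ ℚ.≤ A → ℚ.∣ I ℚ.- I′ ∣ ℚ.≤ B → ℚ.∣ w ℚ.* I ℚ.- w′ ℚ.* I′ ∣ ℚ.≤ A ℚ.+ B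
∣diff*∣ {w} {w′} {I} {I′} {A} {B} 0≤w′ w′≤1 0≤I I≤1 wA IB = begin
  ℚ.∣ w ℚ.* I ℚ.- w′ ℚ.* I′ ∣                                 ≡⟨ cong ℚ.∣_∣ (eq w I w′ I′) ⟩
  ℚ.∣ (w ℚ.- w′) ℚ.* I ℚ.+ w′ ℚ.* (I ℚ.- I′) ∣                ≤⟨ ℚ.∣p+q∣≤∣p∣+∣q∣ ((w ℚ.- w′) ℚ.* I) (w′ ℚ.* (I ℚ.- I′)) ⟩
  ℚ.∣ (w ℚ.- w′) ℚ.* I ∣ ℚ.+ ℚ.∣ w′ ℚ.* (I ℚ.- I′) ∣          ≡⟨ cong₂ ℚ._+_ (ℚ.∣p*q∣≡∣p∣*∣q∣ (w ℚ.- w′) I) (ℚ.∣p*q∣≡∣p∣*∣q∣ w′ (I ℚ.- I′)) ⟩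
  ℚ.∣ w ℚ.- w′ ∣ ℚ.* ℚ.∣ I ∣ ℚ.+ ℚ.∣ w′ ∣ ℚ.* ℚ.∣ I ℚ.- I′ ∣  ≤⟨ ℚ.+-mono-≤
      (*-mono (ℚ.0≤∣p∣ (w ℚ.- w′)) 0≤1 wA (subst (ℚ._≤ 1ℚ) (sym (ℚ.0≤p⇒∣p∣≡p 0≤I)) I≤1))
      (*-mono (ℚ.0≤∣p∣ w′) 0≤B (subst (ℚ._≤ 1ℚ) (sym (ℚ.0≤p⇒∣p∣≡p 0≤w′)) w′≤1) IB) ⟩
  A ℚ.* 1ℚ ℚ.+ 1ℚ ℚ.* B                                       ≡⟨ cong₂ ℚ._+_ (ℚ.*-identityʳ A) (ℚ.*-identityˡ B) ⟩
  A ℚ.+ B                                                     ∎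
  where
  open ℚ.≤-Reasoning
  0≤B : 0ℚ ℚ.≤ B
  0≤B = ℚ.≤-trans (ℚ.0≤∣p∣ (I ℚ.- I′)) IB
  eq : ∀ w I w′ I′ → w ℚ.* I ℚ.- w′ ℚ.* I′ ≡ (w ℚ.- w′) ℚ.* I ℚ.+ w′ ℚ.* (I ℚ.- I′)
  eq = solve-∀ ℚ-ring

0<*⇒0< : ∀ {a b} → 0ℚ ℚ.≤ a → 0ℚ ℚ.≤ b → 0ℚ ℚ.< a ℚ.* b → 0ℚ ℚ.< a × 0ℚ ℚ.< b
0<*⇒0< {a} {b} 0≤a 0≤b lt = pos 0≤a (λ e → ℚ.<⇒≢ lt (sym (trans (cong (ℚ._* b) (sym e)) (ℚ.*-zeroˡ b)))) ,
                            pos 0≤b (λ e → ℚ.<⇒≢ lt (sym (trans (cong (a ℚ.*_) (sym e)) (ℚ.*-zeroʳ a))))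
  where
  pos : ∀ {x} → 0ℚ ℚ.≤ x → 0ℚ ≢ x → 0ℚ ℚ.< x
  pos {x} 0≤x ne with 0ℚ ℚ.<? x
  ... | yes p = p
  ... | no ¬p = ⊥-elim (ne (ℚ.≤-antisym 0≤x (ℚ.≮⇒≥ ¬p)))

0<⊓ : ∀ {a b} → 0ℚ ℚ.< a → 0ℚ ℚ.< b → 0ℚ ℚ.< a ℚ.⊓ b
0<⊓ {a} {b} 0<a 0<b with ℚ.≤-total a b
... | inj₁ le = subst (0ℚ ℚ.<_) (sym (ℚ.p≤q⇒p⊓q≡p le)) 0<a
... | inj₂ ge = subst (0ℚ ℚ.<_) (sym (ℚ.p≥q⇒p⊓q≡q ge)) 0<b

½^ : ℕ → ℚ
½^ zero    = 1ℚ
½^ (suc k) = ½ ℚ.* ½^ k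

0<½^ : ∀ k → 0ℚ ℚ.< ½^ k
0<½^ zero    = ℚ.positive⁻¹ 1ℚ
0<½^ (suc k) = 0<* 0<½ (0<½^ k)

-- Linear interpolation weights of the integer points 0, …, N on the line,
-- constant outside [0,N]; they telescope to 1.
module Weights (N : ℕ) where

  -- The total weight of the points a, a + 1, ..., N. It is cut to 0 past N, so that the point N
  -- takes up all the weight beyond it.
  tail : ℕ → ℚ → ℚ
  tail zero    y = 1ℚ
  tail (suc a) y with suc a ℕ.≤? N
  ... | yes _ = clamp (y ℚ.- ι a)
  ... | no  _ = 0ℚ

  weight : ℕ → ℚ → ℚ
  weight a y = tail a y ℚ.- tail (suc a) y

  0≤tail : ∀ a y → 0ℚ ℚ.≤ tail a y
  0≤tail zero    y = 0≤1
  0≤tail (suc a) y with suc a ℕ.≤? N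
  ... | yes _ = 0≤clamp (y ℚ.- ι a)
  ... | no  _ = ℚ.≤-refl

  tail≤1 : ∀ a y → tail a y ℚ.≤ 1ℚ
  tail≤1 zero    y = ℚ.≤-refl
  tail≤1 (suc a) y with suc a ℕ.≤? N
  ... | yes _ = clamp≤1 (y ℚ.- ι a)
  ... | no  _ = 0≤1

  tail-≤N : ∀ {a} y → suc a ℕ.≤ N → tail (suc a) y ≡ clamp (y ℚ.- ι a)
  tail-≤N {a} y le with suc a ℕ.≤? N
  ... | yes _ = refl
  ... | no ¬p = ⊥-elim (¬p le)

  tail->N : ∀ {a} y → N ℕ.< a → tail a y ≡ 0ℚ
  tail->N {suc a} y lt with suc a ℕ.≤? N
  ... | yes p = ⊥-elim (ℕ.<⇒≱ lt p)
  ... | no _  = refl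

  tail-anti : ∀ a y → tail (suc a) y ℚ.≤ tail a y
  tail-anti zero    y = tail≤1 1 y
  tail-anti (suc a) y with suc (suc a) ℕ.≤? N
  ... | no  _  = 0≤tail (suc a) y
  ... | yes le = ℚ.≤-trans (clamp-mono (ℚ.+-monoʳ-≤ y (ℚ.neg-antimono-≤ (ι-mono (ℕ.n≤1+n a)))))
                   (ℚ.≤-reflexive (sym (tail-≤N y (ℕ.<⇒≤ le))))

  0≤weight : ∀ a y → 0ℚ ℚ.≤ weight a y
  0≤weight a y = p≤q⇒0≤q-p (tail-anti a y)

  weight≤tail : ∀ a y → weight a y ℚ.≤ tail a y
  weight≤tail a y = ≤-excess (tail (suc a) y) (0≤tail (suc a) y) (eq (tail a y) (tail (suc a) y))
    where
    eq : ∀ a b → a ≡ (a ℚ.- b) ℚ.+ b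
    eq = solve-∀ ℚ-ring

  weight≤1 : ∀ a y → weight a y ℚ.≤ 1ℚ
  weight≤1 a y = ℚ.≤-trans (weight≤tail a y) (tail≤1 a y)

  weights-total : ∀ y → sumℕ (suc N) (λ a → weight a y) ≡ 1ℚ
  weights-total y = trans (sumℕ-cong (suc N) (λ a _ → eq (tail a y) (tail (suc a) y)))
    (trans (telescope (suc N) (λ a → ℚ.- tail a y)) (cong (λ z → ℚ.- z ℚ.- (ℚ.- 1ℚ)) (tail->N {suc N} y ℕ.≤-refl)))
    where
    eq : ∀ a b → a ℚ.- b ≡ ℚ.- b ℚ.- (ℚ.- a)
    eq = solve-∀ ℚ-ring

  -- Positive weight means distance less than 1, except beyond the ends of the interval: the point 0
  -- has no lower bound and the point N no upper one.
  record Active (y : ℚ) (a : ℕ) : Set where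
    field
      ≤N    : a ℕ.≤ N
      lower : ∀ {b} → a ≡ suc b → ι b ℚ.< y
      upper : a ℕ.< N → y ℚ.< ι (suc a)

  weight>0⇒active : ∀ a y → 0ℚ ℚ.< weight a y → Active y a
  weight>0⇒active a y 0<w = record { ≤N = ≤N ; lower = lower ; upper = upper }
    where
    0<tail : 0ℚ ℚ.< tail a y
    0<tail = ℚ.<-≤-trans 0<w (weight≤tail a y)
    ≤N : a ℕ.≤ N
    ≤N with a ℕ.≤? N
    ... | yes p = p
    ... | no ¬p = ⊥-elim (ℚ.<⇒≢ 0<tail (sym (tail->N y (ℕ.≰⇒> ¬p))))
    lower : ∀ {b} → a ≡ suc b → ι b ℚ.< y
    lower {b} refl with ι b ℚ.<? y
    ... | yes p = p
    ... | no ¬p = ⊥-elim (ℚ.<⇒≢ 0<tail (sym (trans (tail-≤N y ≤N) (clamp-≤0 {y ℚ.- ι b}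
        (≤-excess (ι b ℚ.- y) (p≤q⇒0≤q-p (ℚ.≮⇒≥ ¬p)) (eq y (ι b)))))))
      where
      eq : ∀ y b → 0ℚ ≡ (y ℚ.- b) ℚ.+ (b ℚ.- y)
      eq = solve-∀ ℚ-ring
    upper : a ℕ.< N → y ℚ.< ι (suc a)
    upper a<N with y ℚ.<? ι (suc a)
    ... | yes p = p
    ... | no ¬p = ⊥-elim (ℚ.<-irrefl refl (ℚ.<-≤-trans 0<w (ℚ.+-mono-≤ (tail≤1 a y)
        (ℚ.≤-reflexive (cong ℚ.-_ (trans (tail-≤N y a<N) (clamp-≥1 (≤-excess (y ℚ.- ι (suc a)) (p≤q⇒0≤q-p (ℚ.≮⇒≥ ¬p)) (eq y (ι a))))))))))
      where
      eq : ∀ y a → y ℚ.- a ≡ 1ℚ ℚ.+ (y ℚ.- (1ℚ ℚ.+ a))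
      eq = solve-∀ ℚ-ring

  active-close : ∀ {y a b} → Active y a → Active y b → a ℕ.≤ suc b
  active-close {y} {a} {b} α β with a ℕ.≤? suc b
  ... | yes p = p
  ... | no ¬p with a | Active.lower α | ℕ.≰⇒> ¬p | Active.≤N α
  ...   | suc a′ | low | s≤s b<a′ | a≤N = ⊥-elim (ℚ.<-irrefl refl (ℚ.<-≤-trans (low refl)
            (ℚ.≤-trans (ℚ.<⇒≤ (Active.upper β (ℕ.<-trans b<a′ a≤N))) (ι-mono b<a′))))

  active-≤0 : ∀ {y a} → y ℚ.≤ 0ℚ → Active y a → a ≡ 0
  active-≤0 {a = zero}  _   _ = refl
  active-≤0 {a = suc a} y≤0 α = ⊥-elim (ℚ.<-irrefl refl (ℚ.≤-<-trans (0≤ι a) (ℚ.<-≤-trans (Active.lower α refl) y≤0)))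

  active-≥N : ∀ {y a} → ι N ℚ.≤ y → Active y a → a ≡ N
  active-≥N {y} {a} N≤y α with ℕ.m≤n⇒m<n∨m≡n (Active.≤N α)
  ... | inj₂ e = e
  ... | inj₁ a<N = ⊥-elim (ℚ.<-irrefl refl (ℚ.<-≤-trans (Active.upper α a<N) (ℚ.≤-trans (ι-mono a<N) N≤y)))

  round : ℕ → ℚ → ℕ
  round zero    y = 0
  round (suc a) y with ι a ℚ.+ ½ ℚ.≤? y
  ... | yes _ = suc a
  ... | no  _ = round a y

  round≤ : ∀ a y → round a y ℕ.≤ a
  round≤ zero    y = z≤n
  round≤ (suc a) y with ι a ℚ.+ ½ ℚ.≤? y
  ... | yes _ = ℕ.≤-refl
  ... | no  _ = ℕ.m≤n⇒m≤1+n (round≤ a y)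

  round-lower : ∀ a y {b} → round a y ≡ suc b → ι b ℚ.+ ½ ℚ.≤ y
  round-lower (suc a) y e with ι a ℚ.+ ½ ℚ.≤? y
  round-lower (suc a) y refl | yes p = p
  ... | no _ = round-lower a y e

  round-upper : ∀ a y → round a y ℕ.< a → y ℚ.< ι (round a y) ℚ.+ ½
  round-upper (suc a) y lt with ι a ℚ.+ ½ ℚ.≤? y
  ... | yes _ = ⊥-elim (ℕ.<-irrefl refl lt)
  ... | no ¬p with ℕ.m≤n⇒m<n∨m≡n (round≤ a y)
  ...   | inj₁ lt′ = round-upper a y lt′
  ...   | inj₂ e   = subst (λ z → y ℚ.< ι z ℚ.+ ½) (sym e) (ℚ.≰⇒> ¬p)

  nearest : ℚ → ℕ
  nearest = round N

  nearest-close : ∀ {y z} → y ℚ.≤ z ℚ.+ 1ℚ → nearest y ℕ.≤ suc (nearest z)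
  nearest-close {y} {z} y≤z+1 with nearest y ℕ.≤? suc (nearest z)
  ... | yes p = p
  ... | no ¬p with nearest y | round-lower N y | ℕ.≰⇒> ¬p | round≤ N y
  ...   | suc a | low | s≤s b<a | a<N = ⊥-elim (ℚ.<-irrefl refl (ℚ.<-≤-trans (ℚ.≤-<-trans y≤z+1
            (ℚ.+-monoˡ-< 1ℚ (round-upper N z (ℕ.<-trans b<a a<N))))
            (ℚ.≤-trans (ℚ.≤-reflexive (eq (ι (nearest z)))) (ℚ.≤-trans (ℚ.+-monoˡ-≤ ½ (ι-mono b<a)) (low refl)))))
    where
    eq : ∀ a → (a ℚ.+ ½) ℚ.+ 1ℚ ≡ (1ℚ ℚ.+ a) ℚ.+ ½
    eq = solve-∀ ℚ-ring

  nearest-≤0 : ∀ {y} → y ℚ.≤ 0ℚ → nearest y ≡ 0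
  nearest-≤0 {y} y≤0 with nearest y | round-lower N y
  ... | zero  | _   = refl
  ... | suc b | low = ⊥-elim (ℚ.<-irrefl refl (ℚ.<-≤-trans (ℚ.+-mono-≤-< (0≤ι b) 0<½) (ℚ.≤-trans (low refl) y≤0)))

  nearest-≥N : ∀ {y} → ι N ℚ.≤ y → nearest y ≡ N
  nearest-≥N {y} N≤y with ℕ.m≤n⇒m<n∨m≡n (round≤ N y)
  ... | inj₂ e  = e
  ... | inj₁ lt = ⊥-elim (ℚ.<-irrefl refl (ℚ.<-≤-trans (round-upper N y lt) (ℚ.≤-trans
      (≤-excess ½ 0≤½ (eq (ι (nearest y)))) (ℚ.≤-trans (ι-mono lt) N≤y))))
    where
    eq : ∀ a → 1ℚ ℚ.+ a ≡ (a ℚ.+ ½) ℚ.+ ½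
    eq = solve-∀ ℚ-ring

  weight-nearest : ∀ y → ½ ℚ.≤ weight (nearest y) y
  weight-nearest y = go (nearest y) (round≤ N y) (round-lower N y) (round-upper N y)
    where
    open ℚ.≤-Reasoning
    ½≤ : ∀ {b} → ι b ℚ.+ ½ ℚ.≤ y → ½ ℚ.≤ y ℚ.- ι b
    ½≤ {b} le = ≤-excess (y ℚ.- (ι b ℚ.+ ½)) (p≤q⇒0≤q-p le) (eq y (ι b))
      where
      eq : ∀ y b → y ℚ.- b ≡ ½ ℚ.+ (y ℚ.- (b ℚ.+ ½))
      eq = solve-∀ ℚ-ring
    go : ∀ a → a ℕ.≤ N → (∀ {b} → a ≡ suc b → ι b ℚ.+ ½ ℚ.≤ y) → (a ℕ.< N → y ℚ.< ι a ℚ.+ ½) → ½ ℚ.≤ weight a y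
    go zero a≤N low up with 1 ℕ.≤? N
    ... | no  _   = ≤-excess ½ 0≤½ refl
    ... | yes 1≤N = begin
      ½                        ≡⟨ refl ⟩
      1ℚ ℚ.- ½                 ≤⟨ ℚ.+-monoʳ-≤ 1ℚ (ℚ.neg-antimono-≤ (clamp-mono {v = ½} y-0≤½)) ⟩
      1ℚ ℚ.- clamp (y ℚ.- 0ℚ)  ∎
      where
      y-0≤½ : y ℚ.- 0ℚ ℚ.≤ ½
      y-0≤½ = ≤-excess (½ ℚ.- y) (p≤q⇒0≤q-p (ℚ.≤-trans (ℚ.<⇒≤ (up 1≤N)) (ℚ.≤-reflexive (ℚ.+-identityˡ ½)))) (eq y)
        where
        eq : ∀ y → ½ ≡ (y ℚ.- 0ℚ) ℚ.+ (½ ℚ.- y)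
        eq = solve-∀ ℚ-ring
    go (suc b) a≤N low up with ℕ.m≤n⇒m<n∨m≡n a≤N
    ... | inj₂ e = begin
      ½                                     ≡⟨ sym (ℚ.+-identityʳ ½) ⟩
      ½ ℚ.- 0ℚ                              ≤⟨ ℚ.+-monoˡ-≤ (ℚ.- 0ℚ) (clamp-mono {½} (½≤ {b} (low refl))) ⟩
      clamp (y ℚ.- ι b) ℚ.- 0ℚ              ≡⟨ cong₂ ℚ._-_ (sym (tail-≤N y a≤N)) (sym (tail->N y (s≤s (ℕ.≤-reflexive (sym e))))) ⟩
      weight (suc b) y                      ∎
    ... | inj₁ lt with ℚ.≤-total y (ι (suc b))
    ...   | inj₁ y≤a = begin
      ½                                                ≤⟨ clamp-mono {½} (½≤ {b} (low refl)) ⟩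
      clamp (y ℚ.- ι b)                                ≡⟨ sym (ℚ.+-identityʳ (clamp (y ℚ.- ι b))) ⟩
      clamp (y ℚ.- ι b) ℚ.- 0ℚ                         ≡⟨ cong (λ z → clamp (y ℚ.- ι b) ℚ.- z) (sym (clamp-≤0 {y ℚ.- ι (suc b)} ≤0)) ⟩
      clamp (y ℚ.- ι b) ℚ.- clamp (y ℚ.- ι (suc b))    ≡⟨ cong₂ ℚ._-_ (sym (tail-≤N y a≤N)) (sym (tail-≤N y lt)) ⟩
      weight (suc b) y                                 ∎
      where
      ≤0 : y ℚ.- ι (suc b) ℚ.≤ 0ℚ
      ≤0 = ≤-excess (ι (suc b) ℚ.- y) (p≤q⇒0≤q-p y≤a) (eq y (ι (suc b)))
        where
        eq : ∀ y b → 0ℚ ≡ (y ℚ.- b) ℚ.+ (b ℚ.- y)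
        eq = solve-∀ ℚ-ring
    ...   | inj₂ a≤y = begin
      ½                                                ≡⟨ refl ⟩
      1ℚ ℚ.- ½                                         ≤⟨ ℚ.+-monoʳ-≤ 1ℚ (ℚ.neg-antimono-≤ (clamp-mono {v = ½} ≤½)) ⟩
      1ℚ ℚ.- clamp (y ℚ.- ι (suc b))                   ≡⟨ cong (ℚ._- clamp (y ℚ.- ι (suc b))) (sym (clamp-≥1 {y ℚ.- ι b} 1≤)) ⟩
      clamp (y ℚ.- ι b) ℚ.- clamp (y ℚ.- ι (suc b))    ≡⟨ cong₂ ℚ._-_ (sym (tail-≤N y a≤N)) (sym (tail-≤N y lt)) ⟩
      weight (suc b) y                                 ∎
      where
      ≤½ : y ℚ.- ι (suc b) ℚ.≤ ½
      ≤½ = ≤-excess ((ι (suc b) ℚ.+ ½) ℚ.- y) (p≤q⇒0≤q-p (ℚ.<⇒≤ (up lt))) (eq y (ι (suc b)))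
        where
        eq : ∀ y b → ½ ≡ (y ℚ.- b) ℚ.+ ((b ℚ.+ ½) ℚ.- y)
        eq = solve-∀ ℚ-ring
      1≤ : 1ℚ ℚ.≤ y ℚ.- ι b
      1≤ = ≤-excess (y ℚ.- ι (suc b)) (p≤q⇒0≤q-p a≤y) (eq y (ι b))
        where
        eq : ∀ y b → y ℚ.- b ≡ 1ℚ ℚ.+ (y ℚ.- (1ℚ ℚ.+ b))
        eq = solve-∀ ℚ-ring

  tail-Lipschitz : ∀ a y z → ℚ.∣ tail a y ℚ.- tail a z ∣ ℚ.≤ ℚ.∣ y ℚ.- z ∣
  tail-Lipschitz zero    y z = ℚ.0≤∣p∣ (y ℚ.- z)
  tail-Lipschitz (suc a) y z with suc a ℕ.≤? N
  ... | yes _ = ℚ.≤-trans (clamp-Lipschitz (y ℚ.- ι a) (z ℚ.- ι a)) (ℚ.≤-reflexive (cong ℚ.∣_∣ (eq y z (ι a))))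
    where
    eq : ∀ y z a → (y ℚ.- a) ℚ.- (z ℚ.- a) ≡ y ℚ.- z
    eq = solve-∀ ℚ-ring
  ... | no  _ = ℚ.0≤∣p∣ (y ℚ.- z)

  weight-Lipschitz : ∀ a y z {h} → ℚ.∣ y ℚ.- z ∣ ℚ.≤ h → ℚ.∣ weight a y ℚ.- weight a z ∣ ℚ.≤ h ℚ.+ h
  weight-Lipschitz a y z {h} le = begin
    ℚ.∣ (tail a y ℚ.- tail (suc a) y) ℚ.- (tail a z ℚ.- tail (suc a) z) ∣
      ≡⟨ cong ℚ.∣_∣ (eq (tail a y) (tail (suc a) y) (tail a z) (tail (suc a) z)) ⟩
    ℚ.∣ (tail a y ℚ.- tail a z) ℚ.- (tail (suc a) y ℚ.- tail (suc a) z) ∣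
      ≤⟨ ℚ.∣p-q∣≤∣p∣+∣q∣ (tail a y ℚ.- tail a z) (tail (suc a) y ℚ.- tail (suc a) z) ⟩
    ℚ.∣ tail a y ℚ.- tail a z ∣ ℚ.+ ℚ.∣ tail (suc a) y ℚ.- tail (suc a) z ∣
      ≤⟨ ℚ.+-mono-≤ (ℚ.≤-trans (tail-Lipschitz a y z) le) (ℚ.≤-trans (tail-Lipschitz (suc a) y z) le) ⟩
    h ℚ.+ h ∎
    where
    open ℚ.≤-Reasoning
    eq : ∀ a b c d → (a ℚ.- b) ℚ.- (c ℚ.- d) ≡ (a ℚ.- c) ℚ.- (b ℚ.- d)
    eq = solve-∀ ℚ-ring

  interp : ∀ {k} → (Vec ℕ k → ℚ) → (Fin k → ℚ) → ℚ
  interp {zero}  f y = f []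
  interp {suc k} f y = sumℕ (suc N) (λ a → weight a (y zero) ℚ.* interp (f ∘ (a ∷_)) (y ∘ suc))

  interp-linear : ∀ {k} (y : Fin k → ℚ) → Linear (λ f → interp f y)
  interp-linear {zero}  y = eval-linear []
  interp-linear {suc k} y = sumℕ-linear (suc N) (λ a → *-linear (weight a (y zero)) (pullback-linear (a ∷_) (interp-linear (y ∘ suc))))

  interp-total : ∀ {k} (y : Fin k → ℚ) → interp (λ _ → 1ℚ) y ≡ 1ℚ
  interp-total {zero}  y = refl
  interp-total {suc k} y = trans (sumℕ-cong (suc N) (λ a _ → trans (cong (weight a (y zero) ℚ.*_) (interp-total (y ∘ suc))) (ℚ.*-identityʳ (weight a (y zero)))))
    (weights-total (y zero))

  interp-mono : ∀ {k} {f g : Vec ℕ k → ℚ} → (∀ p → f p ℚ.≤ g p) → ∀ y → interp f y ℚ.≤ interp g y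
  interp-mono {zero}  h y = h []
  interp-mono {suc k} h y = sumℕ-mono (suc N) λ a → *-monoˡ (0≤weight a (y zero)) (interp-mono (h ∘ (a ∷_)) (y ∘ suc))

  0≤interp : ∀ {k} {f : Vec ℕ k → ℚ} → (∀ p → 0ℚ ℚ.≤ f p) → ∀ y → 0ℚ ℚ.≤ interp f y
  0≤interp {zero}  h y = h []
  0≤interp {suc k} h y = sumℕ-≥0 (suc N) λ a → 0≤* (0≤weight a (y zero)) (0≤interp (h ∘ (a ∷_)) (y ∘ suc))

  interp≤1 : ∀ {k} {f : Vec ℕ k → ℚ} → (∀ p → f p ℚ.≤ 1ℚ) → ∀ y → interp f y ℚ.≤ 1ℚ
  interp≤1 h y = ℚ.≤-trans (interp-mono h y) (ℚ.≤-reflexive (interp-total y))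

  interp>0 : ∀ {k} {f : Vec ℕ k → ℚ} → (∀ p → 0ℚ ℚ.≤ f p) → ∀ y → 0ℚ ℚ.< interp f y →
    ∃[ p ] (0ℚ ℚ.< f p × (∀ i → Active (y i) (lookup p i)))
  interp>0 {zero}  h y lt = [] , lt , λ ()
  interp>0 {suc k} h y lt with sumℕ>0 (suc N) lt
  ... | a , lt′ with 0<*⇒0< (0≤weight a (y zero)) (0≤interp (h ∘ (a ∷_)) (y ∘ suc)) lt′
  ...   | 0<w , 0<I with interp>0 (h ∘ (a ∷_)) (y ∘ suc) 0<I
  ...     | p , 0<f , act = a ∷ p , 0<f , λ { zero → weight>0⇒active a (y zero) 0<w ; (suc i) → act i }

  interp-nearest : ∀ {k} {f : Vec ℕ k → ℚ} → (∀ p → 0ℚ ℚ.≤ f p) → ∀ y p →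
    (∀ i → lookup p i ≡ nearest (y i)) → f p ≡ 1ℚ → ½^ k ℚ.≤ interp f y
  interp-nearest {zero}  h y []      e f≡1 = ℚ.≤-reflexive (sym f≡1)
  interp-nearest {suc k} {f} h y (a ∷ p) e f≡1 = ℚ.≤-trans
    (*-mono 0≤½ (0≤interp (h ∘ (a ∷_)) (y ∘ suc)) (subst (λ b → ½ ℚ.≤ weight b (y zero)) (sym (e zero)) (weight-nearest (y zero))) (interp-nearest (h ∘ (a ∷_)) (y ∘ suc) p (e ∘ suc) f≡1))
    (sumℕ-term (suc N) {λ a → weight a (y zero) ℚ.* interp (f ∘ (a ∷_)) (y ∘ suc)}
      (λ a → 0≤* (0≤weight a (y zero)) (0≤interp (h ∘ (a ∷_)) (y ∘ suc)))
      (s≤s (subst (ℕ._≤ N) (sym (e zero)) (round≤ N (y zero)))))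

  -- Each of the N + 1 summands changes by at most 2h through its weight, a difference of two tails,
  -- and by `Lip k` times h through the remaining coordinates.
  Lip : ℕ → ℚ
  Lip zero    = 0ℚ
  Lip (suc k) = ι (suc N) ℚ.* (1ℚ ℚ.+ 1ℚ ℚ.+ Lip k)

  0≤Lip : ∀ k → 0ℚ ℚ.≤ Lip k
  0≤Lip zero    = ℚ.≤-refl
  0≤Lip (suc k) = 0≤* (0≤ι (suc N)) (0≤+ (0≤+ 0≤1 0≤1) (0≤Lip k))

  interp-Lipschitz : ∀ {k} {f : Vec ℕ k → ℚ} → (∀ p → 0ℚ ℚ.≤ f p) → (∀ p → f p ℚ.≤ 1ℚ) → ∀ y z {h} →
    (∀ i → ℚ.∣ y i ℚ.- z i ∣ ℚ.≤ h) → ℚ.∣ interp f y ℚ.- interp f z ∣ ℚ.≤ Lip k ℚ.* h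
  interp-Lipschitz {zero} {f} 0≤f f≤1 y z {h} le = ℚ.≤-reflexive (trans (cong ℚ.∣_∣ (ℚ.+-inverseʳ (f []))) (sym (ℚ.*-zeroˡ h)))
  interp-Lipschitz {suc k} {f} 0≤f f≤1 y z {h} le = ℚ.≤-trans
    (sumℕ-diff (suc N) _ _ λ a → ∣diff*∣ {w = weight a (y zero)} (0≤weight a (z zero)) (weight≤1 a (z zero))
      (0≤interp (0≤f ∘ (a ∷_)) (y ∘ suc)) (interp≤1 (f≤1 ∘ (a ∷_)) (y ∘ suc))
      (weight-Lipschitz a (y zero) (z zero) (le zero)) (interp-Lipschitz (0≤f ∘ (a ∷_)) (f≤1 ∘ (a ∷_)) (y ∘ suc) (z ∘ suc) (le ∘ suc)))
    (ℚ.≤-reflexive (eq (ι (suc N)) (Lip k) h))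
    where
    eq : ∀ n l h → n ℚ.* ((h ℚ.+ h) ℚ.+ l ℚ.* h) ≡ n ℚ.* (1ℚ ℚ.+ 1ℚ ℚ.+ l) ℚ.* h
    eq = solve-∀ ℚ-ring

-- Rational points of balls and spheres

abstract
  quotient : ∀ {B ε} → 0ℚ ℚ.< B → 0ℚ ℚ.< ε → ∃[ ζ ] (0ℚ ℚ.< ζ × B ℚ.* ζ ≡ ε)
  quotient {B} {ε} 0<B 0<ε = B⁻¹ ℚ.* ε , 0<* (ℚ.positive⁻¹ B⁻¹ {{ℚ.1/pos⇒pos B}}) 0<ε ,
    trans (sym (ℚ.*-assoc B B⁻¹ ε)) (trans (cong (ℚ._* ε) (ℚ.*-inverseʳ B)) (ℚ.*-identityˡ ε))
    where
    instance
      B-pos : ℚ.Positive B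
      B-pos = ℚ.positive 0<B
      B-nonZero : ℚ.NonZero B
      B-nonZero = ℚ.pos⇒nonZero B
    B⁻¹ : ℚ
    B⁻¹ = ℚ.1/ B

sum-mono : ∀ {k} {f g : Fin k → ℚ} → (∀ i → f i ℚ.≤ g i) → sum f ℚ.≤ sum g
sum-mono {zero}  h = ℚ.≤-refl
sum-mono {suc k} h = ℚ.+-mono-≤ (h zero) (sum-mono (h ∘ suc))

sum-const : ∀ k c → sum {k} (λ _ → c) ≡ ι k ℚ.* c
sum-const zero    c = sym (ℚ.*-zeroˡ c)
sum-const (suc k) c = trans (cong (c ℚ.+_) (sum-const k c)) (eq (ι k) c)
  where
  eq : ∀ a c → c ℚ.+ a ℚ.* c ≡ (1ℚ ℚ.+ a) ℚ.* c
  eq = solve-∀ ℚ-ring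

sum-scale : ∀ {k} c (f : Fin k → ℚ) → sum (λ i → c ℚ.* f i) ≡ c ℚ.* sum f
sum-scale {zero}  c f = sym (ℚ.*-zeroʳ c)
sum-scale {suc k} c f = trans (cong (c ℚ.* f zero ℚ.+_) (sum-scale c (f ∘ suc))) (sym (ℚ.*-distribˡ-+ c (f zero) (sum (f ∘ suc))))

sum-≤ : ∀ {k} {f : Fin k → ℚ} {B} → (∀ i → f i ℚ.≤ B) → sum f ℚ.≤ ι k ℚ.* B
sum-≤ {k} {B = B} h = ℚ.≤-trans (sum-mono h) (ℚ.≤-reflexive (sum-const k B))

0≤sum : ∀ {k} {f : Fin k → ℚ} → (∀ i → 0ℚ ℚ.≤ f i) → 0ℚ ℚ.≤ sum f
0≤sum {zero}  h = ℚ.≤-refl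
0≤sum {suc k} h = 0≤+ (h zero) (0≤sum (h ∘ suc))

sum-term : ∀ {k} {f : Fin k → ℚ} → (∀ i → 0ℚ ℚ.≤ f i) → ∀ i → f i ℚ.≤ sum f
sum-term {f = f} h zero    = subst (ℚ._≤ sum f) (ℚ.+-identityʳ (f zero)) (ℚ.+-monoʳ-≤ (f zero) (0≤sum (h ∘ suc)))
sum-term {f = f} h (suc i) = subst (ℚ._≤ sum f) (ℚ.+-identityˡ (f (suc i))) (ℚ.+-mono-≤ (h zero) (sum-term (h ∘ suc) i))

0≤square : ∀ a → 0ℚ ℚ.≤ a ℚ.* a
0≤square a with ℚ.≤-total 0ℚ a
... | inj₁ 0≤a = 0≤* 0≤a 0≤a
... | inj₂ a≤0 = subst (0ℚ ℚ.≤_) (eq a) (0≤* (ℚ.neg-antimono-≤ a≤0) (ℚ.neg-antimono-≤ a≤0))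
  where
  eq : ∀ a → ℚ.- a ℚ.* ℚ.- a ≡ a ℚ.* a
  eq = solve-∀ ℚ-ring

sqn : ∀ {k} → (Fin k → ℚ) → ℚ
sqn x = sum (λ i → x i ℚ.* x i)

0≤sqn : ∀ {k} (x : Fin k → ℚ) → 0ℚ ℚ.≤ sqn x
0≤sqn x = 0≤sum (λ i → 0≤square (x i))

sqn-scale : ∀ {k} c (x : Fin k → ℚ) → sqn (λ i → c ℚ.* x i) ≡ c ℚ.* c ℚ.* sqn x
sqn-scale c x = trans (foldr-cong (λ i → eq c (x i))) (sum-scale (c ℚ.* c) (λ i → x i ℚ.* x i))
  where
  eq : ∀ c a → (c ℚ.* a) ℚ.* (c ℚ.* a) ≡ c ℚ.* c ℚ.* (a ℚ.* a)
  eq = solve-∀ ℚ-ring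

sqn-unit-coordinate : ∀ {k} (x : Fin k → ℚ) i → x i ℚ.* x i ≡ 1ℚ → 1ℚ ℚ.≤ sqn x
sqn-unit-coordinate x i e = subst (ℚ._≤ sqn x) e (sum-term (λ i → 0≤square (x i)) i)

sqn-near : ∀ {k} (x y : Fin k → ℚ) {h} → (∀ i → ℚ.∣ x i ∣ ℚ.≤ 1ℚ) → (∀ i → ℚ.∣ y i ∣ ℚ.≤ 1ℚ) →
  (∀ i → ℚ.∣ x i ℚ.- y i ∣ ℚ.≤ h) → sqn x ℚ.≤ sqn y ℚ.+ ι k ℚ.* (h ℚ.+ h)
sqn-near {zero} x y {h} _ _ _ = ℚ.≤-reflexive (sym (trans (ℚ.+-identityˡ (0ℚ ℚ.* (h ℚ.+ h))) (ℚ.*-zeroˡ (h ℚ.+ h))))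
sqn-near {suc k} x y {h} x≤1 y≤1 near = ℚ.≤-trans
  (ℚ.+-mono-≤ head (sqn-near (x ∘ suc) (y ∘ suc) (x≤1 ∘ suc) (y≤1 ∘ suc) (near ∘ suc)))
  (ℚ.≤-reflexive (eq₂ (y zero ℚ.* y zero) (sqn (y ∘ suc)) (h ℚ.+ h) (ι k)))
  where
  a b : ℚ
  a = x zero
  b = y zero
  eq₂ : ∀ p q h k → (p ℚ.+ h) ℚ.+ (q ℚ.+ k ℚ.* h) ≡ (p ℚ.+ q) ℚ.+ (1ℚ ℚ.+ k) ℚ.* h
  eq₂ = solve-∀ ℚ-ring
  eq₁ : ∀ a b → a ℚ.* a ≡ b ℚ.* b ℚ.+ (a ℚ.- b) ℚ.* (a ℚ.+ b)
  eq₁ = solve-∀ ℚ-ring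
  eq₃ : ∀ h → h ℚ.* (1ℚ ℚ.+ 1ℚ) ≡ h ℚ.+ h
  eq₃ = solve-∀ ℚ-ring
  head : a ℚ.* a ℚ.≤ b ℚ.* b ℚ.+ (h ℚ.+ h)
  head = subst (ℚ._≤ b ℚ.* b ℚ.+ (h ℚ.+ h)) (sym (eq₁ a b)) (ℚ.+-monoʳ-≤ (b ℚ.* b) (begin
    (a ℚ.- b) ℚ.* (a ℚ.+ b)              ≤⟨ p≤∣p∣ ((a ℚ.- b) ℚ.* (a ℚ.+ b)) ⟩
    ℚ.∣ (a ℚ.- b) ℚ.* (a ℚ.+ b) ∣        ≡⟨ ℚ.∣p*q∣≡∣p∣*∣q∣ (a ℚ.- b) (a ℚ.+ b) ⟩
    ℚ.∣ a ℚ.- b ∣ ℚ.* ℚ.∣ a ℚ.+ b ∣      ≤⟨ *-mono (ℚ.0≤∣p∣ (a ℚ.- b)) (0≤+ 0≤1 0≤1) (near zero)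
                                              (ℚ.≤-trans (ℚ.∣p+q∣≤∣p∣+∣q∣ a b) (ℚ.+-mono-≤ (x≤1 zero) (y≤1 zero))) ⟩
    h ℚ.* (1ℚ ℚ.+ 1ℚ)                    ≡⟨ eq₃ h ⟩
    h ℚ.+ h                              ∎))
    where open ℚ.≤-Reasoning

module _ {j} (x : Fin (suc j) → ℚ) (sq≤1 : sqn x ℚ.≤ 1ℚ) (x≤1 : ∀ i → ℚ.∣ x i ∣ ℚ.≤ 1ℚ) where
  private
    x₀ R s : ℚ
    x₀ = x zero
    R  = sqn (x ∘ suc)
    s  = 1ℚ ℚ.- sqn x

    0≤s : 0ℚ ℚ.≤ s
    0≤s = p≤q⇒0≤q-p sq≤1

  -- Stereographic projection of x from the pole ε e₀ in the opposite half
  -- space; it keeps the coordinates rational.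
  stereographic : ∀ ε → ε ℚ.* ε ≡ 1ℚ → ℚ.∣ ε ∣ ≡ 1ℚ → ε ℚ.* x₀ ℚ.≤ 0ℚ →
    ∃[ z ] (sqn z ≡ 1ℚ × (∀ i → ℚ.∣ z i ℚ.- x i ∣ ℚ.≤ s ℚ.+ s))
  stereographic ε ε² ∣ε∣ εx₀≤0 = z , sqn-z , near
    where
    D : ℚ
    D = (x₀ ℚ.- ε) ℚ.* (x₀ ℚ.- ε) ℚ.+ R
    -- `D` is the squared distance from `x` to the pole; it is at least 1 because the pole lies in
    -- the opposite half space.
    1≤D : 1ℚ ℚ.≤ D
    1≤D = ≤-excess (x₀ ℚ.* x₀ ℚ.+ R ℚ.+ (0ℚ ℚ.- ε ℚ.* x₀) ℚ.+ (0ℚ ℚ.- ε ℚ.* x₀))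
      (0≤+ (0≤+ (0≤+ (0≤square x₀) (0≤sqn (x ∘ suc))) (p≤q⇒0≤q-p εx₀≤0)) (p≤q⇒0≤q-p εx₀≤0))
      (trans (eq₁ x₀ ε R) (cong (λ e → (e ℚ.+ (x₀ ℚ.* x₀ ℚ.+ R ℚ.+ (0ℚ ℚ.- ε ℚ.* x₀) ℚ.+ (0ℚ ℚ.- ε ℚ.* x₀)))) ε²))
      where
      eq₁ : ∀ a e r → (a ℚ.- e) ℚ.* (a ℚ.- e) ℚ.+ r ≡ e ℚ.* e ℚ.+ (a ℚ.* a ℚ.+ r ℚ.+ (0ℚ ℚ.- e ℚ.* a) ℚ.+ (0ℚ ℚ.- e ℚ.* a))
      eq₁ = solve-∀ ℚ-ring
    0<D : 0ℚ ℚ.< D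
    0<D = ℚ.<-≤-trans (ℚ.positive⁻¹ 1ℚ) 1≤D
    inv : ∃[ ζ ] (0ℚ ℚ.< ζ × D ℚ.* ζ ≡ 1ℚ)
    inv = quotient 0<D (ℚ.positive⁻¹ 1ℚ)
    D⁻¹ u t : ℚ
    D⁻¹ = proj₁ inv
    -- The line from the pole p through x meets the sphere again at p + t(x - p), where t = 1 + (1 -
    -- |x|²)/D. The displacement is then u(x - p), with u at most s.
    u = s ℚ.* D⁻¹
    t = 1ℚ ℚ.+ u
    Du : D ℚ.* u ≡ s
    Du = trans (eq₂ D s D⁻¹) (trans (cong (s ℚ.*_) (proj₂ (proj₂ inv))) (ℚ.*-identityʳ s))
      where
      eq₂ : ∀ d s i → d ℚ.* (s ℚ.* i) ≡ s ℚ.* (d ℚ.* i)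
      eq₂ = solve-∀ ℚ-ring
    0≤u : 0ℚ ℚ.≤ u
    0≤u = 0≤* 0≤s (ℚ.<⇒≤ (proj₁ (proj₂ inv)))
    u≤s : u ℚ.≤ s
    u≤s = subst₂ ℚ._≤_ (ℚ.*-identityˡ u) Du (*-monoʳ 0≤u 1≤D)
    z : Fin (suc j) → ℚ
    z zero    = ε ℚ.+ t ℚ.* (x₀ ℚ.- ε)
    z (suc i) = t ℚ.* x (suc i)
    sqn-z : sqn z ≡ 1ℚ
    sqn-z = begin
      (ε ℚ.+ t ℚ.* (x₀ ℚ.- ε)) ℚ.* (ε ℚ.+ t ℚ.* (x₀ ℚ.- ε)) ℚ.+ sqn (λ i → t ℚ.* x (suc i))
        ≡⟨ cong ((ε ℚ.+ t ℚ.* (x₀ ℚ.- ε)) ℚ.* (ε ℚ.+ t ℚ.* (x₀ ℚ.- ε)) ℚ.+_) (sqn-scale t (x ∘ suc)) ⟩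
      (ε ℚ.+ t ℚ.* (x₀ ℚ.- ε)) ℚ.* (ε ℚ.+ t ℚ.* (x₀ ℚ.- ε)) ℚ.+ t ℚ.* t ℚ.* R
        ≡⟨ eq₃ ε u x₀ R ⟩
      (x₀ ℚ.* x₀ ℚ.+ R) ℚ.+ (u ℚ.+ 1ℚ) ℚ.* (D ℚ.* u) ℚ.+ u ℚ.* (x₀ ℚ.* x₀ ℚ.+ R ℚ.- ε ℚ.* ε)
        ≡⟨ cong₂ (λ a b → (x₀ ℚ.* x₀ ℚ.+ R) ℚ.+ (u ℚ.+ 1ℚ) ℚ.* a ℚ.+ u ℚ.* (x₀ ℚ.* x₀ ℚ.+ R ℚ.- b)) Du ε² ⟩
      (x₀ ℚ.* x₀ ℚ.+ R) ℚ.+ (u ℚ.+ 1ℚ) ℚ.* s ℚ.+ u ℚ.* (x₀ ℚ.* x₀ ℚ.+ R ℚ.- 1ℚ)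
        ≡⟨ eq₄ (x₀ ℚ.* x₀ ℚ.+ R) u ⟩
      1ℚ ∎
      where
      open ≡-Reasoning
      eq₃ : ∀ e u a r → (e ℚ.+ (1ℚ ℚ.+ u) ℚ.* (a ℚ.- e)) ℚ.* (e ℚ.+ (1ℚ ℚ.+ u) ℚ.* (a ℚ.- e)) ℚ.+ (1ℚ ℚ.+ u) ℚ.* (1ℚ ℚ.+ u) ℚ.* r
        ≡ (a ℚ.* a ℚ.+ r) ℚ.+ (u ℚ.+ 1ℚ) ℚ.* (((a ℚ.- e) ℚ.* (a ℚ.- e) ℚ.+ r) ℚ.* u) ℚ.+ u ℚ.* (a ℚ.* a ℚ.+ r ℚ.- e ℚ.* e)
      eq₃ = solve-∀ ℚ-ring
      eq₄ : ∀ q u → q ℚ.+ (u ℚ.+ 1ℚ) ℚ.* (1ℚ ℚ.- q) ℚ.+ u ℚ.* (q ℚ.- 1ℚ) ≡ 1ℚ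
      eq₄ = solve-∀ ℚ-ring
    near′ : ∀ a → ℚ.∣ a ∣ ℚ.≤ 1ℚ ℚ.+ 1ℚ → ℚ.∣ u ℚ.* a ∣ ℚ.≤ s ℚ.+ s
    near′ a a≤2 = begin
      ℚ.∣ u ℚ.* a ∣             ≡⟨ ℚ.∣p*q∣≡∣p∣*∣q∣ u a ⟩
      ℚ.∣ u ∣ ℚ.* ℚ.∣ a ∣       ≡⟨ cong (ℚ._* ℚ.∣ a ∣) (ℚ.0≤p⇒∣p∣≡p 0≤u) ⟩
      u ℚ.* ℚ.∣ a ∣             ≤⟨ *-mono 0≤u (0≤+ 0≤1 0≤1) u≤s a≤2 ⟩
      s ℚ.* (1ℚ ℚ.+ 1ℚ)         ≡⟨ eq₅ s ⟩
      s ℚ.+ s                   ∎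
      where
      open ℚ.≤-Reasoning
      eq₅ : ∀ h → h ℚ.* (1ℚ ℚ.+ 1ℚ) ≡ h ℚ.+ h
      eq₅ = solve-∀ ℚ-ring
    near : ∀ i → ℚ.∣ z i ℚ.- x i ∣ ℚ.≤ s ℚ.+ s
    near zero = subst (λ a → ℚ.∣ a ∣ ℚ.≤ s ℚ.+ s) (eq₆ ε u x₀) (near′ (x₀ ℚ.- ε)
      (ℚ.≤-trans (ℚ.∣p-q∣≤∣p∣+∣q∣ x₀ ε) (ℚ.+-mono-≤ (x≤1 zero) (ℚ.≤-reflexive ∣ε∣))))
      where
      eq₆ : ∀ e u a → u ℚ.* (a ℚ.- e) ≡ (e ℚ.+ (1ℚ ℚ.+ u) ℚ.* (a ℚ.- e)) ℚ.- a
      eq₆ = solve-∀ ℚ-ring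
    near (suc i) = subst (λ a → ℚ.∣ a ∣ ℚ.≤ s ℚ.+ s) (eq₇ u (x (suc i))) (near′ (x (suc i)) (ℚ.≤-trans (x≤1 (suc i)) (≤-excess 1ℚ 0≤1 refl)))
      where
      eq₇ : ∀ u a → u ℚ.* a ≡ (1ℚ ℚ.+ u) ℚ.* a ℚ.- a
      eq₇ = solve-∀ ℚ-ring

  abstract
    sphere-point : ∃[ z ] (sqn z ≡ 1ℚ × (∀ i → ℚ.∣ z i ℚ.- x i ∣ ℚ.≤ s ℚ.+ s))
    sphere-point with ℚ.≤-total 0ℚ x₀
    ... | inj₁ 0≤x₀ = stereographic (ℚ.- 1ℚ) refl refl (≤-excess x₀ 0≤x₀ (eq x₀))
      where
      eq : ∀ a → 0ℚ ≡ (ℚ.- 1ℚ) ℚ.* a ℚ.+ a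
      eq = solve-∀ ℚ-ring
    ... | inj₂ x₀≤0 = stereographic 1ℚ refl refl (subst (ℚ._≤ 0ℚ) (sym (ℚ.*-identityˡ x₀)) x₀≤0)

-- From a grid map to a map of spheres

record Enumeration {m} (σ : Subset m) (k : ℕ) : Set where
  field
    emb     : Fin k → Fin m
    idx     : Fin m → Maybe (Fin k)
    emb-∈   : ∀ i → emb i ∈ σ
    idx-emb : ∀ i → idx (emb i) ≡ just i
    idx-∈   : ∀ {v} → v ∈ σ → ∃[ i ] (idx v ≡ just i × emb i ≡ v)
    idx-∉   : ∀ {v} → v ∉ σ → idx v ≡ nothing

enumerate : ∀ {m} (σ : Subset m) → Enumeration σ ∣ σ ∣
enumerate [] = record { emb = λ () ; idx = λ () ; emb-∈ = λ () ; idx-emb = λ () ; idx-∈ = λ () ; idx-∉ = λ { {()} } }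
enumerate (outside ∷ σ) = record
  { emb     = suc ∘ emb
  ; idx     = λ { zero → nothing ; (suc v) → idx v }
  ; emb-∈   = λ i → there (emb-∈ i)
  ; idx-emb = idx-emb
  ; idx-∈   = λ { (there v∈) → let i , p , q = idx-∈ v∈ in i , p , cong suc q }
  ; idx-∉   = λ { {zero} _ → refl ; {suc v} v∉ → idx-∉ (v∉ ∘ there) }
  }
  where open Enumeration (enumerate σ)
enumerate (inside ∷ σ) = record
  { emb     = λ { zero → zero ; (suc i) → suc (emb i) }
  ; idx     = λ { zero → just zero ; (suc v) → mapMaybe suc (idx v) }
  ; emb-∈   = λ { zero → here ; (suc i) → there (emb-∈ i) }
  ; idx-emb = λ { zero → refl ; (suc i) → cong (mapMaybe suc) (idx-emb i) }
  ; idx-∈   = λ { here → zero , refl , refl ; (there v∈) → let i , p , q = idx-∈ v∈ in suc i , cong (mapMaybe suc) p , cong suc q }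
  ; idx-∉   = λ { {zero} v∉ → ⊥-elim (v∉ here) ; {suc v} v∉ → cong (mapMaybe suc) (idx-∉ (v∉ ∘ there)) }
  }
  where open Enumeration (enumerate σ)

upper-bound : ∀ {k} (f : Fin k → ℕ) → ∃[ n ] (∀ i → f i ℕ.≤ n)
upper-bound {zero}  f = 0 , λ ()
upper-bound {suc k} f = let n , h = upper-bound (f ∘ suc) in
  f zero ℕ.⊔ n , λ { zero → ℕ.m≤m⊔n (f zero) n ; (suc i) → ℕ.≤-trans (h i) (ℕ.m≤n⊔m (f zero) n) }

seq-sumᴿ : ∀ {k} (g : Fin k → ℝ) n → seq (sumᴿ g) n ≡ sum (λ i → seq (g i) n)
seq-sumᴿ {zero}  g n = refl
seq-sumᴿ {suc k} g n = cong (seq (g zero) n ℚ.+_) (seq-sumᴿ (g ∘ suc) n)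

pointwise-≤ᴿ : ∀ {x y} → (∀ n → seq x n ℚ.≤ seq y n) → x ≤ᴿ y
pointwise-≤ᴿ {x} {y} h = mk≤ λ ε 0<ε → 0 , λ n _ → ℚ.≤-<-trans (h n) (<-excess ε 0<ε refl)

h*2l≡2 : ∀ l {h} → ι l ℚ.* h ≡ 1ℚ → h ℚ.* ι (l ℕ.+ l) ≡ 1ℚ ℚ.+ 1ℚ
h*2l≡2 l {h} e = trans (cong (h ℚ.*_) (ι-+ l l)) (trans (eq h (ι l)) (cong₂ ℚ._+_ e e))
  where
  eq : ∀ h l → h ℚ.* (l ℚ.+ l) ≡ l ℚ.* h ℚ.+ l ℚ.* h
  eq = solve-∀ ℚ-ring

0<1 : 0ℚ ℚ.< 1ℚ
0<1 = ℚ.positive⁻¹ 1ℚ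

-- The affine map aff carries [-1/c, 1/c] to [0, 2L]; for c = 4 k the points
-- with all coordinates in that interval lie well inside the unit ball.
module Stage (L k : ℕ) (0<k : 0 ℕ.< k) where

  N c : ℕ
  N = L ℕ.+ L
  c = 4 ℕ.* k

  open Weights N public

  aff : ℚ → ℚ
  aff q = ι L ℚ.+ ι L ℚ.* (ι c ℚ.* q)

  1≤c : 1ℚ ℚ.≤ ι c
  1≤c = ι-mono {1} (ℕ.≤-trans 0<k (ℕ.m≤m+n k _))

  aff-≤0 : ∀ {q} → ι c ℚ.* q ℚ.≤ ℚ.- 1ℚ → aff q ℚ.≤ 0ℚ
  aff-≤0 {q} le = ℚ.≤-trans (ℚ.+-monoʳ-≤ (ι L) (*-monoˡ (0≤ι L) le)) (ℚ.≤-reflexive (eq (ι L)))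
    where
    eq : ∀ l → l ℚ.+ l ℚ.* (ℚ.- 1ℚ) ≡ 0ℚ
    eq = solve-∀ ℚ-ring

  aff-≥N : ∀ {q} → 1ℚ ℚ.≤ ι c ℚ.* q → ι N ℚ.≤ aff q
  aff-≥N {q} le = ℚ.≤-trans (ℚ.≤-reflexive (trans (ι-+ L L) (cong (ι L ℚ.+_) (sym (ℚ.*-identityʳ (ι L))))))
    (ℚ.+-monoʳ-≤ (ι L) (*-monoˡ (0≤ι L) le))

  -- The coordinate a of a finer grid sits at h a - 1 in [-1,1]; `aff` carries it to the scale of
  -- the coarse grid, where it is rounded.
  reduce : ℚ → ℕ → ℕ
  reduce h a = nearest (aff (h ℚ.* ι a ℚ.- 1ℚ))

  reduce-0 : ∀ h → reduce h 0 ≡ 0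
  reduce-0 h = nearest-≤0 (aff-≤0 {h ℚ.* 0ℚ ℚ.- 1ℚ} (≤-excess (ι c ℚ.- 1ℚ) (p≤q⇒0≤q-p 1≤c) (eq (ι c) h)))
    where
    eq : ∀ c h → ℚ.- 1ℚ ≡ c ℚ.* (h ℚ.* 0ℚ ℚ.- 1ℚ) ℚ.+ (c ℚ.- 1ℚ)
    eq = solve-∀ ℚ-ring

  aff-Lipschitz : ∀ p q {h} → ℚ.∣ p ℚ.- q ∣ ℚ.≤ h → ℚ.∣ aff p ℚ.- aff q ∣ ℚ.≤ ι L ℚ.* ι c ℚ.* h
  aff-Lipschitz p q {h} le = begin
    ℚ.∣ aff p ℚ.- aff q ∣                     ≡⟨ cong ℚ.∣_∣ (eq (ι L) (ι c) p q) ⟩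
    ℚ.∣ ι L ℚ.* ι c ℚ.* (p ℚ.- q) ∣           ≡⟨ ℚ.∣p*q∣≡∣p∣*∣q∣ (ι L ℚ.* ι c) (p ℚ.- q) ⟩
    ℚ.∣ ι L ℚ.* ι c ∣ ℚ.* ℚ.∣ p ℚ.- q ∣       ≡⟨ cong (ℚ._* ℚ.∣ p ℚ.- q ∣) (ℚ.0≤p⇒∣p∣≡p (0≤* (0≤ι L) (0≤ι c))) ⟩
    ι L ℚ.* ι c ℚ.* ℚ.∣ p ℚ.- q ∣             ≤⟨ *-monoˡ (0≤* (0≤ι L) (0≤ι c)) le ⟩
    ι L ℚ.* ι c ℚ.* h                         ∎
    where
    open ℚ.≤-Reasoning
    eq : ∀ l c p q → (l ℚ.+ l ℚ.* (c ℚ.* p)) ℚ.- (l ℚ.+ l ℚ.* (c ℚ.* q)) ≡ l ℚ.* c ℚ.* (p ℚ.- q)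
    eq = solve-∀ ℚ-ring

  -- If every c xᵢ lay strictly between -1 and 1, then |c x|² would be at most k, whereas c²/4 = 4k²
  -- exceeds k.
  escapes : ∀ (x : Fin k → ℚ) → ½ ℚ.* ½ ℚ.≤ sqn x → ∃[ i ] (aff (x i) ℚ.≤ 0ℚ ⊎ ι N ℚ.≤ aff (x i))
  escapes x ¼≤ with Fin.any? (λ i → (ι c ℚ.* x i ℚ.≤? ℚ.- 1ℚ) ⊎-dec (1ℚ ℚ.≤? ι c ℚ.* x i))
  ... | yes (i , inj₁ le) = i , inj₁ (aff-≤0 le)
  ... | yes (i , inj₂ le) = i , inj₂ (aff-≥N le)
  ... | no ¬p = ⊥-elim (ℚ.<-irrefl refl (ℚ.<-≤-trans small (begin
      ι c ℚ.* ι c ℚ.* (½ ℚ.* ½)    ≤⟨ *-monoˡ (0≤* (0≤ι c) (0≤ι c)) ¼≤ ⟩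
      ι c ℚ.* ι c ℚ.* sqn x        ≡⟨ sym (sqn-scale (ι c) x) ⟩
      sqn (λ i → ι c ℚ.* x i)      ≤⟨ sum-≤ square≤1 ⟩
      ι k ℚ.* 1ℚ                   ≡⟨ ℚ.*-identityʳ (ι k) ⟩
      ι k                          ∎)))
    where
    open ℚ.≤-Reasoning
    square≤1 : ∀ i → (ι c ℚ.* x i) ℚ.* (ι c ℚ.* x i) ℚ.≤ 1ℚ
    square≤1 i = ≤-excess ((1ℚ ℚ.- a) ℚ.* (a ℚ.- (ℚ.- 1ℚ)))
      (0≤* (p≤q⇒0≤q-p (ℚ.<⇒≤ (ℚ.≰⇒> (λ le → ¬p (i , inj₂ le))))) (p≤q⇒0≤q-p (ℚ.<⇒≤ (ℚ.≰⇒> (λ le → ¬p (i , inj₁ le)))))) (eq a)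
      where
      a = ι c ℚ.* x i
      eq : ∀ a → 1ℚ ≡ a ℚ.* a ℚ.+ (1ℚ ℚ.- a) ℚ.* (a ℚ.- (ℚ.- 1ℚ))
      eq = solve-∀ ℚ-ring
    small : ι k ℚ.< ι c ℚ.* ι c ℚ.* (½ ℚ.* ½)
    small = <-excess (ι k ℚ.* ι k ℚ.* ι 3 ℚ.+ ι k ℚ.* (ι k ℚ.- 1ℚ))
      (0<+ (0<* (0<* (0<ι 0<k) (0<ι 0<k)) (0<ι {3} (s≤s z≤n))) (0≤* (0≤ι k) (p≤q⇒0≤q-p (ι-mono {1} 0<k))))
      (trans (cong (λ z → z ℚ.* z ℚ.* (½ ℚ.* ½)) (ι-* 4 k)) (eq (ι k)))
      where
      eq : ∀ k → ((ι 4 ℚ.* k) ℚ.* (ι 4 ℚ.* k)) ℚ.* (½ ℚ.* ½) ≡ k ℚ.+ (k ℚ.* k ℚ.* ι 3 ℚ.+ k ℚ.* (k ℚ.- 1ℚ))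
      eq = solve-∀ ℚ-ring

module Approximation {m j} (K : Complex m) (L : ℕ) {Q : Vec ℕ m → Fin m} (G : GridMap K (L ℕ.+ L) j Q)
  {σ : Subset m} (Kσ : Simplex K σ) (∣σ∣ : ∣ σ ∣ ≡ suc j) where

  k : ℕ
  k = suc j

  open Stage L k (s≤s z≤n)
  open Cubes N
  open GridMap G
  open Enumeration (subst (Enumeration σ) ∣σ∣ (enumerate σ))

  Y : (Fin k → ℚ) → Fin m → ℚ
  Y x v = maybe′ (λ i → aff (x i)) 0ℚ (idx v)

  Y-∈ : ∀ x {v} → v ∈ σ → ∃[ i ] (emb i ≡ v × Y x v ≡ aff (x i))
  Y-∈ x v∈ = let i , p , q = idx-∈ v∈ in i , q , cong (maybe′ (λ i → aff (x i)) 0ℚ) p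

  Y-∉ : ∀ x {v} → v ∉ σ → Y x v ≡ 0ℚ
  Y-∉ x v∉ = cong (maybe′ (λ i → aff (x i)) 0ℚ) (idx-∉ v∉)

  Y-emb : ∀ x i → Y x (emb i) ≡ aff (x i)
  Y-emb x i = cong (maybe′ (λ i → aff (x i)) 0ℚ) (idx-emb i)

  at : Fin m → Vec ℕ m → ℚ
  at v p with Q p Fin.≟ v
  ... | yes _ = 1ℚ
  ... | no  _ = 0ℚ

  0≤at : ∀ v p → 0ℚ ℚ.≤ at v p
  0≤at v p with Q p Fin.≟ v
  ... | yes _ = 0≤1
  ... | no  _ = ℚ.≤-refl

  at≤1 : ∀ v p → at v p ℚ.≤ 1ℚ
  at≤1 v p with Q p Fin.≟ v
  ... | yes _ = ℚ.≤-refl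
  ... | no  _ = 0≤1

  at>0 : ∀ {v p} → 0ℚ ℚ.< at v p → Q p ≡ v
  at>0 {v} {p} lt with Q p Fin.≟ v
  ... | yes e = e
  ... | no  _ = ⊥-elim (ℚ.<-irrefl refl lt)

  at-Q : ∀ p → at (Q p) p ≡ 1ℚ
  at-Q p with Q p Fin.≟ Q p
  ... | yes _ = refl
  ... | no ne = ⊥-elim (ne refl)

  at-total : ∀ p → sum (λ v → at v p) ≡ 1ℚ
  at-total p = trans (sum-single (λ v → at v p) (Q p) other) (at-Q p)
    where
    other : ∀ v → v ≢ Q p → at v p ≡ 0ℚ
    other v ne with Q p Fin.≟ v
    ... | yes e = ⊥-elim (ne (sym e))
    ... | no  _ = refl

  -- The piecewise multilinear extension of Q, precomposed with aff.
  Ψ : Fin m → (Fin k → ℚ) → ℚ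
  Ψ v x = interp (at v) (Y x)

  0≤Ψ : ∀ v x → 0ℚ ℚ.≤ Ψ v x
  0≤Ψ v x = 0≤interp (0≤at v) (Y x)

  Ψ-total : ∀ x → sum (λ v → Ψ v x) ≡ 1ℚ
  Ψ-total x = trans (sym (sum-commutes (interp-linear (Y x)) at)) (trans (cong-≗ (interp-linear (Y x)) at-total) (interp-total (Y x)))

  M : ℚ
  M = Lip m ℚ.* (ι L ℚ.* ι c)

  0≤M : 0ℚ ℚ.≤ M
  0≤M = 0≤* (0≤Lip m) (0≤* (0≤ι L) (0≤ι c))

  Ψ-Lipschitz : ∀ v x z {h} → 0ℚ ℚ.≤ h → (∀ i → ℚ.∣ x i ℚ.- z i ∣ ℚ.≤ h) → ℚ.∣ Ψ v x ℚ.- Ψ v z ∣ ℚ.≤ M ℚ.* h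
  Ψ-Lipschitz v x z {h} 0≤h le = ℚ.≤-trans (interp-Lipschitz (0≤at v) (at≤1 v) (Y x) (Y z) Y-le)
    (ℚ.≤-reflexive (sym (ℚ.*-assoc (Lip m) (ι L ℚ.* ι c) h)))
    where
    Y-le : ∀ u → ℚ.∣ Y x u ℚ.- Y z u ∣ ℚ.≤ ι L ℚ.* ι c ℚ.* h
    Y-le u with idx u
    ... | just i  = aff-Lipschitz (x i) (z i) (le i)
    ... | nothing = 0≤* (0≤* (0≤ι L) (0≤ι c)) 0≤h

  -- Some coordinate w escapes the interval. If it falls below 0, all active grid points have
  -- w-coordinate 0 and lie in the cube over `σ` without w, which has j vertices, so that `G` is
  -- simplicial there. If it exceeds N, they lie in the base, where the Sperner condition puts their
  -- labels in `σ`.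
  Ψ-simplex : ∀ x → ½ ℚ.* ½ ℚ.≤ sqn x → ∀ τ → (∀ {v} → v ∈ τ → 0ℚ ℚ.< Ψ v x) → Simplex K τ
  Ψ-simplex x ¼≤ τ pos with escapes x ¼≤
  ... | i , side = cases side
    where
    point : Fin m → Vec ℕ m
    point v with 0ℚ ℚ.<? Ψ v x
    ... | yes lt = proj₁ (interp>0 (0≤at v) (Y x) lt)
    ... | no  _  = replicate m 0
    point-spec : ∀ {v} → v ∈ τ → Q (point v) ≡ v × (∀ u → Active (Y x u) (lookup (point v) u))
    point-spec {v} v∈ with 0ℚ ℚ.<? Ψ v x
    ... | no ¬p = ⊥-elim (¬p (pos v∈))
    ... | yes lt = let _ , 0<at , act = interp>0 (0≤at v) (Y x) lt in at>0 0<at , act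
    off-σ : ∀ {v u} → v ∈ τ → u ∉ σ → lookup (point v) u ≡ 0
    off-σ v∈ u∉ = active-≤0 (ℚ.≤-reflexive (Y-∉ x u∉)) (proj₂ (point-spec v∈) _)
    w = emb i
    cases : aff (x i) ℚ.≤ 0ℚ ⊎ ι N ℚ.≤ aff (x i) → Simplex K τ
    cases (inj₁ ≤0) = simplicial (down-closed K (p─q⊆p σ _) Kσ) (ℕ.≤-pred (subst (∣ σ ∖ w ∣ ℕ.<_) ∣σ∣ (x∈p⇒∣p-x∣<∣p∣ (emb-∈ i)))) τ point
      (λ {v} v∈ → (λ u → Active.≤N (proj₂ (point-spec v∈) u) , λ u∉ → zeros v∈ u u∉) , proj₁ (point-spec v∈))
      (λ u∈ v∈ a → active-close (proj₂ (point-spec u∈) a) (proj₂ (point-spec v∈) a) , active-close (proj₂ (point-spec v∈) a) (proj₂ (point-spec u∈) a))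
      where
      zeros : ∀ {v} → v ∈ τ → ∀ u → u ∉ σ ∖ w → lookup (point v) u ≡ 0
      zeros v∈ u u∉ with u Fin.≟ w
      ... | yes refl = active-≤0 (subst (ℚ._≤ 0ℚ) (sym (Y-emb x i)) ≤0) (proj₂ (point-spec v∈) w)
      ... | no  u≢w  = off-σ v∈ (λ u∈ → u∉ (x∈p∧x≢y⇒x∈p-y u∈ u≢w))
    cases (inj₂ ≥N) = down-closed K τ⊆σ Kσ
      where
      τ⊆σ : τ ⊆ σ
      τ⊆σ {v} v∈ with v ∈? σ
      ... | yes p = p
      ... | no v∉ = ⊥-elim (ℕ.<⇒≢ (base (point v) w (active-≥N (subst (ι N ℚ.≤_) (sym (Y-emb x i)) ≥N) (proj₂ (point-spec v∈) w)))
                      (sym (trans (cong (lookup (point v)) (proj₁ (point-spec v∈))) (off-σ v∈ v∉))))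

  -- `M` is only known to be nonnegative. Dividing by 1 + M is safe and makes the resulting estimate
  -- strict.
  1+M : ℚ
  1+M = 1ℚ ℚ.+ M

  0<1+M : 0ℚ ℚ.< 1+M
  0<1+M = 0<+ 0<1 0≤M

  M*ζ<ε : ∀ {ζ ε} → 0ℚ ℚ.< ζ → 1+M ℚ.* ζ ≡ ε → M ℚ.* ζ ℚ.< ε
  M*ζ<ε {ζ} 0<ζ e = <-excess ζ 0<ζ (trans (sym e) (eq M ζ))
    where
    eq : ∀ m z → (1ℚ ℚ.+ m) ℚ.* z ≡ m ℚ.* z ℚ.+ z
    eq = solve-∀ ℚ-ring

  -- The n-th approximation of the value is the value of `Ψ` at the n-th approximation of the point.
  -- Approximations of a unit vector need not be unit vectors, which is why `Ψ-simplex` asks only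
  -- for squared norm at least 1/4. Finitely many positivity witnesses hold at a common index.
  sphereMap : Sphere j → ∥ K ∥
  sphereMap (mkSphere x unit) = record { bary = b ; nonneg = λ v → pointwise-≤ᴿ (λ n → 0≤Ψ v (xₙ n)) ; total = total ; support = support }
    where
    xₙ : ℕ → Fin k → ℚ
    xₙ n i = seq (x i) n
    b : Fin m → ℝ
    b v = mkℝ (λ n → Ψ v (xₙ n)) λ ε 0<ε →
      let ζ , 0<ζ , e = quotient 0<1+M 0<ε
          n₀ , h = upper-bound (λ i → proj₁ (cauchy (x i) ζ 0<ζ))
      in n₀ , λ p q le le′ → ℚ.≤-<-trans (Ψ-Lipschitz v (xₙ p) (xₙ q) (ℚ.<⇒≤ 0<ζ)
           (λ i → ℚ.<⇒≤ (proj₂ (cauchy (x i) ζ 0<ζ) p q (ℕ.≤-trans (h i) le) (ℕ.≤-trans (h i) le′)))) (M*ζ<ε 0<ζ e)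
    total : sumᴿ b ≈ᴿ 1ᴿ
    total = pointwise-≤ᴿ (λ n → ℚ.≤-reflexive (trans (seq-sumᴿ b n) (Ψ-total (xₙ n)))) ,
            pointwise-≤ᴿ (λ n → ℚ.≤-reflexive (sym (trans (seq-sumᴿ b n) (Ψ-total (xₙ n)))))
    support : ∀ τ → (∀ {v} → v ∈ τ → 0ᴿ <ᴿ b v) → Simplex K τ
    support τ pos = Ψ-simplex (xₙ n₀) big τ λ {v} v∈ → pos-at v∈
      where
      norm : ∃[ n ] (∀ p → n ℕ.≤ p → 1ℚ ℚ.< seq (normSq x) p ℚ.+ ½)
      norm = _≤ᴿ_.holds (proj₂ unit) ½ 0<½
      start : Fin m → ℕ
      start v with v ∈? τ
      ... | yes v∈ = _<ᴿ_.from (pos v∈)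
      ... | no  _  = 0
      n₀ : ℕ
      n₀ = proj₁ (upper-bound start) ℕ.⊔ proj₁ norm
      pos-at : ∀ {v} → v ∈ τ → 0ℚ ℚ.< Ψ v (xₙ n₀)
      pos-at {v} v∈ with v ∈? τ | ℕ.≤-trans (proj₂ (upper-bound start) v) (ℕ.m≤m⊔n _ (proj₁ norm))
      ... | no v∉   | _  = ⊥-elim (v∉ v∈)
      ... | yes v∈′ | le = ℚ.<-trans (subst (0ℚ ℚ.<_) (sym (ℚ.+-identityˡ (_<ᴿ_.gap (pos v∈′)))) (_<ᴿ_.gap-pos (pos v∈′))) (_<ᴿ_.holds (pos v∈′) n₀ le)
      big : ½ ℚ.* ½ ℚ.≤ sqn (xₙ n₀)
      big = ℚ.≤-trans (≤-excess (½ ℚ.* ½) (0≤* 0≤½ 0≤½) refl) (≤-excess (a ℚ.+ ½ ℚ.- 1ℚ) (p≤q⇒0≤q-p (ℚ.<⇒≤ 1<)) (eq a))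
        where
        a = sqn (xₙ n₀)
        1< : 1ℚ ℚ.< a ℚ.+ ½
        1< = subst (λ z → 1ℚ ℚ.< z ℚ.+ ½) (seq-sumᴿ (λ i → x i *ᴿ x i) n₀) (proj₂ norm n₀ (ℕ.m≤n⊔m (proj₁ (upper-bound start)) (proj₁ norm)))
        eq : ∀ a → a ≡ ½ ℚ.+ (a ℚ.+ ½ ℚ.- 1ℚ)
        eq = solve-∀ ℚ-ring

  sphereMap-continuous : Continuous Sphere.coords bary sphereMap
  sphereMap-continuous ε 0<ε = ζ , 0<ζ , cont
    where
    half : 0ℚ ℚ.< ½ ℚ.* ε
    half = 0<* 0<½ 0<ε
    ζ : ℚ
    ζ = proj₁ (quotient 0<1+M half)
    0<ζ : 0ℚ ℚ.< ζ
    0<ζ = proj₁ (proj₂ (quotient 0<1+M half))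
    Mζ< : M ℚ.* ζ ℚ.< ½ ℚ.* ε
    Mζ< = M*ζ<ε 0<ζ (proj₂ (proj₂ (quotient 0<1+M half)))
    cont : ∀ x y → Within ζ (Sphere.coords x) (Sphere.coords y) → Within ε (bary (sphereMap x)) (bary (sphereMap y))
    cont x y within v = mk< (½ ℚ.* ε) half n₀ (λ n le → bound (Ψ v (xₙ n)) (Ψ v (yₙ n)) (diff n le)) ,
                        mk< (½ ℚ.* ε) half n₀ (λ n le → bound (Ψ v (yₙ n)) (Ψ v (xₙ n)) (subst (ℚ._≤ M ℚ.* ζ) (∣∣-sym (Ψ v (xₙ n)) (Ψ v (yₙ n))) (diff n le)))
      where
      xₙ yₙ : ℕ → Fin k → ℚ
      xₙ n i = seq (Sphere.coords x i) n
      yₙ n i = seq (Sphere.coords y i) n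
      n₁ = upper-bound (λ i → _<ᴿ_.from (proj₁ (within i)))
      n₂ = upper-bound (λ i → _<ᴿ_.from (proj₂ (within i)))
      n₀ : ℕ
      n₀ = proj₁ n₁ ℕ.⊔ proj₁ n₂
      drop-gap : ∀ {a g z} → 0ℚ ℚ.< g → a ℚ.+ g ℚ.< z → a ℚ.≤ z
      drop-gap {a} {g} 0<g lt = ℚ.<⇒≤ (ℚ.<-trans (<-excess g 0<g refl) lt)
      diff : ∀ n → n₀ ℕ.≤ n → ℚ.∣ Ψ v (xₙ n) ℚ.- Ψ v (yₙ n) ∣ ℚ.≤ M ℚ.* ζ
      diff n le = Ψ-Lipschitz v (xₙ n) (yₙ n) (ℚ.<⇒≤ 0<ζ) λ i → ∣∣≤
        (drop-gap (_<ᴿ_.gap-pos (proj₁ (within i))) (_<ᴿ_.holds (proj₁ (within i)) n (ℕ.≤-trans (proj₂ n₁ i) (ℕ.≤-trans (ℕ.m≤m⊔n _ _) le))))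
        (subst (ℚ._≤ ζ) (eq (xₙ n i) (yₙ n i))
          (drop-gap (_<ᴿ_.gap-pos (proj₂ (within i))) (_<ᴿ_.holds (proj₂ (within i)) n (ℕ.≤-trans (proj₂ n₂ i) (ℕ.≤-trans (ℕ.m≤n⊔m (proj₁ n₁) _) le)))))
        where
        eq : ∀ a b → b ℚ.- a ≡ ℚ.- (a ℚ.- b)
        eq = solve-∀ ℚ-ring
      bound : ∀ a b → ℚ.∣ a ℚ.- b ∣ ℚ.≤ M ℚ.* ζ → (a ℚ.- b) ℚ.+ ½ ℚ.* ε ℚ.< ε
      bound a b le = ℚ.<-≤-trans (ℚ.+-monoˡ-< (½ ℚ.* ε) (ℚ.≤-<-trans (ℚ.≤-trans (p≤∣p∣ (a ℚ.- b)) le) Mζ<)) (ℚ.≤-reflexive (eq ε))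
        where
        eq : ∀ e → ½ ℚ.* e ℚ.+ ½ ℚ.* e ≡ e
        eq = solve-∀ ℚ-ring

-- From an extension over the ball to a finer grid map

½^≤1 : ∀ m → ½^ m ℚ.≤ 1ℚ
½^≤1 zero    = ℚ.≤-refl
½^≤1 (suc m) = ℚ.≤-trans (*-mono 0≤½ 0≤1 (≤-excess ½ 0≤½ refl) (½^≤1 m)) (ℚ.≤-reflexive (ℚ.*-identityˡ 1ℚ))

ι*½^≤1 : ∀ m → ι m ℚ.* ½^ m ℚ.≤ 1ℚ
ι*½^≤1 zero    = 0≤1
ι*½^≤1 (suc m) = ℚ.≤-trans (ℚ.≤-reflexive (eq (ι m) (½^ m))) (*-monoˡ 0≤½ (ℚ.+-mono-≤ (½^≤1 m) (ι*½^≤1 m)))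
  where
  eq : ∀ i q → (1ℚ ℚ.+ i) ℚ.* (½ ℚ.* q) ≡ ½ ℚ.* (q ℚ.+ i ℚ.* q)
  eq = solve-∀ ℚ-ring

Eventually : (ℕ → Set) → Set
Eventually P = ∃[ n₀ ] (∀ n → n₀ ℕ.≤ n → P n)

eventually₂ : ∀ {P Q R : ℕ → Set} → (∀ {n} → P n → Q n → R n) → Eventually P → Eventually Q → Eventually R
eventually₂ f (a , p) (b , q) = a ℕ.⊔ b , λ n le → f (p n (ℕ.≤-trans (ℕ.m≤m⊔n a b) le)) (q n (ℕ.≤-trans (ℕ.m≤n⊔m a b) le))

eventually-map : ∀ {P Q : ℕ → Set} → (∀ {n} → P n → Q n) → Eventually P → Eventually Q
eventually-map f (a , p) = a , λ n le → f (p n le)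

-- The tolerance is chosen such that 5 m η < 1/2, so that every point of a
-- realization has a coordinate above 4 η, and such that 4 η ≤ 2⁻ᵐ, a lower
-- bound for the weight of the nearest grid point.
abstract
  η : ℕ → ℚ
  η m = ½^ (4 ℕ.+ m)

  0<η : ∀ m → 0ℚ ℚ.< η m
  0<η m = 0<½^ (4 ℕ.+ m)

  16η : ∀ m → η m ≡ (½ ℚ.* ½ ℚ.* (½ ℚ.* ½)) ℚ.* ½^ m
  16η m = eq (½^ m)
    where
    eq : ∀ p → ½ ℚ.* (½ ℚ.* (½ ℚ.* (½ ℚ.* p))) ≡ (½ ℚ.* ½ ℚ.* (½ ℚ.* ½)) ℚ.* p
    eq = solve-∀ ℚ-ring

0≤η : ∀ m → 0ℚ ℚ.≤ η m
0≤η m = ℚ.<⇒≤ (0<η m)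

4η : ℕ → ℚ
4η m = (η m ℚ.+ η m) ℚ.+ (η m ℚ.+ η m)

4η≤½^ : ∀ m → 4η m ℚ.≤ ½^ m
4η≤½^ m = ℚ.≤-trans (ℚ.≤-reflexive (trans (cong (λ e → (e ℚ.+ e) ℚ.+ (e ℚ.+ e)) (16η m)) (eq (½^ m))))
  (ℚ.≤-trans (*-monoʳ {a = ½^ m} {b = ½ ℚ.* ½} {c = 1ℚ} (ℚ.<⇒≤ (0<½^ m)) (ℚ.≤ᵇ⇒≤ _)) (ℚ.≤-reflexive (ℚ.*-identityˡ (½^ m))))
  where
  eq : ∀ p → ((½ ℚ.* ½ ℚ.* (½ ℚ.* ½)) ℚ.* p ℚ.+ (½ ℚ.* ½ ℚ.* (½ ℚ.* ½)) ℚ.* p) ℚ.+ ((½ ℚ.* ½ ℚ.* (½ ℚ.* ½)) ℚ.* p ℚ.+ (½ ℚ.* ½ ℚ.* (½ ℚ.* ½)) ℚ.* p) ≡ (½ ℚ.* ½) ℚ.* p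
  eq = solve-∀ ℚ-ring

-- The choice is made among rationals, at one index past all Cauchy moduli for η. There some
-- coordinate is at least 5η, since m times 5η is at most 5/16 and the sum exceeds 1/2; at later
-- indices at most η is lost.
heavy-vertex : ∀ {m} {K : Complex m} (P : ∥ K ∥) → ∃[ v ] Eventually (λ n → 4η m ℚ.≤ seq (bary P v) n)
heavy-vertex {m} P = answer
  where
  s : Fin m → ℕ → ℚ
  s v = seq (bary P v)
  cau : ∀ v → ∃[ n₀ ] (∀ p q → n₀ ℕ.≤ p → n₀ ℕ.≤ q → ℚ.∣ s v p ℚ.- s v q ∣ ℚ.< η m)
  cau v = cauchy (bary P v) (η m) (0<η m)
  tot : Eventually (λ n → 1ℚ ℚ.< seq (sumᴿ (bary P)) n ℚ.+ ½)
  tot = _≤ᴿ_.holds (proj₂ (∥_∥.total P)) ½ 0<½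
  ub = upper-bound (proj₁ ∘ cau)
  n₀ : ℕ
  n₀ = proj₁ ub ℕ.⊔ proj₁ tot
  5η : ℚ
  5η = 4η m ℚ.+ η m
  answer : ∃[ v ] Eventually (λ n → 4η m ℚ.≤ s v n)
  answer with Fin.any? (λ v → 5η ℚ.≤? s v n₀)
  ... | yes (v , le) = v , n₀ , λ n n₀≤n → ≤-excess ((s v n₀ ℚ.- 5η) ℚ.+ (η m ℚ.- (s v n₀ ℚ.- s v n)))
      (0≤+ (p≤q⇒0≤q-p le) (p≤q⇒0≤q-p (ℚ.≤-trans (p≤∣p∣ (s v n₀ ℚ.- s v n))
        (ℚ.<⇒≤ (proj₂ (cau v) n₀ n (bound v) (ℕ.≤-trans (bound v) n₀≤n))))))
      (eq (s v n₀) (s v n) (4η m) (η m))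
    where
    bound : ∀ v → proj₁ (cau v) ℕ.≤ n₀
    bound v = ℕ.≤-trans (proj₂ ub v) (ℕ.m≤m⊔n _ _)
    eq : ∀ a b f e → b ≡ f ℚ.+ ((a ℚ.- (f ℚ.+ e)) ℚ.+ (e ℚ.- (a ℚ.- b)))
    eq = solve-∀ ℚ-ring
  ... | no ¬p = ⊥-elim (ℚ.<-irrefl refl (ℚ.<-≤-trans (proj₂ tot n₀ (ℕ.m≤n⊔m (proj₁ ub) _)) (begin
      seq (sumᴿ (bary P)) n₀ ℚ.+ ½         ≡⟨ cong (ℚ._+ ½) (seq-sumᴿ (bary P) n₀) ⟩
      sum (λ v → s v n₀) ℚ.+ ½             ≤⟨ ℚ.+-monoˡ-≤ ½ (sum-≤ (λ v → ℚ.<⇒≤ (ℚ.≰⇒> (λ le → ¬p (v , le))))) ⟩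
      ι m ℚ.* 5η ℚ.+ ½                     ≡⟨ trans (eq (ι m) (η m)) (cong (λ e → ι m ℚ.* (ι 5 ℚ.* e) ℚ.+ ½) (16η m)) ⟩
      ι m ℚ.* (ι 5 ℚ.* (q ℚ.* ½^ m)) ℚ.+ ½ ≡⟨ eq′ (ι m) (½^ m) (ι 5) q ⟩
      (ι 5 ℚ.* q) ℚ.* (ι m ℚ.* ½^ m) ℚ.+ ½ ≤⟨ ℚ.+-monoˡ-≤ ½ (*-monoˡ {a = ι 5 ℚ.* q} (ℚ.≤ᵇ⇒≤ _) (ι*½^≤1 m)) ⟩
      (ι 5 ℚ.* q) ℚ.* 1ℚ ℚ.+ ½             ≤⟨ ℚ.≤ᵇ⇒≤ _ ⟩
      1ℚ                                   ∎)))
    where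
    open ℚ.≤-Reasoning
    q : ℚ
    q = ½ ℚ.* ½ ℚ.* (½ ℚ.* ½)
    eq : ∀ i e → i ℚ.* (((e ℚ.+ e) ℚ.+ (e ℚ.+ e)) ℚ.+ e) ℚ.+ ½ ≡ i ℚ.* (ι 5 ℚ.* e) ℚ.+ ½
    eq = solve-∀ ℚ-ring
    eq′ : ∀ i p f q → i ℚ.* (f ℚ.* (q ℚ.* p)) ℚ.+ ½ ≡ (f ℚ.* q) ℚ.* (i ℚ.* p) ℚ.+ ½
    eq′ = solve-∀ ℚ-ring

within-const : ∀ {k} {x y : Fin k → ℚ} {Δ δ′} → Δ ℚ.< δ′ → (∀ i → ℚ.∣ x i ℚ.- y i ∣ ℚ.≤ Δ) →
  Within δ′ (λ i → fromℚ (x i)) (λ i → fromℚ (y i))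
within-const {x = x} {y} {Δ} {δ′} Δ<δ′ le i =
  mk< gap 0<gap 0 (λ _ _ → bound (x i) (y i) (le i)) , mk< gap 0<gap 0 (λ _ _ → bound (y i) (x i) (subst (ℚ._≤ Δ) (∣∣-sym (x i) (y i)) (le i)))
  where
  gap : ℚ
  gap = ½ ℚ.* (δ′ ℚ.- Δ)
  0<gap : 0ℚ ℚ.< gap
  0<gap = 0<* 0<½ (p<q⇒0<q-p Δ<δ′)
  bound : ∀ a b → ℚ.∣ a ℚ.- b ∣ ℚ.≤ Δ → (a ℚ.- b) ℚ.+ gap ℚ.< δ′
  bound a b le = ℚ.≤-<-trans (ℚ.+-monoˡ-≤ gap (ℚ.≤-trans (p≤∣p∣ (a ℚ.- b)) le)) (<-excess gap 0<gap (eq δ′ Δ))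
    where
    eq : ∀ d h → d ≡ (h ℚ.+ ½ ℚ.* (d ℚ.- h)) ℚ.+ ½ ℚ.* (d ℚ.- h)
    eq = solve-∀ ℚ-ring

close-from-< : ∀ {a b g e} → 0ℚ ℚ.< g → (a ℚ.- b) ℚ.+ g ℚ.< e → a ℚ.≤ b ℚ.+ e
close-from-< {a} {b} {g} {e} 0<g lt = ≤-excess ((e ℚ.- ((a ℚ.- b) ℚ.+ g)) ℚ.+ g) (0≤+ (p≤q⇒0≤q-p (ℚ.<⇒≤ lt)) (ℚ.<⇒≤ 0<g)) (eq a b g e)
  where
  eq : ∀ a b g e → b ℚ.+ e ≡ a ℚ.+ ((e ℚ.- ((a ℚ.- b) ℚ.+ g)) ℚ.+ g)
  eq = solve-∀ ℚ-ring

∣∣⇒≤+ : ∀ {a b e} → ℚ.∣ a ℚ.- b ∣ ℚ.≤ e → a ℚ.≤ b ℚ.+ e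
∣∣⇒≤+ {a} {b} {e} le = ≤-excess (e ℚ.- (a ℚ.- b)) (p≤q⇒0≤q-p (ℚ.≤-trans (p≤∣p∣ (a ℚ.- b)) le)) (eq a b e)
  where
  eq : ∀ a b e → b ℚ.+ e ≡ a ℚ.+ (e ℚ.- (a ℚ.- b))
  eq = solve-∀ ℚ-ring

rationalBall : ∀ {k} (x : Fin k → ℚ) → sqn x ℚ.≤ 1ℚ → Ball k
rationalBall x le = mkBall (λ i → fromℚ (x i)) (pointwise-≤ᴿ (λ n → subst (ℚ._≤ 1ℚ) (sym (seq-sumᴿ (λ i → fromℚ (x i) *ᴿ fromℚ (x i)) n)) le))

rationalSphere : ∀ {j} (z : Fin (suc j) → ℚ) → sqn z ≡ 1ℚ → Sphere j
rationalSphere z e = mkSphere (λ i → fromℚ (z i))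
  (pointwise-≤ᴿ (λ n → ℚ.≤-reflexive (trans (seq-sumᴿ (λ i → fromℚ (z i) *ᴿ fromℚ (z i)) n) e)) ,
   pointwise-≤ᴿ (λ n → ℚ.≤-reflexive (sym (trans (seq-sumᴿ (λ i → fromℚ (z i) *ᴿ fromℚ (z i)) n) e))))

module Filling {m j} (K : Complex m) (L : ℕ) {Q : Vec ℕ m → Fin m} (G : GridMap K (L ℕ.+ L) j Q)
  {σ : Subset m} (Kσ : Simplex K σ) (∣σ∣ : ∣ σ ∣ ≡ suc j) 
  (F : Ball (suc j) → ∥ K ∥) (F-continuous : Continuous Ball.coords bary F)
  (F-extends : ∀ x v → bary (F (sphere⇒ball x)) v ≈ᴿ bary (Approximation.sphereMap K L G Kσ ∣σ∣ x) v) where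

  open Approximation K L G Kσ ∣σ∣
  open Stage L k (s≤s z≤n)
  open Enumeration (subst (Enumeration σ) ∣σ∣ (enumerate σ))

  modulus = F-continuous (η m) (0<η m)

  δF : ℚ
  δF = proj₁ modulus

  0<δF : 0ℚ ℚ.< δF
  0<δF = proj₁ (proj₂ modulus)

  ζ₁ : ∃[ ζ ] (0ℚ ℚ.< ζ × 1+M ℚ.* ζ ≡ η m)
  ζ₁ = quotient 0<1+M (0<η m)

  ζ : ℚ
  ζ = proj₁ ζ₁ ℚ.⊓ (½ ℚ.* δF)

  0<ζ : 0ℚ ℚ.< ζ
  0<ζ = 0<⊓ (proj₁ (proj₂ ζ₁)) (0<* 0<½ 0<δF)

  -- Neighboring grid points differ by at most h per coordinate. A detour through a point of the
  -- sphere costs up to 4kh + h, which is at most 5kh.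
  5k : ℚ
  5k = ι k ℚ.* ι 5

  fine : ∃[ q ] (0ℚ ℚ.< q × ζ ℚ.* q ≡ 5k)
  fine = quotient {B = ζ} {ε = 5k} 0<ζ (0<* {a = ι k} {b = ι 5} (0<ι {k} (s≤s z≤n)) (0<ι {5} (s≤s z≤n)))

  threshold : ℕ
  threshold = proj₁ (archimedean (proj₁ fine))

  module Finer (L′ : ℕ) (large : threshold ℕ.≤ L′) (h : ℚ) (0<h : 0ℚ ℚ.< h) (L′h : ι L′ ℚ.* h ≡ 1ℚ) where

    open Cubes (L′ ℕ.+ L′) using (Close; InCube)

    0≤h : 0ℚ ℚ.≤ h
    0≤h = ℚ.<⇒≤ 0<h

    Δ : ℚ
    Δ = 5k ℚ.* h

    Δ≤ζ : Δ ℚ.≤ ζ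
    Δ≤ζ = begin
      5k ℚ.* h                        ≡⟨ cong (ℚ._* h) (sym (proj₂ (proj₂ fine))) ⟩
      ζ ℚ.* proj₁ fine ℚ.* h          ≤⟨ *-monoʳ 0≤h (*-monoˡ (ℚ.<⇒≤ 0<ζ) (ℚ.≤-trans (proj₂ (archimedean (proj₁ fine))) (ι-mono large))) ⟩
      ζ ℚ.* ι L′ ℚ.* h                ≡⟨ trans (ℚ.*-assoc ζ (ι L′) h) (trans (cong (ζ ℚ.*_) L′h) (ℚ.*-identityʳ ζ)) ⟩
      ζ                               ∎
      where open ℚ.≤-Reasoning

    Δ<δF : Δ ℚ.< δF
    Δ<δF = ℚ.≤-<-trans (ℚ.≤-trans Δ≤ζ (ℚ.p⊓q≤q (proj₁ ζ₁) (½ ℚ.* δF))) (<-excess (½ ℚ.* δF) (0<* 0<½ 0<δF) (eq δF))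
      where
      eq : ∀ e → e ≡ ½ ℚ.* e ℚ.+ ½ ℚ.* e
      eq = solve-∀ ℚ-ring

    MΔ≤η : M ℚ.* Δ ℚ.≤ η m
    MΔ≤η = ℚ.≤-trans (*-monoˡ 0≤M (ℚ.≤-trans Δ≤ζ (ℚ.p⊓q≤p (proj₁ ζ₁) (½ ℚ.* δF)))) (ℚ.<⇒≤ (M*ζ<ε (proj₁ (proj₂ ζ₁)) (proj₂ (proj₂ ζ₁))))

    1≤ιk : 1ℚ ℚ.≤ ι k
    1≤ιk = ι-mono {1} {k} (s≤s z≤n)

    4kh≤Δ : ι k ℚ.* (h ℚ.+ h) ℚ.+ ι k ℚ.* (h ℚ.+ h) ℚ.≤ Δ
    4kh≤Δ = ≤-excess (ι k ℚ.* h) (0≤* (0≤ι k) 0≤h) (eq (ι k) h)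
      where
      eq : ∀ k h → k ℚ.* ι 5 ℚ.* h ≡ (k ℚ.* (h ℚ.+ h) ℚ.+ k ℚ.* (h ℚ.+ h)) ℚ.+ k ℚ.* h
      eq = solve-∀ ℚ-ring

    4kh+h≤Δ : (ι k ℚ.* (h ℚ.+ h) ℚ.+ ι k ℚ.* (h ℚ.+ h)) ℚ.+ h ℚ.≤ Δ
    4kh+h≤Δ = ≤-excess ((ι k ℚ.- 1ℚ) ℚ.* h) (0≤* (p≤q⇒0≤q-p 1≤ιk) 0≤h) (eq (ι k) h)
      where
      eq : ∀ k h → k ℚ.* ι 5 ℚ.* h ≡ ((k ℚ.* (h ℚ.+ h) ℚ.+ k ℚ.* (h ℚ.+ h)) ℚ.+ h) ℚ.+ (k ℚ.- 1ℚ) ℚ.* h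
      eq = solve-∀ ℚ-ring

    h≤Δ : h ℚ.≤ Δ
    h≤Δ = ℚ.≤-trans (≤-excess (ι k ℚ.* (h ℚ.+ h) ℚ.+ ι k ℚ.* (h ℚ.+ h)) (0≤+ p p) (ℚ.+-comm (ι k ℚ.* (h ℚ.+ h) ℚ.+ ι k ℚ.* (h ℚ.+ h)) h)) 4kh+h≤Δ
      where
      p : 0ℚ ℚ.≤ ι k ℚ.* (h ℚ.+ h)
      p = 0≤* (0≤ι k) (0≤+ 0≤h 0≤h)

    Unit : (Fin k → ℚ) → Set
    Unit x = ∀ i → ℚ.∣ x i ∣ ℚ.≤ 1ℚ

    -- One η each for moving `F` to a point of the sphere, for comparing `F` with the given map
    -- there, and for moving `Ψ` away from it.
    3η : ℚ
    3η = η m ℚ.+ η m ℚ.+ η m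

    F-near : ∀ (b b′ : Ball k) {x y : Fin k → ℚ} → Ball.coords b ≡ (λ i → fromℚ (x i)) → Ball.coords b′ ≡ (λ i → fromℚ (y i)) →
      (∀ i → ℚ.∣ x i ℚ.- y i ∣ ℚ.≤ Δ) → ∀ v → Eventually (λ n → seq (bary (F b) v) n ℚ.≤ seq (bary (F b′) v) n ℚ.+ η m)
    F-near b b′ {x} {y} refl refl le v = _<ᴿ_.from gap , λ n n₀≤n → close-from-< (_<ᴿ_.gap-pos gap) (_<ᴿ_.holds gap n n₀≤n)
      where
      gap : bary (F b) v -ᴿ bary (F b′) v <ᴿ fromℚ (η m)
      gap = proj₁ (proj₂ (proj₂ modulus) b b′ (within-const {x = x} {y} Δ<δF le) v)

    inside? : ∀ (x : Fin k → ℚ) → Dec (sqn x ℚ.< 1ℚ)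
    inside? x = sqn x ℚ.<? 1ℚ

    ballAt : ∀ x → sqn x ℚ.< 1ℚ → Ball k
    ballAt x lt = rationalBall x (ℚ.<⇒≤ lt)

    -- The finer grid fills the cube [-1,1]^k around the ball. Outside the open ball `Ψ` replaces
    -- `F`: it is defined everywhere, and its supports are still simplices there. The case
    -- distinction is a comparison of rationals.
    val : ∀ x → Dec (sqn x ℚ.< 1ℚ) → Fin m → ℕ → ℚ
    val x (yes lt) v n = seq (bary (F (ballAt x lt)) v) n
    val x (no _)   v n = Ψ v x

    -- Between an inside and an outside point there is a rational point of
    -- the sphere, where F agrees with the given map.
    cross : ∀ x y (lt : sqn x ℚ.< 1ℚ) → ¬ sqn y ℚ.< 1ℚ → Unit x → Unit y → (∀ i → ℚ.∣ y i ℚ.- x i ∣ ℚ.≤ h) → ∀ v →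
      Eventually (λ n → seq (bary (F (ballAt x lt)) v) n ℚ.≤ Ψ v y ℚ.+ 3η) ×
      Eventually (λ n → Ψ v y ℚ.≤ seq (bary (F (ballAt x lt)) v) n ℚ.+ 3η)
    cross x y lt ≮ ux uy near v =
      eventually₂ (λ p q → ℚ.≤-trans p (ℚ.≤-trans (ℚ.+-monoˡ-≤ (η m) (ℚ.<⇒≤ q)) (le₁ (∣∣⇒≤+ {Ψ v z} {Ψ v y} Ψ-zy))))
        (F-near (ballAt x lt) zb refl refl (λ i → subst (ℚ._≤ Δ) (∣∣-sym (z i) (x i)) (zx i)) v)
        (_≤ᴿ_.holds (proj₁ (F-extends zs v)) (η m) (0<η m)) ,
      eventually₂ (λ {n} p q → le₂ {seq (bary (F (ballAt x lt)) v) n} (∣∣⇒≤+ {Ψ v y} {Ψ v z} (subst (ℚ._≤ η m) (∣∣-sym (Ψ v z) (Ψ v y)) Ψ-zy)) (ℚ.≤-trans (ℚ.<⇒≤ q) (ℚ.+-monoˡ-≤ (η m) p)))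
        (F-near zb (ballAt x lt) refl refl zx v)
        (_≤ᴿ_.holds (proj₂ (F-extends zs v)) (η m) (0<η m))
      where
      sp = sphere-point x (ℚ.<⇒≤ lt) ux
      z : Fin k → ℚ
      z = proj₁ sp
      zs : Sphere j
      zs = rationalSphere z (proj₁ (proj₂ sp))
      zb : Ball k
      zb = sphere⇒ball zs
      -- `y` is outside the open ball and within h of `x`, so the squared norm of `x` falls short of
      -- 1 by at most 2kh.
      defect : 1ℚ ℚ.- sqn x ℚ.≤ ι k ℚ.* (h ℚ.+ h)
      defect = ≤-excess ((sqn x ℚ.+ ι k ℚ.* (h ℚ.+ h)) ℚ.- 1ℚ)
        (p≤q⇒0≤q-p (ℚ.≤-trans (ℚ.≮⇒≥ ≮) (sqn-near y x uy ux near))) (eq (sqn x) (ι k ℚ.* (h ℚ.+ h)))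
        where
        eq : ∀ s w → w ≡ (1ℚ ℚ.- s) ℚ.+ ((s ℚ.+ w) ℚ.- 1ℚ)
        eq = solve-∀ ℚ-ring
      zx₀ : ∀ i → ℚ.∣ z i ℚ.- x i ∣ ℚ.≤ ι k ℚ.* (h ℚ.+ h) ℚ.+ ι k ℚ.* (h ℚ.+ h)
      zx₀ i = ℚ.≤-trans (proj₂ (proj₂ sp) i) (ℚ.+-mono-≤ defect defect)
      zx : ∀ i → ℚ.∣ z i ℚ.- x i ∣ ℚ.≤ Δ
      zx i = ℚ.≤-trans (zx₀ i) 4kh≤Δ
      zy : ∀ i → ℚ.∣ z i ℚ.- y i ∣ ℚ.≤ Δ
      zy i = ℚ.≤-trans (subst (λ a → ℚ.∣ a ∣ ℚ.≤ ℚ.∣ z i ℚ.- x i ∣ ℚ.+ ℚ.∣ x i ℚ.- y i ∣) (eq (z i) (x i) (y i)) (ℚ.∣p+q∣≤∣p∣+∣q∣ (z i ℚ.- x i) (x i ℚ.- y i)))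
        (ℚ.≤-trans (ℚ.+-mono-≤ (zx₀ i) (subst (ℚ._≤ h) (∣∣-sym (y i) (x i)) (near i))) 4kh+h≤Δ)
        where
        eq : ∀ a b c → (a ℚ.- b) ℚ.+ (b ℚ.- c) ≡ a ℚ.- c
        eq = solve-∀ ℚ-ring
      Ψ-zy : ℚ.∣ Ψ v z ℚ.- Ψ v y ∣ ℚ.≤ η m
      Ψ-zy = ℚ.≤-trans (Ψ-Lipschitz v z y (ℚ.≤-trans 0≤h h≤Δ) zy) MΔ≤η
      le₁ : Ψ v z ℚ.≤ Ψ v y ℚ.+ η m → Ψ v z ℚ.+ η m ℚ.+ η m ℚ.≤ Ψ v y ℚ.+ 3η
      le₁ le = ℚ.≤-trans (ℚ.+-monoˡ-≤ (η m) (ℚ.+-monoˡ-≤ (η m) le)) (ℚ.≤-reflexive (eq (Ψ v y) (η m)))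
        where
        eq : ∀ a e → a ℚ.+ e ℚ.+ e ℚ.+ e ≡ a ℚ.+ (e ℚ.+ e ℚ.+ e)
        eq = solve-∀ ℚ-ring
      le₂ : ∀ {b} → Ψ v y ℚ.≤ Ψ v z ℚ.+ η m → Ψ v z ℚ.≤ (b ℚ.+ η m) ℚ.+ η m → Ψ v y ℚ.≤ b ℚ.+ 3η
      le₂ {b} p q = ℚ.≤-trans p (ℚ.≤-trans (ℚ.+-monoˡ-≤ (η m) q) (ℚ.≤-reflexive (eq b (η m))))
        where
        eq : ∀ a e → a ℚ.+ e ℚ.+ e ℚ.+ e ≡ a ℚ.+ (e ℚ.+ e ℚ.+ e)
        eq = solve-∀ ℚ-ring

    η≤3η : η m ℚ.≤ 3η
    η≤3η = ≤-excess (η m ℚ.+ η m) (0≤+ (0≤η m) (0≤η m)) (ℚ.+-assoc (η m) (η m) (η m))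

    val-near : ∀ x y (dx : Dec (sqn x ℚ.< 1ℚ)) (dy : Dec (sqn y ℚ.< 1ℚ)) → Unit x → Unit y → (∀ i → ℚ.∣ x i ℚ.- y i ∣ ℚ.≤ h) →
      ∀ v → Eventually (λ n → val x dx v n ℚ.≤ val y dy v n ℚ.+ 3η)
    val-near x y (yes p) (yes q) ux uy near v = eventually-map (λ {n} le → ℚ.≤-trans le (ℚ.+-monoʳ-≤ (seq (bary (F (ballAt y q)) v) n) η≤3η))
      (F-near (ballAt x p) (ballAt y q) refl refl (λ i → ℚ.≤-trans (near i) h≤Δ) v)
    val-near x y (no ¬p) (no ¬q) ux uy near v = 0 , λ n _ → ℚ.≤-trans
      (∣∣⇒≤+ {Ψ v x} {Ψ v y} (ℚ.≤-trans (Ψ-Lipschitz v x y (ℚ.≤-trans 0≤h h≤Δ) (λ i → ℚ.≤-trans (near i) h≤Δ)) MΔ≤η)) (ℚ.+-monoʳ-≤ (Ψ v y) η≤3η)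
    val-near x y (yes p) (no ¬q) ux uy near v = proj₁ (cross x y p ¬q ux uy (λ i → subst (ℚ._≤ h) (∣∣-sym (x i) (y i)) (near i)) v)
    val-near x y (no ¬p) (yes q) ux uy near v = proj₂ (cross y x q ¬p uy ux near v)

    X : Vec ℕ m → Fin k → ℚ
    X t i = h ℚ.* ι (lookup t (emb i)) ℚ.- 1ℚ

    retract : Vec ℕ m → Vec ℕ m
    retract = Vec.map (reduce h)

    choose : ∀ t → Dec (sqn (X t) ℚ.< 1ℚ) → Fin m
    choose t (yes lt) = proj₁ (heavy-vertex (F (ballAt (X t) lt)))
    choose t (no _)   = Q (retract t)

    pick : Vec ℕ m → Fin m
    pick t = choose t (inside? (X t))

    X-0 : ∀ t i → lookup t (emb i) ≡ 0 → X t i ≡ ℚ.- 1ℚ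
    X-0 t i e = trans (cong (λ a → h ℚ.* ι a ℚ.- 1ℚ) e) (eq h)
      where
      eq : ∀ h → h ℚ.* 0ℚ ℚ.- 1ℚ ≡ ℚ.- 1ℚ
      eq = solve-∀ ℚ-ring

    X-N : ∀ t i → lookup t (emb i) ≡ L′ ℕ.+ L′ → X t i ≡ 1ℚ
    X-N t i e = trans (cong (λ a → h ℚ.* ι a ℚ.- 1ℚ) e) (cong (ℚ._- 1ℚ) (h*2l≡2 L′ L′h))

    X-unit : ∀ t → InCube σ t → Unit (X t)
    X-unit t t∈ i = ∣∣≤
      (subst (X t i ℚ.≤_) (cong (ℚ._- 1ℚ) (h*2l≡2 L′ L′h)) (ℚ.+-monoˡ-≤ (ℚ.- 1ℚ) (*-monoˡ 0≤h (ι-mono (proj₁ (t∈ (emb i)))))))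
      (≤-excess (h ℚ.* ι a) (0≤* 0≤h (0≤ι a)) (eq (h ℚ.* ι a)))
      where
      a = lookup t (emb i)
      eq : ∀ p → 1ℚ ≡ ℚ.- (p ℚ.- 1ℚ) ℚ.+ p
      eq = solve-∀ ℚ-ring

    ι-step : ∀ {a b} → a ℕ.≤ suc b → h ℚ.* ι a ℚ.≤ h ℚ.+ h ℚ.* ι b
    ι-step {a} {b} le = ℚ.≤-trans (*-monoˡ 0≤h (ι-mono le)) (ℚ.≤-reflexive (eq h (ι b)))
      where
      eq : ∀ h b → h ℚ.* (1ℚ ℚ.+ b) ≡ h ℚ.+ h ℚ.* b
      eq = solve-∀ ℚ-ring

    X-near : ∀ t u → Close t u → ∀ i → ℚ.∣ X t i ℚ.- X u i ∣ ℚ.≤ h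
    X-near t u cl i = ∣∣≤
      (≤-excess ((h ℚ.+ q) ℚ.- p) (p≤q⇒0≤q-p (ι-step (proj₁ (cl (emb i))))) (eq₁ h p q))
      (≤-excess ((h ℚ.+ p) ℚ.- q) (p≤q⇒0≤q-p (ι-step (proj₂ (cl (emb i))))) (eq₂ h p q))
      where
      p = h ℚ.* ι (lookup t (emb i))
      q = h ℚ.* ι (lookup u (emb i))
      eq₁ : ∀ h p q → h ≡ ((p ℚ.- 1ℚ) ℚ.- (q ℚ.- 1ℚ)) ℚ.+ ((h ℚ.+ q) ℚ.- p)
      eq₁ = solve-∀ ℚ-ring
      eq₂ : ∀ h p q → h ≡ ℚ.- ((p ℚ.- 1ℚ) ℚ.- (q ℚ.- 1ℚ)) ℚ.+ ((h ℚ.+ p) ℚ.- q)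
      eq₂ = solve-∀ ℚ-ring

    -- A coordinate 0 or 2L′ puts the point on the boundary of [-1,1]^k, outside the open ball. So
    -- the choices made for different `σ` agree on common faces and are the old labels on the base.
    pick-boundary : ∀ t {v} → v ∈ σ → lookup t v ≡ 0 ⊎ lookup t v ≡ L′ ℕ.+ L′ → pick t ≡ Q (retract t)
    pick-boundary t v∈ end = outer (inside? (X t))
      where
      far : ∀ {v} → ∃[ i ] (idx v ≡ just i × emb i ≡ v) → lookup t v ≡ 0 ⊎ lookup t v ≡ L′ ℕ.+ L′ → 1ℚ ℚ.≤ sqn (X t)
      far (i , _ , refl) (inj₁ e) = sqn-unit-coordinate (X t) i (cong (λ a → a ℚ.* a) (X-0 t i e))
      far (i , _ , refl) (inj₂ e) = sqn-unit-coordinate (X t) i (cong (λ a → a ℚ.* a) (X-N t i e))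
      outer : ∀ d → choose t d ≡ Q (retract t)
      outer (no _)   = refl
      outer (yes lt) = ⊥-elim (ℚ.<-irrefl refl (ℚ.<-≤-trans lt (far (idx-∈ v∈) end)))

    -- Inside, this is the choice of a heavy vertex. Outside, the retracted point is the grid point
    -- nearest to `Y (X t)`, so its label has weight at least 2⁻ᵐ.
    pick-heavy : ∀ t → InCube σ t → ∀ d → Eventually (λ n → 4η m ℚ.≤ val (X t) d (choose t d) n)
    pick-heavy t t∈ (yes lt) = proj₂ (heavy-vertex (F (ballAt (X t) lt)))
    pick-heavy t t∈ (no _) = 0 , λ _ _ → ℚ.≤-trans (4η≤½^ m)
      (interp-nearest (0≤at (Q (retract t))) (Y (X t)) (retract t) coordinates (at-Q (retract t)))
      where
      coordinates : ∀ v → lookup (retract t) v ≡ nearest (Y (X t) v)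
      coordinates v = trans (Vec.lookup-map v _ t) (cases (v ∈? σ))
        where
        cases : Dec (v ∈ σ) → reduce h (lookup t v) ≡ nearest (Y (X t) v)
        cases (yes v∈) = let i , e , Y≡ = Y-∈ (X t) v∈ in
          trans (cong (λ u → reduce h (lookup t u)) (sym e)) (cong nearest (sym Y≡))
        cases (no v∉)  = trans (cong (reduce h) (proj₂ (t∈ v) v∉))
          (trans (reduce-0 h) (sym (trans (cong nearest (Y-∉ (X t) v∉)) (nearest-≤0 ℚ.≤-refl))))

    module _ (τ : Subset m) (p : Fin m → Vec ℕ m) (spec : ∀ {v} → v ∈ τ → InCube σ (p v) × pick (p v) ≡ v)
      (close : ∀ {u v} → u ∈ τ → v ∈ τ → Close (p u) (p v)) where

      -- The label `v` has value at least 4η at its own point, and passing to the close point `p u`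
      -- loses at most 3η. So all of `τ` is positive at a single point, whose support consists of
      -- simplices.
      heavy-at : ∀ {u v} → u ∈ τ → v ∈ τ → ∀ d → Eventually (λ n → η m ℚ.≤ val (X (p u)) d v n)
      heavy-at {u} {v} u∈ v∈ d = eventually₂ (λ {n} a b → le (val (X (p u)) d v n) a b)
        (subst (λ w → Eventually (λ n → 4η m ℚ.≤ val (X (p v)) (inside? (X (p v))) w n)) (proj₂ (spec v∈))
          (pick-heavy (p v) (proj₁ (spec v∈)) (inside? (X (p v)))))
        (val-near (X (p v)) (X (p u)) (inside? (X (p v))) d (X-unit (p v) (proj₁ (spec v∈))) (X-unit (p u) (proj₁ (spec u∈)))
          (X-near (p v) (p u) (close v∈ u∈)) v)
        where
        le : ∀ {a} b → 4η m ℚ.≤ a → a ℚ.≤ b ℚ.+ 3η → η m ℚ.≤ b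
        le b p q = ≤-excess ((b ℚ.+ 3η) ℚ.- 4η m) (p≤q⇒0≤q-p (ℚ.≤-trans p q)) (eq b (η m))
          where
          eq : ∀ b e → b ≡ e ℚ.+ ((b ℚ.+ (e ℚ.+ e ℚ.+ e)) ℚ.- ((e ℚ.+ e) ℚ.+ (e ℚ.+ e)))
          eq = solve-∀ ℚ-ring

      heavy-simplex : ∀ x d → (∀ {v} → v ∈ τ → Eventually (λ n → η m ℚ.≤ val x d v n)) → Simplex K τ
      heavy-simplex x (yes lt) heavy = ∥_∥.support (F (ballAt x lt)) τ λ v∈ →
        mk< (½ ℚ.* η m) (0<* 0<½ (0<η m)) (proj₁ (heavy v∈))
          (λ n le → ℚ.<-≤-trans (<-excess (½ ℚ.* η m) (0<* 0<½ (0<η m)) (eq (η m))) (proj₂ (heavy v∈) n le))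
        where
        eq : ∀ e → e ≡ (0ℚ ℚ.+ ½ ℚ.* e) ℚ.+ ½ ℚ.* e
        eq = solve-∀ ℚ-ring
      heavy-simplex x (no ≮) heavy = Ψ-simplex x (ℚ.≤-trans {j = 1ℚ} (ℚ.≤ᵇ⇒≤ _) (ℚ.≮⇒≥ ≮)) τ λ v∈ →
        ℚ.<-≤-trans (0<η m) (proj₂ (heavy v∈) (proj₁ (heavy v∈)) ℕ.≤-refl)

      pick-simplex : Simplex K τ
      pick-simplex = cases (nonempty? τ)
        where
        cases : Dec (Nonempty τ) → Simplex K τ
        cases (no empty)     = subst (Simplex K) (sym (Empty-unique empty)) (∅-simplex K)
        cases (yes (u , u∈)) = heavy-simplex (X (p u)) (inside? (X (p u))) (λ v∈ → heavy-at u∈ v∈ (inside? (X (p u))))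

-- Connectivity implies acyclicity

maximum : ∀ {m} → (Subset m → ℕ) → ℕ
maximum {zero}  f = f []
maximum {suc m} f = maximum (f ∘ (inside ∷_)) ℕ.⊔ maximum (f ∘ (outside ∷_))

≤-maximum : ∀ {m} (f : Subset m → ℕ) σ → f σ ℕ.≤ maximum f
≤-maximum f []            = ℕ.≤-refl
≤-maximum f (inside ∷ σ)  = ℕ.≤-trans (≤-maximum (f ∘ (inside ∷_)) σ) (ℕ.m≤m⊔n _ _)
≤-maximum f (outside ∷ σ) = ℕ.≤-trans (≤-maximum (f ∘ (outside ∷_)) σ) (ℕ.m≤n⊔m (maximum (f ∘ (inside ∷_))) _)

side : ℕ → Side
side zero    = outside
side (suc _) = inside

supp : ∀ {m} → Vec ℕ m → Subset m
supp = Vec.map side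

∈-supp : ∀ {m} (t : Vec ℕ m) {v} → 0 ℕ.< lookup t v → v ∈ supp t
∈-supp (suc a ∷ t) {zero}  _  = here
∈-supp (a ∷ t)     {suc v} lt = there (∈-supp t lt)

∉-supp : ∀ {m} (t : Vec ℕ m) {v} → v ∉ supp t → lookup t v ≡ 0
∉-supp (zero ∷ t)  {zero}  _  = refl
∉-supp (suc a ∷ t) {zero}  v∉ = ⊥-elim (v∉ here)
∉-supp (a ∷ t)     {suc v} v∉ = ∉-supp t (v∉ ∘ there)

supp-⊆ : ∀ {m} (t : Vec ℕ m) {σ} → (∀ v → v ∉ σ → lookup t v ≡ 0) → supp t ⊆ σ
supp-⊆ t {σ} h {v} v∈ with v ∈? σ
... | yes p = p
... | no v∉ = ⊥-elim (absurd t v∈ (h v v∉))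
  where
  absurd : ∀ {m} (t : Vec ℕ m) {v} → v ∈ supp t → lookup t v ≢ 0
  absurd (suc a ∷ t) here      ()
  absurd (a ∷ t)     (there v) e = absurd t v e

⊆-strict : ∀ {m} {p q : Subset m} → p ⊆ q → ∣ p ∣ ≢ ∣ q ∣ → ∃[ v ] (v ∈ q × v ∉ p)
⊆-strict {p = p} {q} p⊆q ne with Fin.any? (λ v → (v ∈? q) ×-dec ¬? (v ∈? p))
... | yes (v , v∈ , v∉) = v , v∈ , v∉
... | no ¬∃ = ⊥-elim (ne (ℕ.≤-antisym (p⊆q⇒∣p∣≤∣q∣ p⊆q) (p⊆q⇒∣p∣≤∣q∣ q⊆p)))
  where
  q⊆p : q ⊆ p
  q⊆p {v} v∈ with v ∈? p
  ... | yes v∈p = v∈p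
  ... | no v∉   = ⊥-elim (¬∃ (v , v∈ , v∉))

module Step {m j} (K : Complex m) {L} (0<L : 0 ℕ.< L) {Q : Vec ℕ m → Fin m} (G : GridMap K (L ℕ.+ L) j Q)
  (ext : SphereMapsExtend K j) where

  open Stage L (suc j) (s≤s z≤n)

  Top : Subset m → Set
  Top σ = Simplex K σ × ∣ σ ∣ ≡ suc j

  top? : ∀ σ → Dec (Top σ)
  top? σ = simplex? K σ ×-dec (∣ σ ∣ ℕ.≟ suc j)

  module Filled {σ} (T : Top σ) where
    open Approximation K L G (proj₁ T) (proj₂ T) using (sphereMap; sphereMap-continuous)
    filled : Σ[ F ∈ (Ball (suc j) → ∥ K ∥) ] (Continuous Ball.coords bary F ×
      (∀ x v → bary (F (sphere⇒ball x)) v ≈ᴿ bary (sphereMap x) v))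
    filled = ext sphereMap sphereMap-continuous
    open Filling K L G (proj₁ T) (proj₂ T) (proj₁ filled) (proj₁ (proj₂ filled)) (proj₂ (proj₂ filled)) public

  bound : ∀ σ → Dec (Top σ) → ℕ
  bound σ (yes T) = Filled.threshold T
  bound σ (no _)  = 0

  -- One grid has to serve all `σ`, hence the maximum of the thresholds. The bound L c makes one
  -- fine step, magnified by `aff`, at most one coarse step, so that `retract` preserves closeness.
  L′ : ℕ
  L′ = maximum (λ σ → bound σ (top? σ)) ℕ.⊔ (L ℕ.* c)

  0<L′ : 0 ℕ.< L′
  0<L′ = ℕ.≤-trans (ℕ.*-mono-≤ 0<L (ℕ.≤-trans (s≤s z≤n) (ℕ.m≤m+n (suc j) _))) (ℕ.m≤n⊔m (maximum (λ σ → bound σ (top? σ))) (L ℕ.* c))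

  h-data : ∃[ h ] (0ℚ ℚ.< h × ι L′ ℚ.* h ≡ 1ℚ)
  h-data = quotient (0<ι 0<L′) 0<1

  h : ℚ
  h = proj₁ h-data

  0≤h : 0ℚ ℚ.≤ h
  0≤h = ℚ.<⇒≤ (proj₁ (proj₂ h-data))

  L′h : ι L′ ℚ.* h ≡ 1ℚ
  L′h = proj₂ (proj₂ h-data)

  retract : Vec ℕ m → Vec ℕ m
  retract = Vec.map (reduce h)

  reduce-N : reduce h (L′ ℕ.+ L′) ≡ N
  reduce-N = nearest-≥N (aff-≥N {h ℚ.* ι (L′ ℕ.+ L′) ℚ.- 1ℚ} (subst (1ℚ ℚ.≤_) (sym (trans (cong (λ z → ι c ℚ.* z) one) (ℚ.*-identityʳ (ι c)))) 1≤c))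
    where
    one : h ℚ.* ι (L′ ℕ.+ L′) ℚ.- 1ℚ ≡ 1ℚ
    one = cong (ℚ._- 1ℚ) (h*2l≡2 L′ L′h)

  Lch≤1 : ι L ℚ.* ι c ℚ.* h ℚ.≤ 1ℚ
  Lch≤1 = subst₂ ℚ._≤_ (cong (ℚ._* h) (ι-* L c)) L′h (*-monoʳ 0≤h (ι-mono (ℕ.m≤n⊔m (maximum (λ σ → bound σ (top? σ))) (L ℕ.* c))))

  reduce-close : ∀ {a b} → a ℕ.≤ suc b → reduce h a ℕ.≤ suc (reduce h b)
  reduce-close {a} {b} le = nearest-close (≤-excess
    ((1ℚ ℚ.- ι L ℚ.* ι c ℚ.* h) ℚ.+ ι L ℚ.* ι c ℚ.* (h ℚ.* ι (suc b) ℚ.- h ℚ.* ι a))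
    (0≤+ (p≤q⇒0≤q-p Lch≤1) (0≤* (0≤* (0≤ι L) (0≤ι c)) (p≤q⇒0≤q-p (*-monoˡ 0≤h (ι-mono le)))))
    (eq (ι L) (ι c) h (ι a) (ι b)))
    where
    eq : ∀ l c h a b → (l ℚ.+ l ℚ.* (c ℚ.* (h ℚ.* b ℚ.- 1ℚ))) ℚ.+ 1ℚ
      ≡ (l ℚ.+ l ℚ.* (c ℚ.* (h ℚ.* a ℚ.- 1ℚ))) ℚ.+ ((1ℚ ℚ.- l ℚ.* c ℚ.* h) ℚ.+ l ℚ.* c ℚ.* (h ℚ.* (1ℚ ℚ.+ b) ℚ.- h ℚ.* a))
    eq = solve-∀ ℚ-ring

  pickAt : ∀ σ (d : Dec (Top σ)) → bound σ d ℕ.≤ L′ → Vec ℕ m → Fin m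
  pickAt σ (yes T) le = Filled.Finer.pick T L′ le h (proj₁ (proj₂ h-data)) L′h
  pickAt σ (no _)  _  = Q ∘ retract

  bound≤ : ∀ σ → bound σ (top? σ) ℕ.≤ L′
  bound≤ σ = ℕ.≤-trans (≤-maximum (λ σ → bound σ (top? σ)) σ) (ℕ.m≤m⊔n _ (L ℕ.* c))

  fillAt : Subset m → Vec ℕ m → Fin m
  fillAt σ = pickAt σ (top? σ) (bound≤ σ)

  -- The support of `t` is the smallest set whose cube can contain `t`, so it selects the filling
  -- without reference to an ambient simplex.
  Q′ : Vec ℕ m → Fin m
  Q′ t = fillAt (supp t) t

  open Cubes (L′ ℕ.+ L′) using (InCube; Close)
  open GridMap G

  pickAt-low : ∀ σ d le t → ∣ σ ∣ ≢ suc j → pickAt σ d le t ≡ Q (retract t)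
  pickAt-low σ (yes (_ , e)) le t ne = ⊥-elim (ne e)
  pickAt-low σ (no _)        le t ne = refl

  pickAt-boundary : ∀ σ d le t {v} → v ∈ σ → lookup t v ≡ 0 ⊎ lookup t v ≡ L′ ℕ.+ L′ → pickAt σ d le t ≡ Q (retract t)
  pickAt-boundary σ (yes T) le t v∈ end = Filled.Finer.pick-boundary T L′ le h (proj₁ (proj₂ h-data)) L′h t v∈ end
  pickAt-boundary σ (no _)  le t v∈ end = refl

  -- If the support is smaller than `σ`, some coordinate of `σ` vanishes at `t`. By
  -- `pickAt-boundary` the filling over `σ` is then the retracted old labeling, which `Q′` uses on
  -- small supports.
  Q′≡fillAt : ∀ {σ} t → ∣ σ ∣ ≡ suc j → InCube σ t → Q′ t ≡ fillAt σ t
  Q′≡fillAt {σ} t ∣σ∣ t∈ = cases (∣ supp t ∣ ℕ.≟ suc j)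
    where
    supp⊆σ : supp t ⊆ σ
    supp⊆σ = supp-⊆ t (λ v → proj₂ (t∈ v))
    cases : Dec (∣ supp t ∣ ≡ suc j) → Q′ t ≡ fillAt σ t
    cases (yes e) = cong (λ ρ → fillAt ρ t) (⊆∧∣∣≡⇒≡ supp⊆σ (ℕ.≤-reflexive (trans ∣σ∣ (sym e))))
    cases (no ne) = let v , v∈ , v∉ = ⊆-strict supp⊆σ (λ e → ne (trans e ∣σ∣)) in
      trans (pickAt-low (supp t) (top? (supp t)) (bound≤ (supp t)) t ne)
        (sym (pickAt-boundary σ (top? σ) (bound≤ σ) t v∈ (inj₁ (∉-supp t v∉))))

  pickAt-simplex : ∀ {σ} (d : Dec (Top σ)) le → Top σ → ∀ τ (p : Fin m → Vec ℕ m) →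
    (∀ {v} → v ∈ τ → InCube σ (p v) × pickAt σ d le (p v) ≡ v) → (∀ {u v} → u ∈ τ → v ∈ τ → Close (p u) (p v)) → Simplex K τ
  pickAt-simplex (yes T) le _ = Filled.Finer.pick-simplex T L′ le h (proj₁ (proj₂ h-data)) L′h
  pickAt-simplex (no ¬T) le T = ⊥-elim (¬T T)

  lookup-retract : ∀ t v → lookup (retract t) v ≡ reduce h (lookup t v)
  lookup-retract t v = Vec.lookup-map v (reduce h) t

  retract-simplicial : ∀ {σ} → Simplex K σ → ∣ σ ∣ ℕ.≤ j → ∀ τ (p : Fin m → Vec ℕ m) →
    (∀ {v} → v ∈ τ → InCube σ (p v) × Q′ (p v) ≡ v) → (∀ {u v} → u ∈ τ → v ∈ τ → Close (p u) (p v)) → Simplex K τ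
  retract-simplicial {σ} Kσ ∣σ∣ τ p spec close = simplicial Kσ ∣σ∣ τ (retract ∘ p) spec′ close′
    where
    spec′ : ∀ {v} → v ∈ τ → Cubes.InCube (L ℕ.+ L) σ (retract (p v)) × Q (retract (p v)) ≡ v
    spec′ {v} v∈ = (λ u → subst (ℕ._≤ N) (sym (lookup-retract (p v) u)) (round≤ N _) ,
        λ u∉ → trans (lookup-retract (p v) u) (trans (cong (reduce h) (proj₂ (proj₁ (spec v∈) u) u∉)) (reduce-0 h))) ,
      trans (sym (pickAt-low (supp (p v)) (top? (supp (p v))) (bound≤ (supp (p v))) (p v)
        (ℕ.<⇒≢ (s≤s (ℕ.≤-trans (p⊆q⇒∣p∣≤∣q∣ (supp-⊆ (p v) (λ u → proj₂ (proj₁ (spec v∈) u)))) ∣σ∣))))) (proj₂ (spec v∈))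
    close′ : ∀ {u v} → u ∈ τ → v ∈ τ → Cubes.Close (L ℕ.+ L) (retract (p u)) (retract (p v))
    close′ {u} {v} u∈ v∈ a rewrite lookup-retract (p u) a | lookup-retract (p v) a =
      reduce-close (proj₁ (close u∈ v∈ a)) , reduce-close (proj₂ (close u∈ v∈ a))

  gridMap : GridMap K (L′ ℕ.+ L′) (suc j) Q′
  gridMap = record { simplicial = simplicial′ ; base = base′ }
    where
    simplicial′ : ∀ {σ} → Simplex K σ → ∣ σ ∣ ℕ.≤ suc j → ∀ τ (p : Fin m → Vec ℕ m) →
      (∀ {v} → v ∈ τ → InCube σ (p v) × Q′ (p v) ≡ v) → (∀ {u v} → u ∈ τ → v ∈ τ → Close (p u) (p v)) → Simplex K τ
    simplicial′ {σ} Kσ ≤sj τ p spec close = cases (ℕ.m≤n⇒m<n∨m≡n ≤sj)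
      where
      cases : ∣ σ ∣ ℕ.< suc j ⊎ ∣ σ ∣ ≡ suc j → Simplex K τ
      cases (inj₁ lt) = retract-simplicial Kσ (ℕ.≤-pred lt) τ p spec close
      cases (inj₂ e)  = pickAt-simplex (top? σ) (bound≤ σ) (Kσ , e) τ p
        (λ {v} v∈ → proj₁ (spec v∈) , trans (sym (Q′≡fillAt (p v) e (proj₁ (spec v∈)))) (proj₂ (spec v∈))) close
    0<N′ : 0 ℕ.< L′ ℕ.+ L′
    0<N′ = ℕ.≤-trans 0<L′ (ℕ.m≤m+n L′ L′)
    -- At the base `Q′` is the old label of the retracted point. As `reduce` sends 0 to 0, a
    -- coordinate that is positive after retraction was positive before.
    base′ : ∀ t v → lookup t v ≡ L′ ℕ.+ L′ → 0 ℕ.< lookup t (Q′ t)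
    base′ t v e = subst (λ q → 0 ℕ.< lookup t q)
      (sym (pickAt-boundary (supp t) (top? (supp t)) (bound≤ (supp t)) t (∈-supp t (subst (0 ℕ.<_) (sym e) 0<N′)) (inj₂ e)))
      (ℕ.n≢0⇒n>0 λ z → ℕ.<⇒≢ (base (retract t) v (trans (lookup-retract t v) (trans (cong (reduce h) e) reduce-N)))
        (sym (trans (lookup-retract t (Q (retract t))) (trans (cong (reduce h) z) (reduce-0 h)))))

module _ {m} (K : Complex m) where

  -- For s = 0 only the cone over `∅`, the apex, has to be simplicial, so the label `b` suffices
  -- there. Elsewhere a coordinate equal to N = 2, if there is one, is taken as the label to satisfy
  -- the Sperner condition.
  cone-apex : HasVertex K → ∃[ Q ] GridMap K 2 0 Q
  cone-apex (b , Kb) = Q₀ , record { simplicial = simp ; base = base₀ }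
    where
    peak? : ∀ t → Dec (∃[ v ] lookup t v ≡ 2)
    peak? t = Fin.any? (λ v → lookup t v ℕ.≟ 2)
    Q₀ : Vec ℕ m → Fin m
    Q₀ t with peak? t
    ... | yes (v , _) = v
    ... | no  _       = b
    base₀ : ∀ t v → lookup t v ≡ 2 → 0 ℕ.< lookup t (Q₀ t)
    base₀ t v e with peak? t
    ... | yes (w , e′) = subst (0 ℕ.<_) (sym e′) (s≤s z≤n)
    ... | no ¬p        = ⊥-elim (¬p (v , e))
    Q₀-0 : ∀ t → (∀ v → lookup t v ≡ 0) → Q₀ t ≡ b
    Q₀-0 t z with peak? t
    ... | no _        = refl
    ... | yes (w , e) = ⊥-elim (ℕ.0≢1+n (trans (sym (z w)) e))
    simp : ∀ {σ} → Simplex K σ → ∣ σ ∣ ℕ.≤ 0 → ∀ τ (p : Fin m → Vec ℕ m) →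
      (∀ {v} → v ∈ τ → Cubes.InCube 2 σ (p v) × Q₀ (p v) ≡ v) →
      (∀ {u v} → u ∈ τ → v ∈ τ → Cubes.Close 2 (p u) (p v)) → Simplex K τ
    simp {σ} Kσ le τ p spec _ = down-closed K τ⊆ Kb
      where
      τ⊆ : τ ⊆ ⁅ b ⁆
      τ⊆ {v} v∈ = subst (_∈ ⁅ b ⁆) (trans (sym (Q₀-0 (p v) λ u → proj₂ (proj₁ (spec v∈) u)
        (λ u∈ → ∉⊥ (subst (u ∈_) (∣σ∣≡0⇒∅ σ (ℕ.n≤0⇒n≡0 le)) u∈)))) (proj₂ (spec v∈))) (x∈⁅x⁆ b)

  gridMaps : ∀ s → HasVertex K → (∀ j → j ℕ.< s → SphereMapsExtend K j) →
    ∃[ L ] (0 ℕ.< L × ∃[ Q ] GridMap K (L ℕ.+ L) s Q)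
  gridMaps zero    hv _   = 1 , s≤s z≤n , cone-apex hv
  gridMaps (suc j) hv ext = let L , 0<L , Q , G = gridMaps j hv (λ i lt → ext i (ℕ.m<n⇒m<1+n lt))
                                open Step K 0<L G (ext j (ℕ.n<1+n j))
                            in L′ , 0<L′ , Q′ , gridMap

  connected⇒acyclic : ∀ s → HasVertex K → (∀ j → j ℕ.< s → SphereMapsExtend K j) → Acyclic (Simplex K) s
  connected⇒acyclic s hv ext = let _ , _ , _ , G = gridMaps s hv ext in gridMap⇒acyclic K G (simplex? K)

-- The partition and the theorem

acyclic-resp : ∀ {m} {S S′ : Subset m → Set} {k} → (∀ {σ} → S σ → S′ σ) → (∀ {σ} → S′ σ → S σ) → Acyclic S k → Acyclic S′ k
acyclic-resp f g acyclic z z-on ∂z = let b , b-on , ∂b = acyclic z (λ σ ¬p → z-on σ λ (s , e) → ¬p (g s , e)) ∂z in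
  b , (λ σ ¬p → b-on σ λ (s , e) → ¬p (f s , e)) , ∂b

homology⇒acyclic : ∀ {m} (K : Complex m) j → ReducedHomologyVanishes K j → Acyclic (Simplex K) (suc j)
homology⇒acyclic K j vanishes z z-on ∂z = coeff b , b-on , λ σ → trans (sym (∂≗∂ʳ (coeff b) σ)) (∂b σ)
  where
  cycle : Chain K (suc j)
  cycle = record { coeff = z ; supported = λ σ ne → on σ ne (simplex? K σ ×-dec (∣ σ ∣ ℕ.≟ suc j)) }
    where
    on : ∀ σ → z σ ≢ 0ℚ → Dec (Simplex K σ × ∣ σ ∣ ≡ suc j) → Simplex K σ × ∣ σ ∣ ≡ suc j
    on σ ne (yes p) = p
    on σ ne (no ¬p) = ⊥-elim (ne (z-on σ ¬p))
  filled : Σ[ b ∈ Chain K (suc (suc j)) ] (∀ σ → ∂ (coeff b) σ ≡ z σ)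
  filled = vanishes cycle (λ τ → trans (∂≗∂ʳ z τ) (∂z τ))
  b : Chain K (suc (suc j))
  b = proj₁ filled
  ∂b : ∀ σ → ∂ (coeff b) σ ≡ z σ
  ∂b = proj₂ filled
  b-on : On (λ σ → Simplex K σ × ∣ σ ∣ ≡ suc (suc j)) (coeff b)
  b-on σ ¬p with coeff b σ ℚ.≟ 0ℚ
  ... | yes e = e
  ... | no ne = ⊥-elim (¬p (Chain.supported b σ ne))

-- For homology in positive cardinality the condition in the same dimension is used directly; the
-- homotopical argument climbs through all lower skeleta.
connected-at⇒acyclic : ∀ {m} t (K : Complex m) s → (∀ s′ → s′ ℕ.≤ s → Connected-at t K s′) → Acyclic (Simplex K) s
connected-at⇒acyclic t K zero    conn = connected⇒acyclic K 0 (conn 0 z≤n) λ j ()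
connected-at⇒acyclic π K (suc j) conn = connected⇒acyclic K (suc j) (conn 0 z≤n) λ i lt → conn (suc i) lt
connected-at⇒acyclic H K (suc j) conn = homology⇒acyclic K j (conn (suc j) ℕ.≤-refl)

∈-⋃⁺ : ∀ {m n} (V : Fin n → Subset m) {v i is} → i ∈ˡ is → v ∈ V i → v ∈ ⋃ (map V is)
∈-⋃⁺ V (here refl) v∈ = x∈p∪q⁺ (inj₁ v∈)
∈-⋃⁺ V (there i∈)  v∈ = x∈p∪q⁺ (inj₂ (∈-⋃⁺ V i∈ v∈))

∈-⋃⁻ : ∀ {m n} (V : Fin n → Subset m) {v} is → v ∈ ⋃ (map V is) → ∃[ i ] (i ∈ˡ is × v ∈ V i)
∈-⋃⁻ V []       v∈ = ⊥-elim (∉⊥ v∈)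
∈-⋃⁻ V (i ∷ is) v∈ with x∈p∪q⁻ (V i) _ v∈
... | inj₁ p = i , here refl , p
... | inj₂ p = let i′ , i∈ , q = ∈-⋃⁻ V is p in i′ , there i∈ , q

∣p∣≤1⇒unique : ∀ {m} {p : Subset m} → ∣ p ∣ ℕ.≤ 1 → ∀ {u v} → u ∈ p → v ∈ p → u ≡ v
∣p∣≤1⇒unique {p = p} le u∈ v∈ with ∣J∣≤1⇒ p le
... | inj₁ refl       = ⊥-elim (∉⊥ u∈)
... | inj₂ (i , refl) = trans (x∈⁅y⁆⇒x≡y i u∈) (sym (x∈⁅y⁆⇒x≡y i v∈))

unique⇒∣p∣≤1 : ∀ {m} (p : Subset m) → (∀ {u v} → u ∈ p → v ∈ p → u ≡ v) → ∣ p ∣ ℕ.≤ 1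
unique⇒∣p∣≤1 {m} p uniq with nonempty? p
... | no  em       = ℕ.≤-trans (ℕ.≤-reflexive (trans (cong ∣_∣ (Empty-unique em)) (∣⊥∣≡0 m))) z≤n
... | yes (w , w∈) = ℕ.≤-trans (p⊆q⇒∣p∣≤∣q∣ {q = ⁅ w ⁆} (λ v∈ → subst (_∈ ⁅ w ⁆) (uniq w∈ v∈) (x∈⁅x⁆ w))) (ℕ.≤-reflexive (∣⁅x⁆∣≡1 w))

[s+d]-d : ∀ s d → + (s ℕ.+ d) - + d ≡ + s
[s+d]-d s d = trans (cong (_- + d) (ℤ.pos-+ s d)) (trans (ℤ.+-assoc (+ s) (+ d) (ℤ.- + d))
  (trans (cong (λ z → + s + z) (ℤ.+-inverseʳ (+ d))) (ℤ.+-identityʳ (+ s))))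

r≡n-d⇒r+d≡n : ∀ {r n d} → + r ≡ + n - + d → r ℕ.+ d ≡ n
r≡n-d⇒r+d≡n {r} {n} {d} e = ℤ.+-injective (trans (ℤ.pos-+ r d) (trans (cong (_+ + d) e)
  (trans (ℤ.+-assoc (+ n) (ℤ.- + d) (+ d)) (trans (cong (λ z → + n + z) (ℤ.+-inverseˡ (+ d))) (ℤ.+-identityʳ (+ n))))))

module Coloring {m n} (C : Complex m) (V : Fin (suc n) → Subset m) (partition : IsPartition C V) where
  open IsPartition partition

  -- Elements of the ground set that are not vertices have no color of their own and receive `zero`;
  -- this is why the number of colors is a successor.
  κ : Fin m → Fin (suc n)
  κ v with Fin.any? (λ i → v ∈? V i)
  ... | yes (i , _) = i
  ... | no  _       = zero

  κ-unique : ∀ {v i} → v ∈ V i → κ v ≡ i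
  κ-unique {v} {i} v∈ with Fin.any? (λ i → v ∈? V i)
  ... | no ¬p = ⊥-elim (¬p (i , v∈))
  ... | yes (i′ , v∈′) with i′ Fin.≟ i
  ...   | yes e = e
  ...   | no ne = ⊥-elim (disjoint ne (v , x∈p∩q⁺ (v∈′ , v∈)))

  κ-∈ : ∀ {σ v} → Simplex C σ → v ∈ σ → v ∈ V (κ v)
  κ-∈ {σ} {v} Cσ v∈ = let i , v∈i = Equivalence.to (covers v) (down-closed C (λ u∈ → subst (_∈ σ) (sym (x∈⁅y⁆⇒x≡y v u∈)) v∈) Cσ) in
    subst (λ i → v ∈ V i) (sym (κ-unique v∈i)) v∈i

  open Colored C κ using (Over)

  over⇒induced : ∀ {I σ} → Over I σ → Simplex (C [ ⋃[ I ] V ]) σ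
  over⇒induced {I} (Cσ , col) = Cσ , λ v∈ → ∈-⋃⁺ V (∈-filter⁺ (_∈? I) (∈-allFin _) (col v∈)) (κ-∈ Cσ v∈)

  induced⇒over : ∀ {I σ} → Simplex (C [ ⋃[ I ] V ]) σ → Over I σ
  induced⇒over {I} (Cσ , σ⊆) = Cσ , λ v∈ → let i , i∈ , v∈i = ∈-⋃⁻ V (filter (_∈? I) (allFin _)) (σ⊆ v∈) in
    subst (_∈ I) (sym (κ-unique v∈i)) (proj₂ (∈-filter⁻ (_∈? I) {xs = allFin _} i∈))

  colorful⇒injective : ∀ {σ} → PartialColorful C V σ → InjectiveOn κ σ
  colorful⇒injective {σ} pc {u} {v} u∈ v∈ e = ∣p∣≤1⇒unique (PartialColorful.colorful pc (κ u))
    (x∈p∩q⁺ (u∈ , κ-∈ (PartialColorful.simplex pc) u∈))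
    (x∈p∩q⁺ (v∈ , subst (λ i → v ∈ V i) (sym e) (κ-∈ (PartialColorful.simplex pc) v∈)))

  injective⇒colorful : ∀ {σ} → Simplex C σ → InjectiveOn κ σ → PartialColorful C V σ
  injective⇒colorful {σ} Cσ inj = record { simplex = Cσ ; colorful = λ i → unique⇒∣p∣≤1 (σ ∩ V i) λ u∈ v∈ →
    let u∈σ , u∈i = x∈p∩q⁻ σ (V i) u∈ ; v∈σ , v∈i = x∈p∩q⁻ σ (V i) v∈ in
    inj u∈σ v∈σ (trans (κ-unique u∈i) (sym (κ-unique v∈i))) }

theorem6p1 : ∀ {m n : ℕ} (C : Complex m) (V : Fin n → Subset m) → IsPartition C V →
    (d : ℕ) (t : Theory) →
    (∀ (I : Subset n) → Nonempty I → η[ t ] C [ ⋃[ I ] V ] ≥ (+ ∣ I ∣ - + d + + 1)) →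
    Connected (RG C V (+ n - + d))
-- Without colors there are no vertices, and `∅` is the only simplex.
theorem6p1 {m} {zero} C V partition d t hyp x y (px , ex) (py , ey) = subst (Star _ x) (trans (empty px) (sym (empty py))) done
  where
  empty : ∀ {σ} → PartialColorful C V σ → σ ≡ ∅
  empty pc = Empty-unique λ (v , v∈) → Fin.¬Fin0 (proj₁ (Equivalence.to (IsPartition.covers partition v)
    (down-closed C (λ u∈ → subst (_∈ _) (sym (x∈⁅y⁆⇒x≡y v u∈)) v∈) (PartialColorful.simplex pc))))
theorem6p1 {m} {suc n} C V partition d t hyp x y (px , ex) (py , ey) =
  gmap id step (reconfiguration-connected d C κ r r+d≡n acyclic (config px refl) (config py (ℤ.+-injective (trans ey (sym ex)))))
  where
  open Coloring C V partition
  -- n - d is an integer; the given vertex `x` of the graph shows that it is a natural number.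
  r : ℕ
  r = ∣ x ∣
  r+d≡n : r ℕ.+ d ≡ suc n
  r+d≡n = r≡n-d⇒r+d≡n ex
  open Reconfiguration C κ r
  config : ∀ {σ} → PartialColorful C V σ → ∣ σ ∣ ≡ r → Config σ
  config pc e = PartialColorful.simplex pc , colorful⇒injective pc , e
  vertex : ∀ {σ} → Config σ → PartialColorful C V σ × + ∣ σ ∣ ≡ + suc n - + d
  vertex (Cσ , inj , e) = injective⇒colorful Cσ inj , trans (cong +_ e) ex
  step : ∀ {σ τ} → Move σ τ → (PartialColorful C V σ × + ∣ σ ∣ ≡ + suc n - + d) × (PartialColorful C V τ × + ∣ τ ∣ ≡ + suc n - + d) ×
    Simplex C (σ ∪ τ) × + ∣ σ ∪ τ ∣ ≡ + suc n - + d + 1ℤ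
  step (cσ , cτ , C∪ , e) = vertex cσ , vertex cτ , C∪ , trans (cong +_ (trans e (ℕ.+-comm 1 r))) (cong (_+ 1ℤ) ex)
  acyclic : ∀ I → Nonempty I → ∀ s → s ℕ.+ d ≡ ∣ I ∣ → Acyclic (Colored.Over C κ I) s
  acyclic I ne s s+d≡ with hyp I ne
  ... | e , le , conn = acyclic-resp induced⇒over over⇒induced (connected-at⇒acyclic t (C [ ⋃[ I ] V ]) s
      λ s′ s′≤s → conn s′ (ℕ.≤-<-trans s′≤s s<e))
    where
    -- |I| - d + 1 = s + 1 is at most e, so the conditions hold up to and including index s, that
    -- is, dimension s - 1.
    s<e : s ℕ.< e
    s<e = ℤ.drop‿+≤+ (subst (ℤ._≤ + e) (trans (cong (λ k → + k - + d + + 1) (sym s+d≡)) (trans (cong (_+ + 1) ([s+d]-d s d)) (cong +_ (ℕ.+-comm s 1)))) le)
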